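{- Let $p$ be a prime and let $P(p-1)$ denote the number of integer partitions of $p-1$. (i) If $P(p-1) \not\equiv 1 \pmod p$, then for every integer $j \ge 1$, with $n = p^2 j - p - 1$, the number of coefficients of $p_n(b)$ congruent to $r$ modulo $p$ is the same for every $r \in \{1,2,\dots,p-1\}$. (ii) If $P(p-1) \equiv 1 \pmod p$, then for every integer $j \ge 1$, with $n = p^3 j - p^2 - p - 1$, the number of coefficients of $p_n(b)$ congruent to $r$ modulo $p$ is the same for every $r \in \{1,2,\dots,p-1\}$.
   Context: For a complex indeterminate $b$, define polynomials $p_n(b)$ by the formal power series identity $\prod_{k=1}^{\infty} (1-q^k)^{b-1} = \sum_{n=0}^{\infty} \frac{q^n}{n!}\, p_n(b)$. Each $p_n(b)$ is a polynomial of degree $n$ in $b$ with integer coefficients. -}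

module Defs where

open import Data.Nat as ℕ using (ℕ; zero; suc; _∸_; _≤_; _<_; _≤?_)
open import Data.Nat.Divisibility using (_∣_; _∣?_)
open import Data.Nat using (_!)
open import Data.Nat.Properties using (_!≢0)
import Data.Integer.Divisibility as ℤDiv
open import Data.Integer as ℤ using (ℤ; +_; ∣_∣)
open import Data.Rational as ℚ using (ℚ; 0ℚ; 1ℚ; _+_; _*_; -_; _-_)
open import Data.List using (foldr; List; []; _∷_; [_]; length; filter; concatMap; map; upTo; applyUpTo)
open import Data.Product using (_×_)
open import Relation.Binary.PropositionalEquality using (_≡_)
open import Relation.Nullary using (Dec; yes; no)
open import Relation.Nullary.Decidable using (_×-dec_)

-- partitionsBounded f m k : the partitions of m into positive parts ≤ k,
-- each written as a non-increasing list of parts.  f is fuel (f ≥ m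
-- suffices, since each step removes a part ≥ 1).
partitionsBounded : ℕ → ℕ → ℕ → List (List ℕ)
partitionsBounded _       zero    _ = [ [] ]
partitionsBounded zero    (suc m) _ = []
partitionsBounded (suc f) (suc m) k =
  concatMap (λ i → map (i ∷_) (partitionsBounded f (suc m ∸ i) i))
            (filter (λ i → i ≤? suc m) (applyUpTo suc k))

partitions : ℕ → List (List ℕ)
partitions m = partitionsBounded m m m

P : ℕ → ℕ
P m = length (partitions m)

-- Polynomials in the indeterminate b with rational coefficients,
-- as coefficient lists (constant term first).

Poly : Set
Poly = List ℚ

_+ₚ_ : Poly → Poly → Poly
[]       +ₚ g        = g
(a ∷ f)  +ₚ []       = a ∷ f
(a ∷ f)  +ₚ (c ∷ g)  = (a + c) ∷ (f +ₚ g)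

_·ₚ_ : ℚ → Poly → Poly
c ·ₚ f = map (c *_) f

_*ₚ_ : Poly → Poly → Poly
[]      *ₚ g = []
(a ∷ f) *ₚ g = (a ·ₚ g) +ₚ (0ℚ ∷ (f *ₚ g))

constₚ : ℚ → Poly
constₚ c = [ c ]

bₚ : Poly
bₚ = 0ℚ ∷ 1ℚ ∷ []

ℕ→ℚ : ℕ → ℚ
ℕ→ℚ n = (+ n) ℚ./ 1

binomₚ : Poly → ℕ → Poly
binomₚ x m = (((+ 1) ℚ./ (m !)) {{m !≢0}}) ·ₚ fall m
  where
  fall : ℕ → Poly
  fall zero    = constₚ 1ℚ
  fall (suc i) = fall i *ₚ (x +ₚ constₚ (- ℕ→ℚ i))

-- Formal power series in q with coefficients in ℚ[b],
-- given by their coefficient functions.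

Series : Set
Series = ℕ → Poly

sumₚ : List Poly → Poly
sumₚ = foldr _+ₚ_ []

_⋆_ : Series → Series → Series
(f ⋆ g) n = sumₚ (map (λ i → f i *ₚ g (n ∸ i)) (upTo (suc n)))

oneₛ : Series
oneₛ zero    = constₚ 1ℚ
oneₛ (suc _) = []

-- (1 - q^k)^(b-1) = Σ_m binom(b-1, m) (-1)^m q^(k m), for k = suc k'
signₚ : ℕ → Poly → Poly
signₚ zero    f = f
signₚ (suc m) f = (- 1ℚ) ·ₚ signₚ m f

factor : ℕ → Series
factor k' i with suc k' ∣? i
... | yes _ = signₚ (i ℕ./ suc k') (binomₚ (bₚ +ₚ constₚ (- 1ℚ)) (i ℕ./ suc k'))
... | no  _ = []

-- Coefficient of q^n in ∏_{k ≥ 1} (1 - q^k)^(b-1).  Factors with k > n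
-- are ≡ 1 modulo q^(n+1), so the finite product over k = 1..n gives the
-- coefficient of q^n of the infinite product.
prodCoeff : ℕ → Poly
prodCoeff n = foldr _⋆_ oneₛ (map factor (upTo n)) n

-- p_n(b) = n! · [q^n] ∏_{k ≥ 1} (1 - q^k)^(b-1), as a coefficient list
-- (constant term first; possibly with trailing zeros).
pPoly : ℕ → Poly
pPoly n = ℕ→ℚ (n !) ·ₚ prodCoeff n

IntCong : ℤ → ℤ → ℕ → Set
IntCong a b m = (+ m) ℤDiv.∣ (a ℤ.- b)

CongQ : ℚ → ℤ → ℕ → Set
CongQ c r m = (ℚ.denominator-1 c ≡ 0) × (IntCong (ℚ.numerator c) r m)

congQ? : ∀ c r m → Dec (CongQ c r m)
congQ? c r m = (ℚ.denominator-1 c ℕ.≟ 0) ×-dec (m ∣? ∣ ℚ.numerator c ℤ.- r ∣)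

countCong : ℕ → ℤ → Poly → ℕ
countCong m r f = length (filter (λ c → congQ? c r m) f)

-- Write p_n = n! [q^n] ∏ (1 − q^k)^(b−1). Shifting the index n is a derivation of the ring of
-- exponential generating functions, and its p-th power is again a derivation modulo p. It annihilates
-- the factors with k ≥ 2 modulo p, and multiplies the factor with k = 1 by
-- (1 − b) (2 − b) ⋯ (p − b) ≡ b − b^p. Hence p_(kp+r) ≡ (b − b^p)^k p_r.
--
-- For r = p − 1 put d = p − 1. Up to the factor b^k this is (1 − b^d)^k p_d, whose coefficients with
-- indices in a fixed class modulo d form the series (1 − X)^k (x + y X), where (x, y) is either
-- (c, 0) or the pair of the constant and the leading coefficient of p_d, which are
-- d! P(d) ≡ −P(d) and (−1)^d ≡ 1. Since x + y X = (1 − X)² Σ (x + l (x + y)) X^l, for k + 2 = p j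
-- this series is (1 − X^p)^j Σ (x + l (x + y)) X^l. Each block of p coefficients is a multiple of
-- an arithmetic progression, which runs through all residues unless x + y ≡ 0. In the latter case
-- the blocks are constant and the series (1 − X)^j / (1 − X) of their values has the first form.
module Submission where

open import Defs
open import Algebra.Bundles using (CommutativeRing)
import Algebra.Properties.AbelianGroup as AbelianGroupProperties
import Algebra.Properties.CommutativeMonoid.Mult as CommutativeMonoidMult
import Algebra.Properties.CommutativeSemigroup as CommutativeSemigroupProperties
import Algebra.Properties.Ring as RingProperties
import Algebra.Properties.Semiring.Exp as SemiringExp
import Algebra.Properties.Semiring.Mult as SemiringMult
open import Data.Bool using (if_then_else_; true; false)
open import Data.Integer as ℤ using (ℤ; +_; 0ℤ; 1ℤ; -1ℤ)
import Data.Integer.DivMod as ℤDivMod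
import Data.Integer.Divisibility.Signed as ℤDiv
import Data.Integer.Properties as ℤₚ
import Data.Integer.Tactic.RingSolver as ℤSolver
open import Data.List using (List; []; _∷_; [_]; _∷ʳ_; _++_; foldr; applyUpTo; concatMap; filter; map; length)
open import Data.List.Properties using (applyUpTo-∷ʳ; foldr-∷ʳ; map-upTo; filter-++; concatMap-++; length-++; length-map; filter-accept; filter-reject; ++-identityʳ)
open import Data.Nat as ℕ using (ℕ; zero; suc; _!; _∸_; _≤?_; s≤s; z≤n)
import Data.Nat.Coprimality as Coprimality
open import Data.Nat.Divisibility using (_∣_; _∣?_; divides; ∣⇒≤; m≤n⇒m!∣n!; _∣0; 1∣_; ∣m⇒∣m*n; ∣n⇒∣m*n; ∣m∣n⇒∣m+n; ∣m+n∣m⇒∣n; ∣-refl; ∣-trans)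
open import Data.Nat.DivMod using (m/n*n≡m; m*n/n≡m; n/1≡n; m/n*n≤m; m≡m%n+[m/n]*n; m%n<n; m/n≤m; m/n<m)
open import Data.Nat.GeneralisedArithmetic using (fold; fold-+)
open import Data.Nat.Primality using (Prime; euclidsLemma; ¬prime[0]; ¬prime[1]; prime⇒nonZero)
import Data.Nat.Properties as ℕₚ
open import Data.Nat.Properties using (_!≢0)
import Data.Nat.Tactic.RingSolver as ℕSolver
open import Data.Product using (_,_; _×_; ∃)
open import Data.Rational as ℚ using (ℚ; 0ℚ; 1ℚ; mkℚ)
import Data.Rational.Properties as ℚₚ
open import Data.Rational.Unnormalised using (mkℚᵘ; *≡*)
import Data.Rational.Unnormalised.Properties as ℚᵘₚ
open import Data.Sum as Sum using (_⊎_; inj₁; inj₂)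
open import Function using (_∘_)
open import Level using (0ℓ)
open import Relation.Binary.Definitions using (tri<; tri≈; tri>)
open import Relation.Binary.PropositionalEquality as ≡ using (_≡_)
import Relation.Binary.Reasoning.Setoid as SetoidReasoning
open import Relation.Nullary using (¬_; Dec; does; yes; no; contradiction)
open import Relation.Nullary.Decidable using (map′; dec-true; dec-false)

-- The definition of p_n lives over ℚ, while the argument needs characteristic p, where n! cannot be
-- inverted. The two are bridged by a product of sequences defined by the Leibniz rule: it
-- multiplies exponential generating functions over any commutative ring, so the integers n! [q^n]
-- are formed for each factor first and multiplied afterwards. The factors with k ≥ 2 die from n = p
-- on, because their coefficients contain n! / m! with m ≤ n / 2 and there is a multiple of p above
-- n / 2 and up to n. The p-th power of the derivation is a derivation because the inner binomial
-- coefficients are multiples of p. The same fact yields the Frobenius map, hence Fermat's theorem,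
-- the congruence for (1 - b) ⋯ (p - b) by counting roots, and (1 - X)^p = 1 - X^p. Residue 0 is
-- left out of the count, so the factor b^k and any padding by zeros are harmless. The second family
-- of indices is the first one with p j - 1 in place of j; this choice makes the exponent left over
-- in the degenerate case again 2 less than a multiple of p.

-- Formal power series over a commutative ring.

module Sequences {c ℓ} (R : CommutativeRing c ℓ) where
  open CommutativeRing R
  open CommutativeSemigroupProperties +-commutativeSemigroup using (interchange; x∙yz≈y∙xz)
  open SetoidReasoning setoid

  Seq : Set c
  Seq = ℕ → Carrier

  infix 4 _≋_
  record _≋_ (f g : Seq) : Set ℓ where
    constructor pointwise
    field at : ∀ n → f n ≈ g n
  open _≋_ public

  tail : Seq → Seq
  tail f n = f (suc n)

  infixl 6 _⊕_
  infixl 7 _⊛_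
  -- `_⊛_` is the Cauchy product, written as f₀ g + X · (tail f) g. The recursion on the index
  -- avoids finite sums, so the ring laws follow by induction.
  _⊕_ _⊛_ : Seq → Seq → Seq
  (f ⊕ g) n = f n + g n
  (f ⊛ g) zero = f 0 * g 0
  (f ⊛ g) (suc n) = f 0 * g (suc n) + (tail f ⊛ g) n

  ⊖_ : Seq → Seq
  (⊖ f) n = - f n

  𝟘 𝟙 : Seq
  𝟘 _ = 0#
  𝟙 zero = 1#
  𝟙 (suc _) = 0#

  ⊛-cong-at : ∀ {f f′ g g′} → (∀ n → f n ≈ f′ n) → (∀ n → g n ≈ g′ n) → ∀ n → (f ⊛ g) n ≈ (f′ ⊛ g′) n
  ⊛-cong-at p q zero = *-cong (p 0) (q 0)
  ⊛-cong-at p q (suc n) = +-cong (*-cong (p 0) (q (suc n))) (⊛-cong-at (p ∘ suc) q n)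

  ⊛-zeroˡ-at : ∀ f g → (∀ n → f n ≈ 0#) → ∀ n → (f ⊛ g) n ≈ 0#
  ⊛-zeroˡ-at f g f≈0 zero = trans (*-congʳ (f≈0 0)) (zeroˡ _)
  ⊛-zeroˡ-at f g f≈0 (suc n) =
    trans (+-cong (trans (*-congʳ (f≈0 0)) (zeroˡ _)) (⊛-zeroˡ-at (tail f) g (f≈0 ∘ suc) n)) (+-identityˡ _)

  -- The defining recursion peels the left factor; this is its mirror image, from which
  -- commutativity follows.
  ⊛-tailʳ : ∀ f g n → (f ⊛ g) (suc n) ≈ f (suc n) * g 0 + (f ⊛ tail g) n
  ⊛-tailʳ f g zero = +-comm _ _
  ⊛-tailʳ f g (suc n) = begin
    f 0 * g (2 ℕ.+ n) + (tail f ⊛ g) (suc n)                          ≈⟨ +-congˡ (⊛-tailʳ (tail f) g n) ⟩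
    f 0 * g (2 ℕ.+ n) + (f (2 ℕ.+ n) * g 0 + (tail f ⊛ tail g) n)   ≈⟨ x∙yz≈y∙xz _ _ _ ⟩
    f (2 ℕ.+ n) * g 0 + (f 0 * g (2 ℕ.+ n) + (tail f ⊛ tail g) n)   ∎

  ⊛-comm-at : ∀ f g n → (f ⊛ g) n ≈ (g ⊛ f) n
  ⊛-comm-at f g zero = *-comm _ _
  ⊛-comm-at f g (suc n) = begin
    f 0 * g (suc n) + (tail f ⊛ g) n  ≈⟨ +-cong (*-comm _ _) (⊛-comm-at (tail f) g n) ⟩
    g (suc n) * f 0 + (g ⊛ tail f) n  ≈⟨ ⊛-tailʳ g f n ⟨
    (g ⊛ f) (suc n)                   ∎

  ⊛-scaleˡ : ∀ a f g n → ((λ i → a * f i) ⊛ g) n ≈ a * (f ⊛ g) n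
  ⊛-scaleˡ a f g zero = *-assoc _ _ _
  ⊛-scaleˡ a f g (suc n) = trans (+-cong (*-assoc _ _ _) (⊛-scaleˡ a (tail f) g n)) (sym (distribˡ _ _ _))

  ⊛-distribʳ-at : ∀ h f g n → ((f ⊕ g) ⊛ h) n ≈ (f ⊛ h) n + (g ⊛ h) n
  ⊛-distribʳ-at h f g zero = distribʳ _ _ _
  ⊛-distribʳ-at h f g (suc n) =
    trans (+-cong (distribʳ _ _ _) (⊛-distribʳ-at h (tail f) (tail g) n)) (interchange _ _ _ _)

  ⊛-distribˡ-at : ∀ h f g n → (h ⊛ (f ⊕ g)) n ≈ (h ⊛ f) n + (h ⊛ g) n
  ⊛-distribˡ-at h f g n = begin
    (h ⊛ (f ⊕ g)) n          ≈⟨ ⊛-comm-at h (f ⊕ g) n ⟩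
    ((f ⊕ g) ⊛ h) n          ≈⟨ ⊛-distribʳ-at h f g n ⟩
    (f ⊛ h) n + (g ⊛ h) n    ≈⟨ +-cong (⊛-comm-at f h n) (⊛-comm-at g h n) ⟩
    (h ⊛ f) n + (h ⊛ g) n    ∎

  ⊛-assoc-at : ∀ f g h n → ((f ⊛ g) ⊛ h) n ≈ (f ⊛ (g ⊛ h)) n
  ⊛-assoc-at f g h zero = *-assoc _ _ _
  ⊛-assoc-at f g h (suc n) = begin
    f 0 * g 0 * h (suc n) + (tail (f ⊛ g) ⊛ h) n
      ≈⟨ +-cong (*-assoc _ _ _) (⊛-distribʳ-at h (λ i → f 0 * tail g i) (tail f ⊛ g) n) ⟩
    f 0 * (g 0 * h (suc n)) + (((λ i → f 0 * tail g i) ⊛ h) n + ((tail f ⊛ g) ⊛ h) n)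
      ≈⟨ +-congˡ (+-cong (⊛-scaleˡ (f 0) (tail g) h n) (⊛-assoc-at (tail f) g h n)) ⟩
    f 0 * (g 0 * h (suc n)) + (f 0 * (tail g ⊛ h) n + (tail f ⊛ (g ⊛ h)) n)
      ≈⟨ +-assoc _ _ _ ⟨
    f 0 * (g 0 * h (suc n)) + f 0 * (tail g ⊛ h) n + (tail f ⊛ (g ⊛ h)) n
      ≈⟨ +-congʳ (distribˡ _ _ _) ⟨
    f 0 * (g ⊛ h) (suc n) + (tail f ⊛ (g ⊛ h)) n ∎

  ⊛-identityˡ-at : ∀ f n → (𝟙 ⊛ f) n ≈ f n
  ⊛-identityˡ-at f zero = *-identityˡ _
  ⊛-identityˡ-at f (suc n) =
    trans (+-cong (*-identityˡ _) (⊛-zeroˡ-at (tail 𝟙) f (λ _ → refl) n)) (+-identityʳ _)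

  powerSeriesRing : CommutativeRing c ℓ
  powerSeriesRing = record
    { Carrier = Seq ; _≈_ = _≋_ ; _+_ = _⊕_ ; _*_ = _⊛_ ; -_ = ⊖_ ; 0# = 𝟘 ; 1# = 𝟙
    ; isCommutativeRing = record
      { isRing = record
        { +-isAbelianGroup = record
          { isGroup = record
            { isMonoid = record
              { isSemigroup = record
                { isMagma = record
                  { isEquivalence = record
                    { refl = pointwise λ _ → refl
                    ; sym = λ p → pointwise λ n → sym (at p n)
                    ; trans = λ p q → pointwise λ n → trans (at p n) (at q n)
                    }
                  ; ∙-cong = λ p q → pointwise λ n → +-cong (at p n) (at q n)
                  }
                ; assoc = λ _ _ _ → pointwise λ _ → +-assoc _ _ _
                }
              ; identity = (λ _ → pointwise λ _ → +-identityˡ _) , (λ _ → pointwise λ _ → +-identityʳ _)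
              }
            ; inverse = (λ _ → pointwise λ _ → -‿inverseˡ _) , (λ _ → pointwise λ _ → -‿inverseʳ _)
            ; ⁻¹-cong = λ p → pointwise λ n → -‿cong (at p n)
            }
          ; comm = λ _ _ → pointwise λ _ → +-comm _ _
          }
        ; *-cong = λ p q → pointwise (⊛-cong-at (at p) (at q))
        ; *-assoc = λ f g h → pointwise (⊛-assoc-at f g h)
        ; *-identity = (λ f → pointwise (⊛-identityˡ-at f))
                     , (λ f → pointwise λ n → trans (⊛-comm-at f 𝟙 n) (⊛-identityˡ-at f n))
        ; distrib = (λ h f g → pointwise (⊛-distribˡ-at h f g)) , (λ h f g → pointwise (⊛-distribʳ-at h f g))
        }
      ; *-comm = λ f g → pointwise (⊛-comm-at f g)
      }
    }

-- Products of exponential generating functions without division.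

-- Coefficients of exponential generating functions: (f ⊠ g) n is the n-th coefficient of the
-- product, defined through the Leibniz rule, the derivative being the shift of sequences.
module Hurwitz {c ℓ} (R : CommutativeRing c ℓ) where
  open CommutativeRing R
  open SemiringMult semiring using (×-comm-*; ×-congʳ; ×-assocˡ; ×-homo-1)
    renaming (_×_ to _×ᵣ_)
  open CommutativeMonoidMult +-commutativeMonoid using (×-distrib-+)
  open Sequences R using (Seq; tail; _⊛_; ⊛-distribʳ-at)
  open SetoidReasoning setoid

  infixl 7 _⊠_
  _⊠_ : Seq → Seq → Seq
  (f ⊠ g) zero = f 0 * g 0
  (f ⊠ g) (suc n) = (tail f ⊠ g) n + (f ⊠ tail g) n

  ⊠-cong : ∀ {f f′ g g′} → (∀ n → f n ≈ f′ n) → (∀ n → g n ≈ g′ n) → ∀ n → (f ⊠ g) n ≈ (f′ ⊠ g′) n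
  ⊠-cong p q zero = *-cong (p 0) (q 0)
  ⊠-cong p q (suc n) = +-cong (⊠-cong (p ∘ suc) q n) (⊠-cong p (q ∘ suc) n)

  ⊠-scaleˡ : ∀ a f g n → ((λ i → a * f i) ⊠ g) n ≈ a * (f ⊠ g) n
  ⊠-scaleˡ a f g zero = *-assoc _ _ _
  ⊠-scaleˡ a f g (suc n) =
    trans (+-cong (⊠-scaleˡ a (tail f) g n) (⊠-scaleˡ a f (tail g) n)) (sym (distribˡ _ _ _))

  ⊠-comm : ∀ f g n → (f ⊠ g) n ≈ (g ⊠ f) n
  ⊠-comm f g zero = *-comm _ _
  ⊠-comm f g (suc n) = trans (+-cong (⊠-comm (tail f) g n) (⊠-comm f (tail g) n)) (+-comm _ _)

  ⊠-scaleʳ : ∀ a f g n → (f ⊠ (λ i → a * g i)) n ≈ a * (f ⊠ g) n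
  ⊠-scaleʳ a f g n =
    trans (⊠-comm f _ n) (trans (⊠-scaleˡ a g f n) (*-congˡ (⊠-comm g f n)))

  ⊠-zeroʳ : ∀ f g → (∀ n → g n ≈ 0#) → ∀ n → (f ⊠ g) n ≈ 0#
  ⊠-zeroʳ f g g≈0 zero = trans (*-congˡ (g≈0 0)) (zeroʳ _)
  ⊠-zeroʳ f g g≈0 (suc n) =
    trans (+-cong (⊠-zeroʳ (tail f) g g≈0 n) (⊠-zeroʳ f (tail g) (g≈0 ∘ suc) n)) (+-identityˡ _)

  ⊠-identityʳ : ∀ f g → g 0 ≈ 1# → (∀ n → g (suc n) ≈ 0#) → ∀ n → (f ⊠ g) n ≈ f n
  ⊠-identityʳ f g g0 g+ zero = trans (*-congˡ g0) (*-identityʳ _)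
  ⊠-identityʳ f g g0 g+ (suc n) =
    trans (+-cong (⊠-identityʳ (tail f) g g0 g+ n) (⊠-zeroʳ f (tail g) g+ n)) (+-identityʳ _)

  derivative : Seq → Seq
  derivative f n = suc n ×ᵣ f (suc n)

  -- Write f = f₀ + X f′. Then n + 2 copies of (f′ ⊛ g) (n + 1) are one copy plus the derivative of
  -- f′ ⊛ g at n, and the single copy makes up the difference between `derivative f` and X ·
  -- `derivative f′`.
  derivative-⊛ : ∀ f g n → derivative (f ⊛ g) n ≈ (derivative f ⊛ g) n + (f ⊛ derivative g) n
  derivative-⊛ f g zero = begin
    1 ×ᵣ (f 0 * g 1 + f 1 * g 0)               ≈⟨ ×-homo-1 _ ⟩
    f 0 * g 1 + f 1 * g 0                      ≈⟨ +-comm _ _ ⟩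
    f 1 * g 0 + f 0 * g 1                      ≈⟨ +-cong (*-congʳ (×-homo-1 _)) (*-congˡ (×-homo-1 _)) ⟨
    1 ×ᵣ f 1 * g 0 + f 0 * (1 ×ᵣ g 1)          ∎
  derivative-⊛ f g (suc n) = begin
    (2 ℕ.+ n) ×ᵣ (f 0 * g (2 ℕ.+ n) + (f′ ⊛ g) (suc n))
      ≈⟨ ×-distrib-+ _ _ (2 ℕ.+ n) ⟩
    (2 ℕ.+ n) ×ᵣ (f 0 * g (2 ℕ.+ n)) + ((f′ ⊛ g) (suc n) + derivative (f′ ⊛ g) n)
      ≈⟨ +-cong (sym (×-comm-* (2 ℕ.+ n) _ _)) (+-congˡ (derivative-⊛ f′ g n)) ⟩
    f 0 * derivative g (suc n) + (f′ 0 * g (suc n) + (tail f′ ⊛ g) n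
      + ((derivative f′ ⊛ g) n + (f′ ⊛ derivative g) n))
      ≈⟨ +-congˡ (+-assoc _ _ _) ⟩
    f 0 * derivative g (suc n) + (f′ 0 * g (suc n) + ((tail f′ ⊛ g) n
      + ((derivative f′ ⊛ g) n + (f′ ⊛ derivative g) n)))
      ≈⟨ +-congˡ (+-congˡ (sym (+-assoc _ _ _))) ⟩
    f 0 * derivative g (suc n) + (f′ 0 * g (suc n) + ((tail f′ ⊛ g) n
      + (derivative f′ ⊛ g) n + (f′ ⊛ derivative g) n))
      ≈⟨ +-congˡ (+-cong (*-congʳ (sym (×-homo-1 _))) (+-congʳ (sym (⊛-distribʳ-at g (tail f′) (derivative f′) n)))) ⟩
    f 0 * derivative g (suc n) + (derivative f 0 * g (suc n) + ((tail (derivative f) ⊛ g) n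
      + (f′ ⊛ derivative g) n))
      ≈⟨ +-congˡ (sym (+-assoc _ _ _)) ⟩
    f 0 * derivative g (suc n) + ((derivative f ⊛ g) (suc n) + (f′ ⊛ derivative g) n)
      ≈⟨ +-comm _ _ ⟩
    (derivative f ⊛ g) (suc n) + (f′ ⊛ derivative g) n + f 0 * derivative g (suc n)
      ≈⟨ +-assoc _ _ _ ⟩
    (derivative f ⊛ g) (suc n) + ((f′ ⊛ derivative g) n + f 0 * derivative g (suc n))
      ≈⟨ +-congˡ (+-comm _ _) ⟩
    (derivative f ⊛ g) (suc n) + (f ⊛ derivative g) (suc n) ∎
    where f′ = tail f

  egf : Seq → Seq
  egf f n = (n !) ×ᵣ f n

  egf-derivative : ∀ f n → egf f (suc n) ≈ egf (derivative f) n
  egf-derivative f n = begin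
    (suc n !) ×ᵣ f (suc n)            ≡⟨ ≡.cong (_×ᵣ f (suc n)) (ℕₚ.*-comm (suc n) (n !)) ⟩
    (n ! ℕ.* suc n) ×ᵣ f (suc n)    ≈⟨ ×-assocˡ _ (n !) (suc n) ⟨
    (n !) ×ᵣ (suc n ×ᵣ f (suc n))     ∎

  -- `egf` carries `derivative` to the shift, so the Leibniz rule for `⊛` becomes the recursion that
  -- defines `⊠`.
  egf-⊛ : ∀ f g n → egf (f ⊛ g) n ≈ (egf f ⊠ egf g) n
  egf-⊛ f g zero = trans (×-homo-1 _) (sym (*-cong (×-homo-1 _) (×-homo-1 _)))
  egf-⊛ f g (suc n) = begin
    egf (f ⊛ g) (suc n)                                            ≈⟨ egf-derivative (f ⊛ g) n ⟩
    egf (derivative (f ⊛ g)) n                                     ≈⟨ ×-congʳ (n !) (derivative-⊛ f g n) ⟩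
    (n !) ×ᵣ ((derivative f ⊛ g) n + (f ⊛ derivative g) n)           ≈⟨ ×-distrib-+ _ _ (n !) ⟩
    egf (derivative f ⊛ g) n + egf (f ⊛ derivative g) n
      ≈⟨ +-cong (egf-⊛ (derivative f) g n) (egf-⊛ f (derivative g) n) ⟩
    (egf (derivative f) ⊠ egf g) n + (egf f ⊠ egf (derivative g)) n
      ≈⟨ +-cong (⊠-cong (λ m → sym (egf-derivative f m)) (λ _ → refl) n)
                (⊠-cong (λ _ → refl) (λ m → sym (egf-derivative g m)) n) ⟩
    (egf f ⊠ egf g) (suc n) ∎

-- Binomial coefficients divisible by p, and derivations in characteristic p.

-- binom i j is the binomial coefficient (i + j choose i).
binom : ℕ → ℕ → ℕ
binom zero    _       = 1
binom (suc _) zero    = 1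
binom (suc i) (suc j) = binom i (suc j) ℕ.+ binom (suc i) j

binom-comm : ∀ i j → binom i j ≡ binom j i
binom-comm zero    zero    = ≡.refl
binom-comm zero    (suc j) = ≡.refl
binom-comm (suc i) zero    = ≡.refl
binom-comm (suc i) (suc j) =
  ≡.trans (ℕₚ.+-comm (binom i (suc j)) _) (≡.cong₂ ℕ._+_ (binom-comm (suc i) j) (binom-comm i (suc j)))

-- Brings out the factor i + j + 1, which Euclid's lemma moves into the binomial coefficient when it
-- equals p. The inductive step links the instances at (i, j) and (j, i) through the symmetry of
-- `binom`.
binom-absorb : ∀ i j → suc i ℕ.* binom (suc i) j ≡ (suc i ℕ.+ j) ℕ.* binom i j
binom-absorb zero    zero    = ≡.refl
binom-absorb (suc i) zero    = ≡.cong (ℕ._* 1) (≡.sym (ℕₚ.+-identityʳ (suc (suc i))))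
binom-absorb i       (suc j) = begin
  suc i ℕ.* (binom i (suc j) ℕ.+ binom (suc i) j)                    ≡⟨ ℕₚ.*-distribˡ-+ (suc i) (binom i (suc j)) _ ⟩
  suc i ℕ.* binom i (suc j) ℕ.+ suc i ℕ.* binom (suc i) j            ≡⟨ ≡.cong (suc i ℕ.* binom i (suc j) ℕ.+_) step ⟩
  suc i ℕ.* binom i (suc j) ℕ.+ suc j ℕ.* binom i (suc j)            ≡⟨ ℕₚ.*-distribʳ-+ (binom i (suc j)) (suc i) (suc j) ⟨
  (suc i ℕ.+ suc j) ℕ.* binom i (suc j)                              ∎
  where
  open ≡.≡-Reasoning
  step : suc i ℕ.* binom (suc i) j ≡ suc j ℕ.* binom i (suc j)
  step = begin
    suc i ℕ.* binom (suc i) j       ≡⟨ binom-absorb i j ⟩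
    (suc i ℕ.+ j) ℕ.* binom i j     ≡⟨ ≡.cong₂ ℕ._*_ (≡.cong suc (ℕₚ.+-comm i j)) (binom-comm i j) ⟩
    (suc j ℕ.+ i) ℕ.* binom j i     ≡⟨ binom-absorb j i ⟨
    suc j ℕ.* binom (suc j) i       ≡⟨ ≡.cong (suc j ℕ.*_) (binom-comm (suc j) i) ⟩
    suc j ℕ.* binom i (suc j)       ∎

prime∣binom : ∀ {p} → Prime p → ∀ i j → suc i ℕ.+ suc j ≡ p → p ∣ binom (suc i) (suc j)
prime∣binom {p} pp i j i+j≡p with euclidsLemma (suc i) (binom (suc i) (suc j)) pp
    (divides (binom i (suc j)) (≡.trans (binom-absorb i (suc j))
      (≡.trans (≡.cong (ℕ._* binom i (suc j)) i+j≡p) (ℕₚ.*-comm p _))))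
... | inj₂ p∣b = p∣b
... | inj₁ p∣i = contradiction (∣⇒≤ p∣i)
      (ℕₚ.<⇒≱ (≡.subst (suc i ℕ.<_) i+j≡p (ℕₚ.m<m+n (suc i) (s≤s ℕ.z≤n))))

module PrimeCharacteristic {c ℓ} (R : CommutativeRing c ℓ) {p : ℕ} (p-prime : Prime p)
  (p×≈0 : ∀ x → CommutativeRing._≈_ R (SemiringMult._×_ (CommutativeRing.semiring R) p x) (CommutativeRing.0# R))
  where
  open CommutativeRing R
  open CommutativeSemigroupProperties +-commutativeSemigroup using (interchange)
  open SemiringMult semiring using (×-assocˡ; ×-homo-1; ×-homo-+) renaming (_×_ to _×ᵣ_)
  open SemiringExp semiring using (_^_)
  open Sequences R using (Seq; tail)
  open Hurwitz R
  open SetoidReasoning setoid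

  private
    antidiag : ℕ → (ℕ → ℕ → Carrier) → Carrier
    antidiag zero    T = T 0 0
    antidiag (suc n) T = T 0 (suc n) + antidiag n (T ∘ suc)

    antidiag-last : ∀ n T → antidiag (suc n) T ≈ antidiag n (λ i j → T i (suc j)) + T (suc n) 0
    antidiag-last zero    T = refl
    antidiag-last (suc n) T = trans (+-congˡ (antidiag-last n (T ∘ suc))) (sym (+-assoc _ _ _))

    antidiag-cong : ∀ n {T U} → (∀ i j → i ℕ.+ j ≡ n → T i j ≈ U i j) → antidiag n T ≈ antidiag n U
    antidiag-cong zero    e = e 0 0 ≡.refl
    antidiag-cong (suc n) e = +-cong (e 0 (suc n) ≡.refl) (antidiag-cong n λ i j q → e (suc i) j (≡.cong suc q))

    antidiag-+ : ∀ n T U → antidiag n (λ i j → T i j + U i j) ≈ antidiag n T + antidiag n U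
    antidiag-+ zero    T U = refl
    antidiag-+ (suc n) T U = trans (+-congˡ (antidiag-+ n (T ∘ suc) (U ∘ suc))) (interchange _ _ _ _)

    antidiag-0 : ∀ n T → (∀ i j → i ℕ.+ j ≡ n → T i j ≈ 0#) → antidiag n T ≈ 0#
    antidiag-0 zero    T e = e 0 0 ≡.refl
    antidiag-0 (suc n) T e =
      trans (+-cong (e 0 (suc n) ≡.refl) (antidiag-0 n (T ∘ suc) λ i j q → e (suc i) j (≡.cong suc q))) (+-identityˡ 0#)

    -- The Leibniz expansion of an n-th derivative before equal terms are collected: one term for
    -- every word of length n in two letters, `T i j` belonging to the words with i letters of the
    -- first kind and j of the second.
    pascal : ℕ → (ℕ → ℕ → Carrier) → Carrier
    pascal zero    T = T 0 0
    pascal (suc n) T = pascal n (T ∘ suc) + pascal n (λ i j → T i (suc j))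

    -- The two terms of Pascal's rule, extended by 0 at the ends so that both can be summed over the
    -- same antidiagonal.
    binomˡ binomʳ : ℕ → ℕ → ℕ
    binomˡ zero    _ = 0
    binomˡ (suc i) j = binom i j
    binomʳ i zero    = 0
    binomʳ i (suc j) = binom i j

    binom-split : ∀ n i j → i ℕ.+ j ≡ suc n → binom i j ≡ binomˡ i j ℕ.+ binomʳ i j
    binom-split n zero (suc j) _ = ≡.refl
    binom-split n (suc zero) zero _ = ≡.refl
    binom-split n (suc (suc i)) zero _ = ≡.refl
    binom-split n (suc i) (suc j) _ = ≡.refl

    pascal≈antidiag : ∀ n T → pascal n T ≈ antidiag n (λ i j → binom i j ×ᵣ T i j)
    pascal≈antidiag zero    T = sym (×-homo-1 _)
    pascal≈antidiag (suc n) T = begin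
      pascal n (T ∘ suc) + pascal n (λ i j → T i (suc j))
        ≈⟨ +-cong (pascal≈antidiag n _) (pascal≈antidiag n _) ⟩
      antidiag n (λ i j → binom i j ×ᵣ T (suc i) j) + antidiag n (λ i j → binom i j ×ᵣ T i (suc j))
        ≈⟨ +-cong (+-identityˡ _) (+-identityʳ _) ⟨
      antidiag (suc n) (λ i j → binomˡ i j ×ᵣ T i j) + (antidiag n (λ i j → binom i j ×ᵣ T i (suc j)) + 0#)
        ≈⟨ +-congˡ (antidiag-last n (λ i j → binomʳ i j ×ᵣ T i j)) ⟨
      antidiag (suc n) (λ i j → binomˡ i j ×ᵣ T i j) + antidiag (suc n) (λ i j → binomʳ i j ×ᵣ T i j)
        ≈⟨ antidiag-+ (suc n) (λ i j → binomˡ i j ×ᵣ T i j) (λ i j → binomʳ i j ×ᵣ T i j) ⟨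
      antidiag (suc n) (λ i j → binomˡ i j ×ᵣ T i j + binomʳ i j ×ᵣ T i j)
        ≈⟨ antidiag-cong (suc n) (λ i j q → trans (sym (×-homo-+ (T i j) (binomˡ i j) (binomʳ i j)))
             (reflexive (≡.cong (_×ᵣ T i j) (≡.sym (binom-split n i j q))))) ⟩
      antidiag (suc n) (λ i j → binom i j ×ᵣ T i j) ∎

    -- Every binomial coefficient off the two ends is a multiple of p, and p-fold sums vanish.
    pascal-prime : ∀ T → pascal p T ≈ T p 0 + T 0 p
    pascal-prime T = lemma p ≡.refl
      where
      vanish : ∀ b x → p ∣ b → b ×ᵣ x ≈ 0#
      vanish b x (divides q ≡.refl) = begin
        (q ℕ.* p) ×ᵣ x   ≡⟨ ≡.cong (_×ᵣ x) (ℕₚ.*-comm q p) ⟩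
        (p ℕ.* q) ×ᵣ x   ≈⟨ ×-assocˡ x p q ⟨
        p ×ᵣ (q ×ᵣ x)    ≈⟨ p×≈0 _ ⟩
        0#               ∎
      lemma : ∀ n → n ≡ p → pascal n T ≈ T n 0 + T 0 n
      lemma zero       ≡.refl = contradiction p-prime ¬prime[0]
      lemma (suc zero) ≡.refl = contradiction p-prime ¬prime[1]
      lemma (suc (suc n)) ≡.refl = begin
        pascal (2 ℕ.+ n) T
          ≈⟨ pascal≈antidiag (2 ℕ.+ n) T ⟩
        1 ×ᵣ T 0 (2 ℕ.+ n) + antidiag (suc n) (λ i j → binom (suc i) j ×ᵣ T (suc i) j)
          ≈⟨ +-congˡ (antidiag-last n (λ i j → binom (suc i) j ×ᵣ T (suc i) j)) ⟩
        1 ×ᵣ T 0 (2 ℕ.+ n) + (antidiag n (λ i j → binom (suc i) (suc j) ×ᵣ T (suc i) (suc j)) + 1 ×ᵣ T (2 ℕ.+ n) 0)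
          ≈⟨ +-cong (×-homo-1 _) (+-cong (antidiag-0 n _ λ i j q → vanish (binom (suc i) (suc j)) _
               (prime∣binom p-prime i j (≡.cong suc (≡.trans (ℕₚ.+-suc i j) (≡.cong suc q))))) (×-homo-1 _)) ⟩
        T 0 (2 ℕ.+ n) + (0# + T (2 ℕ.+ n) 0)   ≈⟨ +-congˡ (+-identityˡ _) ⟩
        T 0 (2 ℕ.+ n) + T (2 ℕ.+ n) 0          ≈⟨ +-comm _ _ ⟩
        T (2 ℕ.+ n) 0 + T 0 (2 ℕ.+ n)          ∎

    ⊠-pascal : ∀ n m f g → (f ⊠ g) (n ℕ.+ m) ≈ pascal n (λ i j → ((λ k → f (i ℕ.+ k)) ⊠ (λ k → g (j ℕ.+ k))) m)
    ⊠-pascal zero    m f g = refl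
    ⊠-pascal (suc n) m f g = +-cong (⊠-pascal n m (tail f) g) (⊠-pascal n m f (tail g))

  ⊠-shift-prime : ∀ f g m → (f ⊠ g) (p ℕ.+ m) ≈ ((λ k → f (p ℕ.+ k)) ⊠ g) m + (f ⊠ (λ k → g (p ℕ.+ k))) m
  ⊠-shift-prime f g m = trans (⊠-pascal p m f g) (pascal-prime _)

  -- Eigensequences of the p-th iterated shift. This iterate is a derivation, so eigenvalues add
  -- under `⊠` and factors with eigenvalue 0 do not affect the total.
  Eigen : Carrier → Seq → Set ℓ
  Eigen u f = ∀ n → f (p ℕ.+ n) ≈ u * f n

  ⊠-eigen : ∀ {u v f g} → Eigen u f → Eigen v g → Eigen (u + v) (f ⊠ g)
  ⊠-eigen {u} {v} {f} {g} uf vg n = begin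
    (f ⊠ g) (p ℕ.+ n)
      ≈⟨ ⊠-shift-prime f g n ⟩
    ((λ k → f (p ℕ.+ k)) ⊠ g) n + (f ⊠ (λ k → g (p ℕ.+ k))) n
      ≈⟨ +-cong (⊠-cong uf (λ _ → refl) n) (⊠-cong (λ _ → refl) vg n) ⟩
    ((λ k → u * f k) ⊠ g) n + (f ⊠ (λ k → v * g k)) n
      ≈⟨ +-cong (⊠-scaleˡ u f g n) (⊠-scaleʳ v f g n) ⟩
    u * (f ⊠ g) n + v * (f ⊠ g) n
      ≈⟨ distribʳ _ _ _ ⟨
    (u + v) * (f ⊠ g) n ∎

  -- The powers of x are the exponential generating function of exp (x q).
  private
    ⊠-exp : ∀ x y n → ((x ^_) ⊠ (y ^_)) n ≈ (x + y) ^ n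
    ⊠-exp x y zero = *-identityˡ _
    ⊠-exp x y (suc n) = begin
      (tail (x ^_) ⊠ (y ^_)) n + ((x ^_) ⊠ tail (y ^_)) n
        ≈⟨ +-cong (⊠-scaleˡ x (x ^_) (y ^_) n) (⊠-scaleʳ y (x ^_) (y ^_) n) ⟩
      x * ((x ^_) ⊠ (y ^_)) n + y * ((x ^_) ⊠ (y ^_)) n
        ≈⟨ distribʳ _ _ _ ⟨
      (x + y) * ((x ^_) ⊠ (y ^_)) n
        ≈⟨ *-congˡ (⊠-exp x y n) ⟩
      (x + y) ^ suc n ∎

  -- Reads off the p-th coefficient of exp (x q) exp (y q) = exp ((x + y) q) by means of the p-th
  -- Leibniz rule.
  frobenius-+ : ∀ x y → (x + y) ^ p ≈ x ^ p + y ^ p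
  frobenius-+ x y = begin
    (x + y) ^ p                                     ≡⟨ ≡.cong ((x + y) ^_) (ℕₚ.+-identityʳ p) ⟨
    (x + y) ^ (p ℕ.+ 0)                             ≈⟨ ⊠-exp x y (p ℕ.+ 0) ⟨
    ((x ^_) ⊠ (y ^_)) (p ℕ.+ 0)                     ≈⟨ ⊠-shift-prime (x ^_) (y ^_) 0 ⟩
    x ^ (p ℕ.+ 0) * 1# + 1# * y ^ (p ℕ.+ 0)         ≈⟨ +-cong (*-identityʳ _) (*-identityˡ _) ⟩
    x ^ (p ℕ.+ 0) + y ^ (p ℕ.+ 0)                   ≡⟨ ≡.cong (λ n → x ^ n + y ^ n) (ℕₚ.+-identityʳ p) ⟩
    x ^ p + y ^ p                                   ∎

-- Arithmetic modulo p: Fermat's theorem and inverses.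

infix 4 _≡_[mod_]
-- A record, so that `a` and `b` can be inferred from the type of a proof; the bare divisibility of
-- a difference would hide them.
record _≡_[mod_] (a b : ℤ) (p : ℕ) : Set where
  constructor congruent
  field difference : (+ p) ℤDiv.∣ (a ℤ.- b)

module _ (p : ℕ) where
  private
    infix 4 _≈_
    _≈_ : ℤ → ℤ → Set
    a ≈ b = a ≡ b [mod p ]

    via : ∀ {a b d} → (+ p) ℤDiv.∣ d → d ≡ a ℤ.- b → a ≈ b
    via p∣d e = congruent (≡.subst ((+ p) ℤDiv.∣_) e p∣d)

    0≡a-a : ∀ a → 0ℤ ≡ a ℤ.- a
    0≡a-a = ℤSolver.solve-∀

    -[a-b] : ∀ a b → ℤ.- (a ℤ.- b) ≡ b ℤ.- a
    -[a-b] = ℤSolver.solve-∀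

    a-b+[b-c] : ∀ a b c → (a ℤ.- b) ℤ.+ (b ℤ.- c) ≡ a ℤ.- c
    a-b+[b-c] = ℤSolver.solve-∀

    +-diff : ∀ a b c d → (a ℤ.- b) ℤ.+ (c ℤ.- d) ≡ (a ℤ.+ c) ℤ.- (b ℤ.+ d)
    +-diff = ℤSolver.solve-∀

    *-diff : ∀ a b c d → (a ℤ.- b) ℤ.* c ℤ.+ b ℤ.* (c ℤ.- d) ≡ a ℤ.* c ℤ.- b ℤ.* d
    *-diff = ℤSolver.solve-∀

    neg-diff : ∀ a b → ℤ.- (a ℤ.- b) ≡ (ℤ.- a) ℤ.- (ℤ.- b)
    neg-diff = ℤSolver.solve-∀

    ≈-reflexive : ∀ {a b} → a ≡ b → a ≈ b
    ≈-reflexive {a} ≡.refl = via (ℤDiv.divides 0ℤ ≡.refl) (0≡a-a a)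

  -- The carrier stays ℤ and only the equality is coarsened: one and the same integer sequence is
  -- matched exactly with rational coefficients and then computed with modulo p.
  ℤmod : CommutativeRing 0ℓ 0ℓ
  ℤmod = record
    { Carrier = ℤ ; _≈_ = _≈_ ; _+_ = ℤ._+_ ; _*_ = ℤ._*_ ; -_ = ℤ.-_ ; 0# = 0ℤ ; 1# = 1ℤ
    ; isCommutativeRing = record
      { isRing = record
        { +-isAbelianGroup = record
          { isGroup = record
            { isMonoid = record
              { isSemigroup = record
                { isMagma = record
                  { isEquivalence = record
                    { refl = ≈-reflexive ≡.refl
                    ; sym = λ {a} {b} (congruent d) → via (ℤDiv.∣m⇒∣-m d) (-[a-b] a b)
                    ; trans = λ {a} {b} {c} (congruent d) (congruent e) → via (ℤDiv.∣m∣n⇒∣m+n d e) (a-b+[b-c] a b c)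
                    }
                  ; ∙-cong = λ {a} {b} {c} {d} (congruent x) (congruent y) → via (ℤDiv.∣m∣n⇒∣m+n x y) (+-diff a b c d)
                  }
                ; assoc = λ a b c → ≈-reflexive (ℤₚ.+-assoc a b c)
                }
              ; identity = (λ a → ≈-reflexive (ℤₚ.+-identityˡ a)) , (λ a → ≈-reflexive (ℤₚ.+-identityʳ a))
              }
            ; inverse = (λ a → ≈-reflexive (ℤₚ.+-inverseˡ a)) , (λ a → ≈-reflexive (ℤₚ.+-inverseʳ a))
            ; ⁻¹-cong = λ {a} {b} (congruent d) → via (ℤDiv.∣m⇒∣-m d) (neg-diff a b)
            }
          ; comm = λ a b → ≈-reflexive (ℤₚ.+-comm a b)
          }
        ; *-cong = λ {a} {b} {c} {d} (congruent x) (congruent y) →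
            via (ℤDiv.∣m∣n⇒∣m+n (ℤDiv.∣m⇒∣m*n c x) (ℤDiv.∣n⇒∣m*n b y)) (*-diff a b c d)
        ; *-assoc = λ a b c → ≈-reflexive (ℤₚ.*-assoc a b c)
        ; *-identity = (λ a → ≈-reflexive (ℤₚ.*-identityˡ a)) , (λ a → ≈-reflexive (ℤₚ.*-identityʳ a))
        ; distrib = (λ a b c → ≈-reflexive (ℤₚ.*-distribˡ-+ a b c)) , (λ a b c → ≈-reflexive (ℤₚ.*-distribʳ-+ a b c))
        }
      ; *-comm = λ a b → ≈-reflexive (ℤₚ.*-comm a b)
      }
    }

module Residues {p : ℕ} (p-prime : Prime p) where
  open CommutativeRing (ℤmod p) public
    using (_≈_; refl; sym; trans; reflexive; setoid; +-cong; *-cong; -‿cong)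
  open SemiringMult (CommutativeRing.semiring (ℤmod p)) public using () renaming (_×_ to _×ᵣ_)
  open SemiringExp (CommutativeRing.semiring (ℤmod p)) public using (_^_; ^-congˡ)
  open SetoidReasoning setoid

  private instance
    p≢0 : ℕ.NonZero p
    p≢0 = prime⇒nonZero p-prime

  ×ᵣ≡* : ∀ n a → n ×ᵣ a ≡ (+ n) ℤ.* a
  ×ᵣ≡* zero a = ≡.sym (ℤₚ.*-zeroˡ a)
  ×ᵣ≡* (suc n) a = ≡.trans (≡.cong (λ x → a ℤ.+ x) (×ᵣ≡* n a)) (≡.sym (ℤₚ.suc-* (+ n) a))

  ∣⇒≈0 : ∀ {a} → (+ p) ℤDiv.∣ a → a ≈ 0ℤ
  ∣⇒≈0 {a} d = congruent (≡.subst ((+ p) ℤDiv.∣_) (≡.sym (ℤₚ.+-identityʳ a)) d)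

  ≈0⇒∣ : ∀ {a} → a ≈ 0ℤ → (+ p) ℤDiv.∣ a
  ≈0⇒∣ {a} (congruent d) = ≡.subst ((+ p) ℤDiv.∣_) (ℤₚ.+-identityʳ a) d

  +∣⇒≈0 : ∀ {n} → p ∣ n → + n ≈ 0ℤ
  +∣⇒≈0 d = ∣⇒≈0 (ℤDiv.∣ᵤ⇒∣ d)

  +≈0⇒∣ : ∀ {n} → + n ≈ 0ℤ → p ∣ n
  +≈0⇒∣ e = ℤDiv.∣⇒∣ᵤ (≈0⇒∣ e)

  p≈0 : + p ≈ 0ℤ
  p≈0 = ∣⇒≈0 ℤDiv.∣-refl

  p×≈0 : ∀ a → p ×ᵣ a ≈ 0ℤ
  p×≈0 a = trans (reflexive (×ᵣ≡* p a)) (∣⇒≈0 (ℤDiv.∣m⇒∣m*n a ℤDiv.∣-refl))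

  small≉0 : ∀ {n} → 0 ℕ.< n → n ℕ.< p → ¬ (+ n ≈ 0ℤ)
  small≉0 {suc n} _ n<p e = ℕₚ.<⇒≱ n<p (∣⇒≤ (+≈0⇒∣ e))

  a-b≈0⇒a≈b : ∀ {a b} → a ℤ.- b ≈ 0ℤ → a ≈ b
  a-b≈0⇒a≈b e = congruent (≈0⇒∣ e)

  a≈b⇒a-b≈0 : ∀ {a b} → a ≈ b → a ℤ.- b ≈ 0ℤ
  a≈b⇒a-b≈0 (congruent d) = ∣⇒≈0 d

  integral-domain : ∀ a b → a ℤ.* b ≈ 0ℤ → a ≈ 0ℤ ⊎ b ≈ 0ℤ
  integral-domain a b e =
    Sum.map (∣⇒≈0 ∘ ℤDiv.∣ᵤ⇒∣) (∣⇒≈0 ∘ ℤDiv.∣ᵤ⇒∣)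
      (euclidsLemma ℤ.∣ a ∣ ℤ.∣ b ∣ p-prime
        (≡.subst (p ∣_) (ℤₚ.abs-* a b) (ℤDiv.∣⇒∣ᵤ (≈0⇒∣ e))))

  *-cancelˡ-≈0 : ∀ {a b} → ¬ a ≈ 0ℤ → a ℤ.* b ≈ 0ℤ → b ≈ 0ℤ
  *-cancelˡ-≈0 {a} {b} a≉0 e with integral-domain a b e
  ... | inj₁ a≈0 = contradiction a≈0 a≉0
  ... | inj₂ b≈0 = b≈0

  residue : ∀ a → ∃ λ n → n ℕ.< p × a ≈ + n
  residue a = a ℤDivMod.%ℕ p , ℤDivMod.n%ℕd<d a p , (begin
    a                                                          ≡⟨ ℤDivMod.a≡a%ℕn+[a/ℕn]*n a p ⟩
    + (a ℤDivMod.%ℕ p) ℤ.+ (a ℤDivMod./ℕ p) ℤ.* + p            ≈⟨ +-cong {x = + (a ℤDivMod.%ℕ p)} refl (∣⇒≈0 (ℤDiv.∣n⇒∣m*n (a ℤDivMod./ℕ p) ℤDiv.∣-refl)) ⟩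
    + (a ℤDivMod.%ℕ p) ℤ.+ 0ℤ                                  ≡⟨ ℤₚ.+-identityʳ _ ⟩
    + (a ℤDivMod.%ℕ p)                                         ∎)

  open PrimeCharacteristic (ℤmod p) p-prime p×≈0 using (frobenius-+)

  private
    1^n≡1 : ∀ n → 1ℤ ^ n ≡ 1ℤ
    1^n≡1 zero = ≡.refl
    1^n≡1 (suc n) = ≡.trans (ℤₚ.*-identityˡ _) (1^n≡1 n)

    0^p≡0 : 0ℤ ^ p ≡ 0ℤ
    0^p≡0 = lemma p p-prime
      where
      lemma : ∀ n → Prime n → 0ℤ ^ n ≡ 0ℤ
      lemma zero    q = contradiction q ¬prime[0]
      lemma (suc n) _ = ℤₚ.*-zeroˡ (0ℤ ^ n)

    fermat-ℕ : ∀ n → (+ n) ^ p ≈ + n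
    fermat-ℕ zero = reflexive 0^p≡0
    fermat-ℕ (suc n) = trans (frobenius-+ 1ℤ (+ n)) (+-cong (reflexive (1^n≡1 p)) (fermat-ℕ n))

  fermat : ∀ a → a ^ p ≈ a
  fermat a with residue a
  ... | n , _ , a≈n = trans (^-congˡ p a≈n) (trans (fermat-ℕ n) (sym a≈n))

  -- The inverse is a^(p - 2): Fermat's theorem gives a (a^(p - 1) - 1) ≡ 0, where the factor a
  -- cancels.
  inverse : ∀ {a} → ¬ a ≈ 0ℤ → ∃ λ b → a ℤ.* b ≈ 1ℤ
  inverse {a} a≉0 = lemma p p-prime (fermat a)
    where
    a[x-1] : ∀ x → a ℤ.* (x ℤ.- 1ℤ) ≡ a ℤ.* x ℤ.- a
    a[x-1] x = ≡.trans (ℤₚ.*-distribˡ-+ a x -1ℤ) (≡.cong (λ y → a ℤ.* x ℤ.+ y)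
      (≡.trans (ℤₚ.*-comm a -1ℤ) (ℤₚ.-1*i≡-i a)))
    lemma : ∀ n → Prime n → a ^ n ≈ a → ∃ λ b → a ℤ.* b ≈ 1ℤ
    lemma zero q _ = contradiction q ¬prime[0]
    lemma (suc zero) q _ = contradiction q ¬prime[1]
    lemma (suc (suc n)) _ e = a ^ n , a-b≈0⇒a≈b (*-cancelˡ-≈0 a≉0
      (trans (reflexive (a[x-1] (a ^ suc n))) (a≈b⇒a-b≈0 e)))

-- Polynomials as sequences: degrees, evaluation, roots.

module Polynomials {c ℓ} (R : CommutativeRing c ℓ) where
  open CommutativeRing R
  open CommutativeSemigroupProperties +-commutativeSemigroup using () renaming (interchange to +-interchange)
  open CommutativeSemigroupProperties *-commutativeSemigroup using () renaming (x∙yz≈y∙xz to x*yz≈y*xz)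
  open Sequences R
  open SetoidReasoning setoid

  linear : Carrier → Carrier → Seq
  linear a b zero          = a
  linear a b (suc zero)    = b
  linear a b (suc (suc _)) = 0#

  linear-⊛-suc : ∀ a b f n → (linear a b ⊛ f) (suc n) ≈ a * f (suc n) + b * f n
  linear-⊛-suc a b f n = +-congˡ (lemma n)
    where
    lemma : ∀ n → (tail (linear a b) ⊛ f) n ≈ b * f n
    lemma zero = refl
    lemma (suc n) = trans (+-congˡ (⊛-zeroˡ-at (tail (tail (linear a b))) f (λ _ → refl) n)) (+-identityʳ _)

  Degree≤ : ℕ → Seq → Set ℓ
  Degree≤ d f = ∀ i → d ℕ.< i → f i ≈ 0#

  Degree≤-⊛ : ∀ a b {f g} → Degree≤ a f → Degree≤ b g → Degree≤ (a ℕ.+ b) (f ⊛ g)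
  Degree≤-⊛ zero b {f} {g} df dg (suc i) b<i = trans
    (+-cong (trans (*-congˡ (dg (suc i) b<i)) (zeroʳ _)) (⊛-zeroˡ-at (tail f) g (λ n → df (suc n) (s≤s z≤n)) i))
    (+-identityˡ _)
  Degree≤-⊛ (suc a) b {f} {g} df dg (suc i) (s≤s ab<i) = trans
    (+-cong (trans (*-congˡ (dg (suc i) (ℕₚ.≤-trans (s≤s (ℕₚ.m≤n+m b a)) (ℕₚ.m≤n⇒m≤1+n ab<i)))) (zeroʳ _))
            (Degree≤-⊛ a b (λ j a<j → df (suc j) (s≤s a<j)) dg i ab<i))
    (+-identityˡ _)

  ⊛-leading : ∀ a b {f g} → Degree≤ a f → Degree≤ b g → (f ⊛ g) (a ℕ.+ b) ≈ f a * g b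
  ⊛-leading zero zero df dg = refl
  ⊛-leading zero (suc b) {f} {g} df dg =
    trans (+-congˡ (⊛-zeroˡ-at (tail f) g (λ n → df (suc n) (s≤s z≤n)) b)) (+-identityʳ _)
  ⊛-leading (suc a) b {f} {g} df dg = trans
    (+-cong (trans (*-congˡ (dg (suc (a ℕ.+ b)) (s≤s (ℕₚ.m≤n+m b a)))) (zeroʳ _))
            (⊛-leading a b (λ j a<j → df (suc j) (s≤s a<j)) dg))
    (+-identityˡ _)

  Degree≤-linear : ∀ a b → Degree≤ 1 (linear a b)
  Degree≤-linear a b (suc zero) (s≤s ())
  Degree≤-linear a b (suc (suc i)) _ = refl

  -- eval n f x is the value at x of the truncation of f to degrees below n.
  eval : ℕ → Seq → Carrier → Carrier
  eval zero    f x = 0#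
  eval (suc n) f x = f 0 + x * eval n (tail f) x

  eval-cong : ∀ n {f g} x → (∀ i → f i ≈ g i) → eval n f x ≈ eval n g x
  eval-cong zero    x e = refl
  eval-cong (suc n) x e = +-cong (e 0) (*-congˡ (eval-cong n x (e ∘ suc)))

  eval-⊕ : ∀ n f g x → eval n (f ⊕ g) x ≈ eval n f x + eval n g x
  eval-⊕ zero    f g x = sym (+-identityˡ _)
  eval-⊕ (suc n) f g x = begin
    f 0 + g 0 + x * eval n (tail f ⊕ tail g) x                          ≈⟨ +-congˡ (*-congˡ (eval-⊕ n (tail f) (tail g) x)) ⟩
    f 0 + g 0 + x * (eval n (tail f) x + eval n (tail g) x)             ≈⟨ +-congˡ (distribˡ _ _ _) ⟩
    f 0 + g 0 + (x * eval n (tail f) x + x * eval n (tail g) x)         ≈⟨ +-interchange _ _ _ _ ⟩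
    f 0 + x * eval n (tail f) x + (g 0 + x * eval n (tail g) x)         ∎

  eval-scale : ∀ n a f x → eval n (λ i → a * f i) x ≈ a * eval n f x
  eval-scale zero    a f x = sym (zeroʳ a)
  eval-scale (suc n) a f x = begin
    a * f 0 + x * eval n (λ i → a * f (suc i)) x      ≈⟨ +-congˡ (*-congˡ (eval-scale n a (tail f) x)) ⟩
    a * f 0 + x * (a * eval n (tail f) x)             ≈⟨ +-congˡ (x*yz≈y*xz _ _ _) ⟩
    a * f 0 + a * (x * eval n (tail f) x)             ≈⟨ distribˡ _ _ _ ⟨
    a * (f 0 + x * eval n (tail f) x)                 ∎

  eval-suc : ∀ n f x → f n ≈ 0# → eval (suc n) f x ≈ eval n f x
  eval-suc zero    f x e = trans (+-cong e (zeroʳ x)) (+-identityˡ _)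
  eval-suc (suc n) f x e = +-congˡ (*-congˡ (eval-suc n (tail f) x e))

  shift : ℕ → Seq → Seq
  shift zero    f i       = f i
  shift (suc d) f zero    = 0#
  shift (suc d) f (suc i) = shift d f i

  shift-+ : ∀ d f i → shift d f (d ℕ.+ i) ≡ f i
  shift-+ zero    f i = ≡.refl
  shift-+ (suc d) f i = shift-+ d f i

  shift-< : ∀ {d} f {i} → i ℕ.< d → shift d f i ≡ 0#
  shift-< {suc d} f {zero}  _         = ≡.refl
  shift-< {suc d} f {suc i} (s≤s i<d) = shift-< f i<d

  shift-cong : ∀ d {f g} → (∀ i → f i ≈ g i) → ∀ i → shift d f i ≈ shift d g i
  shift-cong zero    e i       = e i
  shift-cong (suc d) e zero    = refl
  shift-cong (suc d) e (suc i) = shift-cong d e i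

  linear-⊛ : ∀ a b f i → (linear a b ⊛ f) i ≈ a * f i + b * shift 1 f i
  linear-⊛ a b f zero    = sym (trans (+-congˡ (zeroʳ b)) (+-identityʳ _))
  linear-⊛ a b f (suc i) = linear-⊛-suc a b f i

  eval-linear-⊛ : ∀ n a b f x → f n ≈ 0# → eval (suc n) (linear a b ⊛ f) x ≈ (a + b * x) * eval n f x
  eval-linear-⊛ n a b f x fn≈0 = begin
    eval (suc n) (linear a b ⊛ f) x
      ≈⟨ eval-cong (suc n) x (linear-⊛ a b f) ⟩
    eval (suc n) ((λ i → a * f i) ⊕ (λ i → b * shift 1 f i)) x
      ≈⟨ eval-⊕ (suc n) (λ i → a * f i) (λ i → b * shift 1 f i) x ⟩
    eval (suc n) (λ i → a * f i) x + eval (suc n) (λ i → b * shift 1 f i) x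
      ≈⟨ +-cong (eval-scale (suc n) a f x) (eval-scale (suc n) b (shift 1 f) x) ⟩
    a * eval (suc n) f x + b * (0# + x * eval n f x)
      ≈⟨ +-cong (*-congˡ (eval-suc n f x fn≈0)) (*-congˡ (+-identityˡ _)) ⟩
    a * eval n f x + b * (x * eval n f x)
      ≈⟨ +-congˡ (*-assoc _ _ _) ⟨
    a * eval n f x + b * x * eval n f x
      ≈⟨ distribʳ _ _ _ ⟨
    (a + b * x) * eval n f x ∎

  -- Synthetic division of f by X − a, f being truncated to degrees ≤ n.
  quotient : ℕ → Seq → Carrier → Seq
  quotient zero    f a i       = 0#
  quotient (suc n) f a zero    = eval (suc n) (tail f) a
  quotient (suc n) f a (suc i) = quotient n (tail f) a i

  eval-quotient : ∀ n f a x → eval (suc n) f x ≈ (x - a) * eval n (quotient n f a) x + eval (suc n) f a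
  eval-quotient zero f a x = begin
    f 0 + x * 0#                     ≈⟨ +-congˡ (trans (zeroʳ x) (sym (zeroʳ a))) ⟩
    f 0 + a * 0#                     ≈⟨ +-identityˡ _ ⟨
    0# + (f 0 + a * 0#)              ≈⟨ +-congʳ (zeroʳ (x - a)) ⟨
    (x - a) * 0# + (f 0 + a * 0#)    ∎
  eval-quotient (suc n) f a x = begin
    f 0 + x * eval (suc n) (tail f) x            ≈⟨ +-congˡ (*-congˡ (eval-quotient n (tail f) a x)) ⟩
    f 0 + x * ((x - a) * q + e)                  ≈⟨ +-congˡ (trans (distribˡ _ _ _) (+-cong (x*yz≈y*xz _ _ _) refl)) ⟩
    f 0 + ((x - a) * (x * q) + x * e)            ≈⟨ +-congˡ (+-congˡ x*e) ⟩
    f 0 + ((x - a) * (x * q) + ((x - a) * e + a * e))   ≈⟨ +-congˡ (+-assoc _ _ _) ⟨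
    f 0 + ((x - a) * (x * q) + (x - a) * e + a * e)     ≈⟨ +-congˡ (+-congʳ (trans (sym (distribˡ _ _ _)) (*-congˡ (+-comm _ _)))) ⟩
    f 0 + ((x - a) * (e + x * q) + a * e)        ≈⟨ +-assoc _ _ _ ⟨
    f 0 + (x - a) * (e + x * q) + a * e          ≈⟨ +-congʳ (+-comm _ _) ⟩
    (x - a) * (e + x * q) + f 0 + a * e          ≈⟨ +-assoc _ _ _ ⟩
    (x - a) * (e + x * q) + (f 0 + a * e)        ∎
    where
    q = eval n (quotient n (tail f) a) x
    e = eval (suc n) (tail f) a
    x*e : x * e ≈ (x - a) * e + a * e
    x*e = begin
      x * e                        ≈⟨ *-congʳ (+-identityʳ x) ⟨
      (x + 0#) * e                 ≈⟨ *-congʳ (+-congˡ (-‿inverseˡ a)) ⟨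
      (x + (- a + a)) * e          ≈⟨ *-congʳ (+-assoc _ _ _) ⟨
      (x - a + a) * e              ≈⟨ distribʳ _ _ _ ⟩
      (x - a) * e + a * e          ∎

  -- The constant coefficient of the quotient is the value of `tail f` at `a`, so its vanishing is
  -- the hypothesis needed to recurse on `tail f`.
  quotient-zero : ∀ n f a → eval (suc n) f a ≈ 0# → (∀ i → i ℕ.< n → quotient n f a i ≈ 0#) →
                  ∀ i → i ℕ.< suc n → f i ≈ 0#
  quotient-zero zero f a e q zero _ = trans (sym (trans (+-congˡ (zeroʳ a)) (+-identityʳ _))) e
  quotient-zero (suc n) f a e q zero _ = begin
    f 0                                    ≈⟨ +-identityʳ _ ⟨
    f 0 + 0#                               ≈⟨ +-congˡ (trans (*-congˡ (q 0 (s≤s z≤n))) (zeroʳ a)) ⟨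
    f 0 + a * eval (suc n) (tail f) a      ≈⟨ e ⟩
    0#                                     ∎
  quotient-zero zero f a e q (suc i) (s≤s ())
  quotient-zero (suc n) f a e q (suc i) (s≤s i<n) =
    quotient-zero n (tail f) a (q 0 (s≤s z≤n)) (λ j j<n → q (suc j) (s≤s j<n)) i i<n

  -- Synthetic division by the last point keeps the other roots. Distinctness is stated as
  -- cancellability of differences, which makes sense over any commutative ring.
  polynomial-with-many-roots : ∀ n f (point : ℕ → Carrier) →
    (∀ {i j} → i ℕ.< j → j ℕ.< n → ∀ {x} → (point i - point j) * x ≈ 0# → x ≈ 0#) →
    (∀ i → i ℕ.< n → eval n f (point i) ≈ 0#) → ∀ i → i ℕ.< n → f i ≈ 0#
  polynomial-with-many-roots (suc n) f point distinct root =
    quotient-zero n f a (root n ℕₚ.≤-refl)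
      (polynomial-with-many-roots n (quotient n f a) point
        (λ i<j j<n → distinct i<j (ℕₚ.m≤n⇒m≤1+n j<n))
        λ i i<n → distinct i<n ℕₚ.≤-refl (begin
          (point i - a) * eval n (quotient n f a) (point i)                            ≈⟨ +-identityʳ _ ⟨
          (point i - a) * eval n (quotient n f a) (point i) + 0#                       ≈⟨ +-congˡ (root n ℕₚ.≤-refl) ⟨
          (point i - a) * eval n (quotient n f a) (point i) + eval (suc n) f a         ≈⟨ eval-quotient n f a (point i) ⟨
          eval (suc n) f (point i)                                                     ≈⟨ root i (ℕₚ.m≤n⇒m≤1+n i<n) ⟩
          0#                                                                           ∎))
    where a = point n

-- Powers of 1 - X^d acting on sequences.

module Differences {c ℓ} (R : CommutativeRing c ℓ) where
  open CommutativeRing R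
  open RingProperties ring using (-‿distribʳ-*; -0#≈0#)
  open AbelianGroupProperties +-abelianGroup using (xyx⁻¹≈y)
  open SemiringMult semiring using () renaming (_×_ to _×ᵣ_)
  open Sequences R
  open Polynomials R
  open SetoidReasoning setoid

  -- Multiplication by 1 − X^d.
  Δ : ℕ → Seq → Seq
  Δ d f i = f i - shift d f i

  Δ^ : ℕ → ℕ → Seq → Seq
  Δ^ d k f = fold f (Δ d) k

  Δ-cong : ∀ d {f g} → (∀ i → f i ≈ g i) → ∀ i → Δ d f i ≈ Δ d g i
  Δ-cong d e i = +-cong (e i) (-‿cong (shift-cong d e i))

  Δ^-cong : ∀ d k {f g} → (∀ i → f i ≈ g i) → ∀ i → Δ^ d k f i ≈ Δ^ d k g i
  Δ^-cong d zero    e = e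
  Δ^-cong d (suc k) e = Δ-cong d (Δ^-cong d k e)

  Δ-scale : ∀ a f i → Δ 1 (λ j → a * f j) i ≈ a * Δ 1 f i
  Δ-scale a f zero = sym (begin
    a * (f 0 - 0#)    ≈⟨ *-congˡ (trans (+-congˡ -0#≈0#) (+-identityʳ _)) ⟩
    a * f 0           ≈⟨ +-identityʳ _ ⟨
    a * f 0 + 0#      ≈⟨ +-congˡ -0#≈0# ⟨
    a * f 0 - 0#      ∎)
  Δ-scale a f (suc i) = sym (trans (distribˡ _ _ _) (+-congˡ (sym (-‿distribʳ-* _ _))))

  Δ^-scale : ∀ k a f i → Δ^ 1 k (λ j → a * f j) i ≈ a * Δ^ 1 k f i
  Δ^-scale zero    a f i = refl
  Δ^-scale (suc k) a f i = trans (Δ-cong 1 (Δ^-scale k a f) i) (Δ-scale a (Δ^ 1 k f) i)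

  -- The coefficients with index in the class of c modulo d, on which 1 - X^d acts as 1 - X. It
  -- serves with d = p - 1 to split a polynomial and with d = p to split the resulting series once
  -- more.
  column : ℕ → ℕ → Seq → Seq
  column d c f l = f (c ℕ.+ l ℕ.* d)

  column-Δ : ∀ {d c} f → c ℕ.< d → ∀ l → column d c (Δ d f) l ≈ Δ 1 (column d c f) l
  column-Δ {d} {c} f c<d zero =
    +-congˡ (-‿cong (reflexive (shift-< {d} f (≡.subst (ℕ._< d) (≡.sym (ℕₚ.+-identityʳ c)) c<d))))
  column-Δ {d} {c} f c<d (suc l) = +-congˡ (-‿cong (reflexive (≡.trans
    (≡.cong (shift d f) (≡.trans (≡.sym (ℕₚ.+-assoc c d (l ℕ.* d)))
      (≡.trans (≡.cong (ℕ._+ l ℕ.* d) (ℕₚ.+-comm c d)) (ℕₚ.+-assoc d c (l ℕ.* d)))))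
    (shift-+ d f (c ℕ.+ l ℕ.* d)))))

  column-Δ^ : ∀ {d c} k f → c ℕ.< d → ∀ l → column d c (Δ^ d k f) l ≈ Δ^ 1 k (column d c f) l
  column-Δ^ zero    f c<d l = refl
  column-Δ^ {d} (suc k) f c<d l = trans (column-Δ (Δ^ d k f) c<d l) (Δ-cong 1 (column-Δ^ k f c<d) l)

  arithmetic : Carrier → Carrier → Seq
  arithmetic a s l = a + l ×ᵣ s

  Δ²-arithmetic : ∀ x y i → Δ^ 1 2 (arithmetic x (x + y)) i ≈ linear x y i
  Δ²-arithmetic x y = second
    where
    first-zero : Δ 1 (arithmetic x (x + y)) 0 ≈ x
    first-zero = trans (+-congˡ -0#≈0#) (trans (+-identityʳ _) (+-identityʳ _))
    first-suc : ∀ l → Δ 1 (arithmetic x (x + y)) (suc l) ≈ x + y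
    first-suc l = begin
      x + (x + y + l ×ᵣ (x + y)) - (x + l ×ᵣ (x + y))        ≈⟨ +-congʳ (trans (sym (+-assoc _ _ _)) (trans (+-congʳ (+-comm _ _)) (+-assoc _ _ _))) ⟩
      x + y + (x + l ×ᵣ (x + y)) - (x + l ×ᵣ (x + y))        ≈⟨ +-assoc _ _ _ ⟩
      x + y + (x + l ×ᵣ (x + y) - (x + l ×ᵣ (x + y)))        ≈⟨ +-congˡ (-‿inverseʳ _) ⟩
      x + y + 0#                                             ≈⟨ +-identityʳ _ ⟩
      x + y                                                  ∎
    second : ∀ i → Δ^ 1 2 (arithmetic x (x + y)) i ≈ linear x y i
    second zero = trans (+-congˡ -0#≈0#) (trans (+-identityʳ _) first-zero)
    second (suc zero) = trans (+-cong (first-suc 0) (-‿cong first-zero)) (xyx⁻¹≈y x y)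
    second (suc (suc i)) = trans (+-cong (first-suc (suc i)) (-‿cong (first-suc i))) (-‿inverseʳ _)

  Δ-ones : ∀ i → Δ 1 (λ _ → 1#) i ≈ linear 1# 0# i
  Δ-ones zero = trans (+-congˡ -0#≈0#) (+-identityʳ _)
  Δ-ones (suc zero) = -‿inverseʳ _
  Δ-ones (suc (suc i)) = -‿inverseʳ _

-- The identity (1 - X)^p = 1 - X^p and its consequences.

module PowerSeriesPrimeCharacteristic {c ℓ} (R : CommutativeRing c ℓ) {p : ℕ} (p-prime : Prime p)
  (p×≈0 : ∀ x → CommutativeRing._≈_ R (SemiringMult._×_ (CommutativeRing.semiring R) p x) (CommutativeRing.0# R))
  where
  open CommutativeRing R
  open SemiringMult semiring using (×-assocˡ; ×-homo-+) renaming (_×_ to _×ᵣ_)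
  open Sequences R
  open Polynomials R
  open Differences R

  private
    module A = CommutativeRing powerSeriesRing
    module AP = RingProperties A.ring
    module AG = AbelianGroupProperties A.+-abelianGroup
    open SemiringMult A.semiring using () renaming (_×_ to _×ₐ_)
    open SemiringExp A.semiring using (_^_; ^-congˡ)
    module E = SetoidReasoning A.setoid

  ×-at : ∀ n f i → (n ×ₐ f) i ≡ n ×ᵣ f i
  ×-at zero    f i = ≡.refl
  ×-at (suc n) f i = ≡.cong (λ x → f i + x) (×-at n f i)

  p×ₐ≈0 : ∀ f → p ×ₐ f ≋ 𝟘
  p×ₐ≈0 f = pointwise λ i → trans (reflexive (×-at p f i)) (p×≈0 (f i))

  open PrimeCharacteristic powerSeriesRing p-prime p×ₐ≈0 using (frobenius-+) public

  X : Seq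
  X = linear 0# 1#

  X-⊛ : ∀ f → X ⊛ f ≋ shift 1 f
  X-⊛ f = pointwise λ i → trans (linear-⊛ 0# 1# f i) (trans (+-cong (zeroˡ _) (*-identityˡ _)) (+-identityˡ _))

  X^-⊛ : ∀ d f → X ^ d ⊛ f ≋ shift d f
  X^-⊛ zero f = A.*-identityˡ f
  X^-⊛ (suc d) f = E.begin
    X ⊛ X ^ d ⊛ f       E.≈⟨ A.*-assoc X (X ^ d) f ⟩
    X ⊛ (X ^ d ⊛ f)     E.≈⟨ A.*-congˡ {X} (X^-⊛ d f) ⟩
    X ⊛ shift d f       E.≈⟨ X-⊛ (shift d f) ⟩
    shift 1 (shift d f) E.≈⟨ (pointwise λ { zero → refl ; (suc i) → refl }) ⟩
    shift (suc d) f     E.∎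

  1-X^ : ℕ → Seq
  1-X^ d = 𝟙 ⊕ ⊖ (X ^ d)

  ⊛-Δ : ∀ d f → 1-X^ d ⊛ f ≋ Δ d f
  ⊛-Δ d f = E.begin
    1-X^ d ⊛ f                   E.≈⟨ A.distribʳ f 𝟙 (⊖ (X ^ d)) ⟩
    𝟙 ⊛ f ⊕ (⊖ (X ^ d)) ⊛ f      E.≈⟨ A.+-cong (A.*-identityˡ f) (A.sym (AP.-‿distribˡ-* (X ^ d) f)) ⟩
    f ⊕ ⊖ (X ^ d ⊛ f)            E.≈⟨ A.+-congˡ (A.-‿cong (X^-⊛ d f)) ⟩
    Δ d f                        E.∎

  private
    ⊛-Δ^ : ∀ k f → 1-X^ 1 ^ k ⊛ f ≋ Δ^ 1 k f
    ⊛-Δ^ zero f = A.*-identityˡ f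
    ⊛-Δ^ (suc k) f = E.begin
      1-X^ 1 ⊛ 1-X^ 1 ^ k ⊛ f      E.≈⟨ A.*-assoc (1-X^ 1) (1-X^ 1 ^ k) f ⟩
      1-X^ 1 ⊛ (1-X^ 1 ^ k ⊛ f)    E.≈⟨ A.*-congˡ {1-X^ 1} (⊛-Δ^ k f) ⟩
      1-X^ 1 ⊛ Δ^ 1 k f            E.≈⟨ ⊛-Δ 1 (Δ^ 1 k f) ⟩
      Δ^ 1 (suc k) f               E.∎

    1^ : ∀ n → 𝟙 ^ n ≋ 𝟙
    1^ zero = A.refl
    1^ (suc n) = A.trans (A.*-identityˡ (𝟙 ^ n)) (1^ n)

    0^p : ∀ n → Prime n → 𝟘 ^ n ≋ 𝟘
    0^p zero    q = contradiction q ¬prime[0]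
    0^p (suc n) _ = A.zeroˡ (𝟘 ^ n)

  -- Additivity of the Frobenius map and uniqueness of negatives avoid the parity of p, so that p =
  -- 2 is included.
  neg-^p : ∀ f → (⊖ f) ^ p ≋ ⊖ (f ^ p)
  neg-^p f = AG.inverseʳ-unique (f ^ p) ((⊖ f) ^ p) (E.begin
    f ^ p ⊕ (⊖ f) ^ p    E.≈⟨ frobenius-+ f (⊖ f) ⟨
    (f ⊕ ⊖ f) ^ p        E.≈⟨ ^-congˡ p (A.-‿inverseʳ f) ⟩
    𝟘 ^ p                E.≈⟨ 0^p p p-prime ⟩
    𝟘                    E.∎)

  -- Once `Δ` is seen as a multiplication, this is the Frobenius map of the power series ring at 1 -
  -- X.
  Δ^-prime : ∀ f → Δ^ 1 p f ≋ Δ p f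
  Δ^-prime f = E.begin
    Δ^ 1 p f                            E.≈⟨ ⊛-Δ^ p f ⟨
    1-X^ 1 ^ p ⊛ f                      E.≈⟨ A.*-congʳ (frobenius-+ 𝟙 (⊖ (X ^ 1))) ⟩
    (𝟙 ^ p ⊕ (⊖ (X ^ 1)) ^ p) ⊛ f       E.≈⟨ A.*-congʳ (A.+-cong (1^ p) (A.trans (^-congˡ p (A.-‿cong (A.*-identityʳ X))) (neg-^p X))) ⟩
    1-X^ p ⊛ f                          E.≈⟨ ⊛-Δ p f ⟩
    Δ p f                               E.∎

  Δ^-prime-* : ∀ k f i → Δ^ 1 (k ℕ.* p) f i ≈ Δ^ p k f i
  Δ^-prime-* zero    f i = refl
  Δ^-prime-* (suc k) f i = trans (reflexive (≡.cong (λ g → g i) (fold-+ f (Δ 1) p)))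
    (trans (at (Δ^-prime (Δ^ 1 (k ℕ.* p) f)) i) (Δ-cong p (Δ^-prime-* k f) i))

  -- (1 − X)^k (x + y X) = (1 − X)^(k+2) Σ_l (x + l (x + y)) X^l, and (1 − X)^(jp) = (1 − X^p)^j.
  Δ^-linear : ∀ k j → k ℕ.+ 2 ≡ j ℕ.* p → ∀ x y l → l ℕ.< p → ∀ m →
    Δ^ 1 k (linear x y) (l ℕ.+ m ℕ.* p) ≈ arithmetic x (x + y) l * Δ^ 1 j (λ _ → 1#) m
  Δ^-linear k j k+2≡jp x y l l<p m = begin
    Δ^ 1 k (linear x y) (l ℕ.+ m ℕ.* p)
      ≈⟨ Δ^-cong 1 k (Δ²-arithmetic x y) (l ℕ.+ m ℕ.* p) ⟨
    Δ^ 1 k (Δ^ 1 2 L) (l ℕ.+ m ℕ.* p)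
      ≡⟨ ≡.cong (λ g → g (l ℕ.+ m ℕ.* p)) (fold-+ L (Δ 1) k) ⟨
    Δ^ 1 (k ℕ.+ 2) L (l ℕ.+ m ℕ.* p)
      ≡⟨ ≡.cong (λ n → Δ^ 1 n L (l ℕ.+ m ℕ.* p)) k+2≡jp ⟩
    Δ^ 1 (j ℕ.* p) L (l ℕ.+ m ℕ.* p)
      ≈⟨ Δ^-prime-* j L (l ℕ.+ m ℕ.* p) ⟩
    column p l (Δ^ p j L) m
      ≈⟨ column-Δ^ j L l<p m ⟩
    Δ^ 1 j (column p l L) m
      ≈⟨ Δ^-cong 1 j L-periodic m ⟩
    Δ^ 1 j (λ _ → L l * 1#) m
      ≈⟨ Δ^-scale j (L l) (λ _ → 1#) m ⟩
    L l * Δ^ 1 j (λ _ → 1#) m ∎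
    where
    open SetoidReasoning setoid
    L = arithmetic x (x + y)
    -- The progression has period p because p-fold sums vanish, so each class modulo p is a constant
    -- series.
    L-periodic : ∀ m → L (l ℕ.+ m ℕ.* p) ≈ L l * 1#
    L-periodic m = begin
      x + (l ℕ.+ m ℕ.* p) ×ᵣ (x + y)                      ≈⟨ +-congˡ (×-homo-+ (x + y) l (m ℕ.* p)) ⟩
      x + (l ×ᵣ (x + y) + (m ℕ.* p) ×ᵣ (x + y))           ≡⟨ ≡.cong (λ n → x + (l ×ᵣ (x + y) + n ×ᵣ (x + y))) (ℕₚ.*-comm m p) ⟩
      x + (l ×ᵣ (x + y) + (p ℕ.* m) ×ᵣ (x + y))           ≈⟨ +-congˡ (+-congˡ (×-assocˡ (x + y) p m)) ⟨
      x + (l ×ᵣ (x + y) + p ×ᵣ (m ×ᵣ (x + y)))            ≈⟨ +-congˡ (trans (+-congˡ (p×≈0 _)) (+-identityʳ _)) ⟩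
      L l                                                 ≈⟨ *-identityʳ _ ⟨
      L l * 1#                                            ∎

-- The polynomial (1 - b) (2 - b) ⋯ (p - b) modulo p.

module PrimeFactorial {p : ℕ} (p-prime : Prime p) where
  open Residues p-prime
  open Sequences (ℤmod p)
  open Polynomials (ℤmod p)
  open Differences (ℤmod p)
  open PowerSeriesPrimeCharacteristic (ℤmod p) p-prime p×≈0 using (X^-⊛)
  private
    module A = CommutativeRing powerSeriesRing
  open SetoidReasoning setoid

  -- (−1)^m m! times the binomial coefficient of b − 1 over m
  factorialPoly : ℕ → Seq
  factorialPoly zero    = 𝟙
  factorialPoly (suc m) = factorialPoly m ⊛ linear (+ suc m) -1ℤ

  degree-factorialPoly : ∀ m → Degree≤ m (factorialPoly m)
  degree-factorialPoly zero (suc i) _ = refl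
  degree-factorialPoly (suc m) = ≡.subst (λ d → Degree≤ d (factorialPoly (suc m))) (ℕₚ.+-comm m 1)
    (Degree≤-⊛ m 1 (degree-factorialPoly m) (Degree≤-linear (+ suc m) -1ℤ))

  leading-factorialPoly : ∀ m → factorialPoly m m ≈ -1ℤ ^ m
  leading-factorialPoly zero = refl
  leading-factorialPoly (suc m) = begin
    factorialPoly (suc m) (suc m)      ≡⟨ ≡.cong (factorialPoly (suc m)) (ℕₚ.+-comm m 1) ⟨
    factorialPoly (suc m) (m ℕ.+ 1)    ≈⟨ ⊛-leading m 1 (degree-factorialPoly m) (Degree≤-linear (+ suc m) -1ℤ) ⟩
    factorialPoly m m ℤ.* -1ℤ          ≡⟨ ℤₚ.*-comm (factorialPoly m m) -1ℤ ⟩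
    -1ℤ ℤ.* factorialPoly m m          ≈⟨ *-cong {x = -1ℤ} refl (leading-factorialPoly m) ⟩
    -1ℤ ^ suc m                        ∎

  constant-factorialPoly : ∀ m → factorialPoly m 0 ≡ + (m !)
  constant-factorialPoly zero = ≡.refl
  constant-factorialPoly (suc m) = ≡.trans (≡.cong (ℤ._* + suc m) (constant-factorialPoly m))
    (≡.trans (≡.sym (ℤₚ.pos-* (m !) (suc m))) (≡.cong +_ (ℕₚ.*-comm (m !) (suc m))))

  factorialPoly-suc : ∀ m i → factorialPoly (suc m) i ≈ (linear (+ suc m) -1ℤ ⊛ factorialPoly m) i
  factorialPoly-suc m = ⊛-comm-at (factorialPoly m) (linear (+ suc m) -1ℤ)

  private
    root-factorialPoly : ∀ m i → i ℕ.< m → eval (suc m) (factorialPoly m) (+ suc i) ≈ 0ℤ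
    root-factorialPoly (suc m) i i<1+m = begin
      eval (2 ℕ.+ m) (factorialPoly (suc m)) x
        ≈⟨ eval-cong (2 ℕ.+ m) x (factorialPoly-suc m) ⟩
      eval (2 ℕ.+ m) (linear (+ suc m) -1ℤ ⊛ factorialPoly m) x
        ≈⟨ eval-linear-⊛ (suc m) (+ suc m) -1ℤ (factorialPoly m) x (degree-factorialPoly m (suc m) ℕₚ.≤-refl) ⟩
      (+ suc m ℤ.+ -1ℤ ℤ.* x) ℤ.* eval (suc m) (factorialPoly m) x
        ≈⟨ vanish (ℕₚ.<-cmp i m) ⟩
      0ℤ ∎
      where
      x = + suc i
      vanish : _ → (+ suc m ℤ.+ -1ℤ ℤ.* x) ℤ.* eval (suc m) (factorialPoly m) x ≈ 0ℤ
      vanish (tri< i<m _ _) = trans (*-cong {x = + suc m ℤ.+ -1ℤ ℤ.* x} refl (root-factorialPoly m i i<m))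
        (reflexive (ℤₚ.*-zeroʳ (+ suc m ℤ.+ -1ℤ ℤ.* x)))
      vanish (tri≈ _ ≡.refl _) = reflexive (≡.trans (≡.cong (ℤ._* eval (suc m) (factorialPoly m) x)
        (≡.trans (≡.cong (λ y → + suc m ℤ.+ y) (ℤₚ.-1*i≡-i (+ suc m))) (ℤₚ.+-inverseʳ (+ suc m))))
        (ℤₚ.*-zeroˡ (eval (suc m) (factorialPoly m) x)))
      vanish (tri> _ _ m<i) = contradiction i<1+m (ℕₚ.<⇒≱ (s≤s m<i))

    eval-zero : ∀ n {f} x → (∀ i → f i ≈ 0ℤ) → eval n f x ≈ 0ℤ
    eval-zero zero x e = refl
    eval-zero (suc n) {f} x e = trans (+-cong (e 0) (*-cong {x = x} refl (eval-zero n {tail f} x (e ∘ suc))))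
      (reflexive (≡.trans (ℤₚ.+-identityˡ (x ℤ.* 0ℤ)) (ℤₚ.*-zeroʳ x)))

    eval-monomial : ∀ d n x → d ℕ.< n → eval n (shift d 𝟙) x ≈ x ^ d
    eval-monomial zero (suc n) x _ = trans (+-cong {x = 1ℤ} refl (*-cong {x = x} refl (eval-zero n {tail 𝟙} x λ _ → refl)))
      (reflexive (≡.cong (λ y → 1ℤ ℤ.+ y) (ℤₚ.*-zeroʳ x)))
    eval-monomial (suc d) (suc n) x (s≤s d<n) = trans (+-cong {x = 0ℤ} refl (*-cong {x = x} refl (eval-monomial d n x d<n)))
      (reflexive (ℤₚ.+-identityˡ _))

    monomial-degree : ∀ d → shift d 𝟙 d ≡ 1ℤ
    monomial-degree zero = ≡.refl
    monomial-degree (suc d) = monomial-degree d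

    monomial-> : ∀ d i → d ℕ.< i → shift d 𝟙 i ≡ 0ℤ
    monomial-> zero (suc i) _ = ≡.refl
    monomial-> (suc d) (suc i) (s≤s d<i) = monomial-> d i d<i

    2≤p : ∀ {n} → Prime n → 2 ℕ.≤ n
    2≤p {zero} q = contradiction q ¬prime[0]
    2≤p {suc zero} q = contradiction q ¬prime[1]
    2≤p {suc (suc n)} q = s≤s (s≤s z≤n)

    1<p = 2≤p p-prime

    -- This is (1 - b) ⋯ (p - b) - b + b^p. The terms of degree p cancel, and 1, ..., p are roots:
    -- of the product by construction, of b^p - b by Fermat's theorem. A polynomial of degree below
    -- p with p incongruent roots is zero.
    remainder : Seq
    remainder = factorialPoly p ⊕ ((λ i → -1ℤ ℤ.* shift 1 𝟙 i) ⊕ shift p 𝟙)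

    remainder-leading : remainder p ≈ 0ℤ
    remainder-leading = begin
      factorialPoly p p ℤ.+ (-1ℤ ℤ.* shift 1 𝟙 p ℤ.+ shift p 𝟙 p)
        -- (-1)^p ≡ -1 is Fermat's theorem at -1, which covers p = 2 as well.
        ≈⟨ +-cong (trans (leading-factorialPoly p) (fermat -1ℤ))
             (reflexive (≡.cong₂ (λ x y → -1ℤ ℤ.* x ℤ.+ y) (monomial-> 1 p 1<p) (monomial-degree p))) ⟩
      0ℤ ∎

    remainder-root : ∀ i → i ℕ.< p → eval p remainder (+ suc i) ≈ 0ℤ
    remainder-root i i<p = begin
      eval p remainder x
        ≈⟨ eval-suc p remainder x remainder-leading ⟨
      eval (suc p) remainder x
        ≈⟨ eval-⊕ (suc p) (factorialPoly p) ((λ i → -1ℤ ℤ.* shift 1 𝟙 i) ⊕ shift p 𝟙) x ⟩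
      eval (suc p) (factorialPoly p) x ℤ.+ eval (suc p) ((λ i → -1ℤ ℤ.* shift 1 𝟙 i) ⊕ shift p 𝟙) x
        ≈⟨ +-cong (root-factorialPoly p i i<p) (eval-⊕ (suc p) (λ i → -1ℤ ℤ.* shift 1 𝟙 i) (shift p 𝟙) x) ⟩
      0ℤ ℤ.+ (eval (suc p) (λ i → -1ℤ ℤ.* shift 1 𝟙 i) x ℤ.+ eval (suc p) (shift p 𝟙) x)
        ≈⟨ +-cong {x = 0ℤ} refl (+-cong
             (trans (eval-scale (suc p) -1ℤ (shift 1 𝟙) x) (*-cong {x = -1ℤ} refl (eval-monomial 1 (suc p) x (s≤s (ℕₚ.<⇒≤ 1<p)))))
             (trans (eval-monomial p (suc p) x ℕₚ.≤-refl) (fermat x))) ⟩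
      0ℤ ℤ.+ (-1ℤ ℤ.* (x ℤ.* 1ℤ) ℤ.+ x)
        ≡⟨ cancel x ⟩
      0ℤ ∎
      where
      x = + suc i
      cancel : ∀ x → 0ℤ ℤ.+ (-1ℤ ℤ.* (x ℤ.* 1ℤ) ℤ.+ x) ≡ 0ℤ
      cancel = ℤSolver.solve-∀

    remainder≈0 : ∀ i → remainder i ≈ 0ℤ
    remainder≈0 i with ℕₚ.<-cmp i p
    ... | tri< i<p _ _ = polynomial-with-many-roots p remainder (λ k → + suc k)
            (λ {k} {l} k<l l<p → *-cancelˡ-≈0 (distinct k<l l<p)) remainder-root i i<p
      where
      distinct : ∀ {k l} → k ℕ.< l → l ℕ.< p → ¬ (+ suc k ℤ.- + suc l ≈ 0ℤ)
      distinct {k} {l} k<l l<p e = small≉0 (ℕₚ.m<n⇒0<n∸m k<l) (ℕₚ.≤-<-trans (ℕₚ.m∸n≤m l k) l<p) (begin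
        + (l ℕ.∸ k)              ≡⟨ ℤₚ.⊖-≥ (ℕₚ.<⇒≤ (s≤s k<l)) ⟨
        suc l ℤ.⊖ suc k          ≡⟨ ℤₚ.m-n≡m⊖n (suc l) (suc k) ⟨
        + suc l ℤ.- + suc k      ≈⟨ a≈b⇒a-b≈0 (sym (a-b≈0⇒a≈b {+ suc k} {+ suc l} e)) ⟩
        0ℤ                       ∎)
    ... | tri≈ _ ≡.refl _ = remainder-leading
    ... | tri> _ _ p<i = +-cong (degree-factorialPoly p i p<i)
            (reflexive (≡.cong₂ (λ x y → -1ℤ ℤ.* x ℤ.+ y) (monomial-> 1 i (ℕₚ.<-trans 1<p p<i)) (monomial-> p i p<i)))

  factorialPoly-prime : ∀ i → factorialPoly p i ≈ shift 1 𝟙 i ℤ.- shift p 𝟙 i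
  factorialPoly-prime i = a-b≈0⇒a≈b (trans (reflexive (rearrange (factorialPoly p i) (shift 1 𝟙 i) (shift p 𝟙 i))) (remainder≈0 i))
    where
    rearrange : ∀ x y z → x ℤ.- (y ℤ.- z) ≡ x ℤ.+ (-1ℤ ℤ.* y ℤ.+ z)
    rearrange = ℤSolver.solve-∀

  shift-𝟙-⊛ : ∀ d f → shift d 𝟙 ⊛ f ≋ shift d f
  shift-𝟙-⊛ d f = A.trans (A.*-congʳ (A.trans (A.sym (X^-⊛ d 𝟙)) (A.*-identityʳ _))) (X^-⊛ d f)

  factorialPoly-prime-⊛ : ∀ d → p ≡ suc d → ∀ f i → (factorialPoly p ⊛ f) i ≈ shift 1 (Δ d f) i
  factorialPoly-prime-⊛ d ≡.refl f i = begin
    (factorialPoly p ⊛ f) i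
      ≈⟨ ⊛-cong-at factorialPoly-prime (λ j → refl) i ⟩
    ((shift 1 𝟙 ⊕ ⊖ shift p 𝟙) ⊛ f) i
      ≈⟨ ⊛-distribʳ-at f (shift 1 𝟙) (⊖ shift p 𝟙) i ⟩
    (shift 1 𝟙 ⊛ f) i ℤ.+ ((⊖ shift p 𝟙) ⊛ f) i
      ≈⟨ +-cong (at (shift-𝟙-⊛ 1 f) i) (sym (at (RingProperties.-‿distribˡ-* A.ring (shift p 𝟙) f) i)) ⟩
    shift 1 f i ℤ.- (shift p 𝟙 ⊛ f) i
      ≈⟨ +-cong {x = shift 1 f i} refl (-‿cong (at (shift-𝟙-⊛ p f) i)) ⟩
    shift 1 f i ℤ.- shift p f i
      ≡⟨ split i ⟩
    shift 1 (Δ d f) i ∎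
    where
    split : ∀ i → shift 1 f i ℤ.- shift p f i ≡ shift 1 (Δ d f) i
    split zero = ≡.refl
    split (suc i) = ≡.refl

  -- Compares the coefficients of b in (p - b) · (1 - b) ⋯ (d - b) and in b - b^p: modulo p the
  -- first is -d! and the second is 1.
  wilson : ∀ d → p ≡ suc d → + (d !) ≈ -1ℤ
  wilson d ≡.refl = begin
    + (d !)                                            ≡⟨ double-neg (+ (d !)) (factorialPoly d 1) ⟩
    0ℤ ℤ.- (0ℤ ℤ.* factorialPoly d 1 ℤ.+ -1ℤ ℤ.* + (d !))
      ≈⟨ +-cong {x = 0ℤ} refl (-‿cong (+-cong (*-cong {u = factorialPoly d 1} (sym p≈0) refl) (reflexive (≡.cong (-1ℤ ℤ.*_) (≡.sym (constant-factorialPoly d)))))) ⟩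
    0ℤ ℤ.- (+ p ℤ.* factorialPoly d 1 ℤ.+ -1ℤ ℤ.* factorialPoly d 0)
      ≈⟨ +-cong {x = 0ℤ} refl (-‿cong (linear-⊛-suc (+ p) -1ℤ (factorialPoly d) 0)) ⟨
    0ℤ ℤ.- (linear (+ p) -1ℤ ⊛ factorialPoly d) 1
      ≈⟨ +-cong {x = 0ℤ} refl (-‿cong (factorialPoly-suc d 1)) ⟨
    0ℤ ℤ.- factorialPoly p 1
      ≈⟨ +-cong {x = 0ℤ} refl (-‿cong (factorialPoly-prime 1)) ⟩
    0ℤ ℤ.- (1ℤ ℤ.- shift p 𝟙 1)
      ≡⟨ ≡.cong (λ x → 0ℤ ℤ.- (1ℤ ℤ.- x)) (shift-< 𝟙 1<p) ⟩
    -1ℤ ∎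
    where
    double-neg : ∀ x y → x ≡ 0ℤ ℤ.- (0ℤ ℤ.* y ℤ.+ -1ℤ ℤ.* x)
    double-neg = ℤSolver.solve-∀

  -- Deduced from Fermat's theorem at -1 and not from parity, since d = p - 1 is odd when p = 2.
  even-power : ∀ d → p ≡ suc d → -1ℤ ^ d ≈ 1ℤ
  even-power d ≡.refl = begin
    -1ℤ ^ d                         ≡⟨ double-neg (-1ℤ ^ d) ⟩
    -1ℤ ℤ.* (-1ℤ ℤ.* -1ℤ ^ d)       ≈⟨ *-cong {x = -1ℤ} refl (fermat -1ℤ) ⟩
    1ℤ                              ∎
    where
    double-neg : ∀ x → x ≡ -1ℤ ℤ.* (-1ℤ ℤ.* x)
    double-neg = ℤSolver.solve-∀

-- Degrees, leading and constant coefficients of products.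

module GradedHurwitz {c ℓ} (R : CommutativeRing c ℓ) where
  open CommutativeRing R
  open Sequences R
  open Polynomials R
  private
    module HR = Hurwitz R
  open Hurwitz powerSeriesRing using (_⊠_)

  -- The offsets `s` and `t` serve the induction: passing to the shifted sequence raises the degree
  -- bound of every entry by one.
  Degree≤-⊠ : ∀ n s t {F G} → (∀ m → Degree≤ (m ℕ.+ s) (F m)) → (∀ m → Degree≤ (m ℕ.+ t) (G m)) →
              Degree≤ (n ℕ.+ (s ℕ.+ t)) ((F ⊠ G) n)
  Degree≤-⊠ zero s t dF dG = Degree≤-⊛ s t (dF 0) (dG 0)
  Degree≤-⊠ (suc n) s t {F} {G} dF dG i n<i = trans (+-cong
    (Degree≤-⊠ n (suc s) t (λ m → ≡.subst (λ d → Degree≤ d (F (suc m))) (≡.sym (ℕₚ.+-suc m s)) (dF (suc m))) dG i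
      (≡.subst (ℕ._< i) (≡.sym (ℕₚ.+-suc n (s ℕ.+ t))) n<i))
    (Degree≤-⊠ n s (suc t) dF (λ m → ≡.subst (λ d → Degree≤ d (G (suc m))) (≡.sym (ℕₚ.+-suc m t)) (dG (suc m))) i
      (≡.subst (ℕ._< i) (≡.sym (≡.trans (≡.cong (n ℕ.+_) (ℕₚ.+-suc s t)) (ℕₚ.+-suc n (s ℕ.+ t)))) n<i)))
    (+-identityˡ _)

  -- Taking the coefficient of top degree is multiplicative, hence turns the product of sequences of
  -- polynomials into that of sequences of scalars.
  ⊠-leading : ∀ n s t {F G} → (∀ m → Degree≤ (m ℕ.+ s) (F m)) → (∀ m → Degree≤ (m ℕ.+ t) (G m)) →
              (F ⊠ G) n (n ℕ.+ (s ℕ.+ t)) ≈ ((λ m → F m (m ℕ.+ s)) HR.⊠ (λ m → G m (m ℕ.+ t))) n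
  ⊠-leading zero s t dF dG = ⊛-leading s t (dF 0) (dG 0)
  ⊠-leading (suc n) s t {F} {G} dF dG = +-cong
    (trans (reflexive (≡.cong ((tail-seq F ⊠ G) n) (≡.sym (ℕₚ.+-suc n (s ℕ.+ t)))))
      (trans (⊠-leading n (suc s) t (λ m → ≡.subst (λ d → Degree≤ d (F (suc m))) (≡.sym (ℕₚ.+-suc m s)) (dF (suc m))) dG)
        (HR.⊠-cong (λ m → reflexive (≡.cong (F (suc m)) (ℕₚ.+-suc m s))) (λ _ → refl) n)))
    (trans (reflexive (≡.cong ((F ⊠ tail-seq G) n) (≡.sym (≡.trans (≡.cong (n ℕ.+_) (ℕₚ.+-suc s t)) (ℕₚ.+-suc n (s ℕ.+ t))))))
      (trans (⊠-leading n s (suc t) dF (λ m → ≡.subst (λ d → Degree≤ d (G (suc m))) (≡.sym (ℕₚ.+-suc m t)) (dG (suc m))))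
        (HR.⊠-cong (λ _ → refl) (λ m → reflexive (≡.cong (G (suc m)) (ℕₚ.+-suc m t))) n)))
    where
    tail-seq : (ℕ → Seq) → ℕ → Seq
    tail-seq H m = H (suc m)

  ⊠-constant : ∀ F G n → (F ⊠ G) n 0 ≡ ((λ m → F m 0) HR.⊠ (λ m → G m 0)) n
  ⊠-constant F G zero = ≡.refl
  ⊠-constant F G (suc n) = ≡.cong₂ _+_ (⊠-constant (F ∘ suc) G n) (⊠-constant F (G ∘ suc) n)

-- Factorial quotients and the integral form of the factors.

factorialRatio : ℕ → ℕ → ℕ
factorialRatio n m = (n ! ℕ./ m !) {{m !≢0}}

factorialRatio-* : ∀ {m n} → m ℕ.≤ n → factorialRatio n m ℕ.* m ! ≡ n !
factorialRatio-* {m} m≤n = m/n*n≡m {{m !≢0}} (m≤n⇒m!∣n! m≤n)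

factorialRatio-unique : ∀ {m n q} → n ! ≡ q ℕ.* m ! → factorialRatio n m ≡ q
factorialRatio-unique {m} {n} {q} e = ≡.trans (≡.cong (λ x → (x ℕ./ m !) {{m !≢0}}) e) (m*n/n≡m q (m !) {{m !≢0}})

-- From n! / m! = n! / (t + 1)! · (t + 1) · t! / m!.
factorialRatio-step : ∀ {m t n} → m ℕ.≤ t → suc t ℕ.≤ n → suc t ∣ factorialRatio n m
factorialRatio-step {m} {t} {n} m≤t t<n = ≡.subst (suc t ∣_) (≡.sym (factorialRatio-unique {m} {n} (begin
    n !                                                         ≡⟨ factorialRatio-* t<n ⟨
    a ℕ.* (suc t ℕ.* t !)                                       ≡⟨ ≡.cong (λ x → a ℕ.* (suc t ℕ.* x)) (factorialRatio-* m≤t) ⟨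
    a ℕ.* (suc t ℕ.* (b ℕ.* m !))                               ≡⟨ ≡.cong (a ℕ.*_) (≡.sym (ℕₚ.*-assoc (suc t) b (m !))) ⟩
    a ℕ.* (suc t ℕ.* b ℕ.* m !)                                 ≡⟨ ≡.sym (ℕₚ.*-assoc a (suc t ℕ.* b) (m !)) ⟩
    a ℕ.* (suc t ℕ.* b) ℕ.* m !                                 ∎)))
  (∣n⇒∣m*n a (∣m⇒∣m*n b ∣-refl))
  where
  open ≡.≡-Reasoning
  a = factorialRatio n (suc t)
  b = factorialRatio t m

-- Among the integers in (m, n] there is a multiple of p.
∣factorialRatio : ∀ p .{{_ : ℕ.NonZero p}} {m n} → p ℕ.≤ n → m ℕ.+ m ℕ.≤ n → p ∣ factorialRatio n m
∣factorialRatio p {m} {n} p≤n 2m≤n = go (n ℕ./ p ℕ.* p) ≡.refl (m/n*n≤m n p)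
  where
  n<t+p : n ℕ.< n ℕ./ p ℕ.* p ℕ.+ p
  n<t+p = ≡.subst₂ ℕ._<_ (≡.sym (m≡m%n+[m/n]*n n p)) (ℕₚ.+-comm p (n ℕ./ p ℕ.* p)) (ℕₚ.+-monoˡ-< (n ℕ./ p ℕ.* p) (m%n<n n p))
  go : ∀ t → t ≡ n ℕ./ p ℕ.* p → t ℕ.≤ n → p ∣ factorialRatio n m
  go zero e _ = contradiction (≡.subst (λ t → n ℕ.< t ℕ.+ p) (≡.sym e) n<t+p) (ℕₚ.≤⇒≯ p≤n)
  go (suc t) e t<n with suc t ℕ.≤? m
  ... | no 1+t≰m = ∣-trans (divides (n ℕ./ p) e) (factorialRatio-step (ℕ.s≤s⁻¹ (ℕₚ.≰⇒> 1+t≰m)) t<n)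
  -- `suc t` is the largest multiple of p up to n. If it were at most m, then p would be at most m
  -- too, and the next multiple would still be at most 2 m ≤ n.
  ... | yes 1+t≤m = contradiction
        (≡.subst (λ t → n ℕ.< t ℕ.+ p) (≡.sym e) n<t+p)
        (ℕₚ.≤⇒≯ (ℕₚ.≤-trans (ℕₚ.+-mono-≤ 1+t≤m (∣⇒≤ (divides (n ℕ./ p) e))) (ℕₚ.≤-trans (ℕₚ.+-monoʳ-≤ m 1+t≤m) 2m≤n)))

module IntegralFactors {p : ℕ} (p-prime : Prime p) where
  open Residues p-prime
  open Sequences (ℤmod p)
  open Polynomials (ℤmod p)
  open Differences (ℤmod p)
  open PowerSeriesPrimeCharacteristic (ℤmod p) p-prime p×≈0 using (p×ₐ≈0)
  open PrimeFactorial p-prime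
  open GradedHurwitz (ℤmod p)
  private
    module A = CommutativeRing powerSeriesRing
    module Hℤ = Hurwitz (ℤmod p)
  module SA = Sequences powerSeriesRing
  open Hurwitz powerSeriesRing
  open PrimeCharacteristic powerSeriesRing p-prime p×ₐ≈0

  private instance
    p≢0 : ℕ.NonZero p
    p≢0 = prime⇒nonZero p-prime

  -- n! times the coefficient of q^n in (1 − q^(k+1))^(b−1)
  integralFactor : ℕ → ℕ → Seq
  integralFactor k n with suc k ∣? n
  ... | yes _ = λ i → + factorialRatio n (n ℕ./ suc k) ℤ.* factorialPoly (n ℕ./ suc k) i
  ... | no  _ = 𝟘

  integralFactor-0 : ∀ n i → integralFactor 0 n i ≡ factorialPoly n i
  integralFactor-0 n i with 1 ∣? n
  ... | yes _ = ≡.trans (≡.cong (λ m → + factorialRatio n m ℤ.* factorialPoly m i) (n/1≡n n))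
                  (≡.trans (≡.cong (λ a → + a ℤ.* factorialPoly n i) (factorialRatio-unique {n} {n} {1} (≡.sym (ℕₚ.+-identityʳ (n !)))))
                    (ℤₚ.*-identityˡ (factorialPoly n i)))
  ... | no 1∤n = contradiction (1∣ n) 1∤n

  -- The quotient m of n by k + 2 is at most n / 2, so for n ≥ p the ratio n! / m! contains a
  -- multiple of p.
  integralFactor-suc : ∀ k n i → p ℕ.≤ n → integralFactor (suc k) n i ≈ 0ℤ
  integralFactor-suc k n i p≤n with suc (suc k) ∣? n
  ... | no _ = refl
  ... | yes d = trans (*-cong {u = factorialPoly m i}
          (+∣⇒≈0 (∣factorialRatio p {m} {n} p≤n 2m≤n)) refl) (reflexive (ℤₚ.*-zeroˡ (factorialPoly m i)))
    where
    m = n ℕ./ suc (suc k)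
    2m≤n : m ℕ.+ m ℕ.≤ n
    2m≤n = ℕₚ.≤-trans (ℕₚ.≤-trans (ℕₚ.+-monoʳ-≤ m (ℕₚ.m≤m+n m (k ℕ.* m))) (ℕₚ.≤-reflexive (ℕₚ.*-comm (suc (suc k)) m)))
             (m/n*n≤m n (suc (suc k)))

  constant-integralFactor : ∀ k n → suc k ∣ n → integralFactor k n 0 ≡ + (n !)
  constant-integralFactor k n k∣n with suc k ∣? n
  ... | yes _ = ≡.trans (≡.cong (λ x → + factorialRatio n m ℤ.* x) (constant-factorialPoly m))
                  (≡.trans (≡.sym (ℤₚ.pos-* (factorialRatio n m) (m !))) (≡.cong +_ (factorialRatio-* (m/n≤m n (suc k)))))
    where m = n ℕ./ suc k
  ... | no ¬d = contradiction k∣n ¬d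

  constant-integralFactor-∤ : ∀ k n → ¬ suc k ∣ n → integralFactor k n 0 ≡ 0ℤ
  constant-integralFactor-∤ k n k∤n with suc k ∣? n
  ... | yes d = contradiction d k∤n
  ... | no _ = ≡.refl

  Degree≤-integralFactor : ∀ k n → Degree≤ (n ℕ.+ 0) (integralFactor k n)
  Degree≤-integralFactor k n i n<i with suc k ∣? n
  ... | no _ = refl
  ... | yes _ = trans (*-cong {x = + factorialRatio n m} refl
          (degree-factorialPoly m i (ℕₚ.≤-<-trans (m/n≤m n (suc k)) (≡.subst (ℕ._< i) (ℕₚ.+-identityʳ n) n<i))))
          (reflexive (ℤₚ.*-zeroʳ (+ factorialRatio n m)))
    where m = n ℕ./ suc k

  leading-integralFactor-0 : ∀ n → integralFactor 0 n (n ℕ.+ 0) ≈ -1ℤ ^ n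
  leading-integralFactor-0 n = trans (reflexive (≡.trans (integralFactor-0 n (n ℕ.+ 0)) (≡.cong (factorialPoly n) (ℕₚ.+-identityʳ n))))
    (leading-factorialPoly n)

  -- The degree is at most n / (k + 2), which is below n unless n = 0. In top degree these factors
  -- therefore behave like the constant 1.
  leading-integralFactor-suc : ∀ k n → integralFactor (suc k) n (n ℕ.+ 0) ≈ 𝟙 n
  leading-integralFactor-suc k zero with suc (suc k) ∣? 0
  ... | yes _ = refl
  ... | no ¬d = contradiction (suc (suc k) ∣0) ¬d
  leading-integralFactor-suc k (suc n) with suc (suc k) ∣? suc n
  ... | no _ = refl
  ... | yes _ = trans (*-cong {x = + factorialRatio (suc n) m} refl
          (degree-factorialPoly m (suc n ℕ.+ 0) (ℕₚ.<-≤-trans (m/n<m (suc n) (suc (suc k)) (s≤s (s≤s z≤n))) (ℕₚ.m≤m+n (suc n) 0))))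
          (reflexive (ℤₚ.*-zeroʳ (+ factorialRatio (suc n) m)))
    where m = suc n ℕ./ suc (suc k)

  productOf : (ℕ → ℕ → Seq) → ℕ → ℕ → Seq
  productOf h N = foldr _⊠_ SA.𝟙 (applyUpTo h N)

  private
    -- Modulo p the linear factors repeat: p + 1 - b, p + 2 - b, ... are 1 - b, 2 - b, ... again.
    eigen-factorialPoly : ∀ n → factorialPoly (p ℕ.+ n) ≋ factorialPoly p ⊛ factorialPoly n
    eigen-factorialPoly zero = A.trans (A.reflexive (≡.cong factorialPoly (ℕₚ.+-identityʳ p))) (A.sym (A.*-identityʳ (factorialPoly p)))
    eigen-factorialPoly (suc n) = E.begin
      factorialPoly (p ℕ.+ suc n)                                      E.≡⟨ ≡.cong factorialPoly (ℕₚ.+-suc p n) ⟩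
      factorialPoly (p ℕ.+ n) ⊛ linear (+ suc (p ℕ.+ n)) -1ℤ           E.≈⟨ A.*-cong (eigen-factorialPoly n) (pointwise linear≈) ⟩
      factorialPoly p ⊛ factorialPoly n ⊛ linear (+ suc n) -1ℤ         E.≈⟨ A.*-assoc (factorialPoly p) (factorialPoly n) (linear (+ suc n) -1ℤ) ⟩
      factorialPoly p ⊛ factorialPoly (suc n)                          E.∎
      where
      module E = SetoidReasoning A.setoid
      linear≈ : ∀ i → linear (+ suc (p ℕ.+ n)) -1ℤ i ≈ linear (+ suc n) -1ℤ i
      linear≈ zero = trans (reflexive (≡.cong +_ (≡.sym (ℕₚ.+-suc p n)))) (trans (+-cong {x = + p} {u = + suc n} p≈0 refl) (reflexive (ℤₚ.+-identityˡ (+ suc n))))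
      linear≈ (suc zero) = refl
      linear≈ (suc (suc i)) = refl

    eigen-0 : Eigen (factorialPoly p) (integralFactor 0)
    eigen-0 n = A.trans (pointwise λ i → reflexive (integralFactor-0 (p ℕ.+ n) i))
      (A.trans (eigen-factorialPoly n) (A.*-congˡ {factorialPoly p} (pointwise λ i → sym (reflexive (integralFactor-0 n i)))))

    eigen-suc : ∀ k → Eigen 𝟘 (integralFactor (suc k))
    eigen-suc k n = A.trans (pointwise λ i → integralFactor-suc k (p ℕ.+ n) i (ℕₚ.m≤m+n p n)) (A.sym (A.zeroˡ (integralFactor (suc k) n)))

    eigen-𝟙 : Eigen 𝟘 SA.𝟙
    eigen-𝟙 n = A.trans (A.reflexive (lemma p p-prime)) (A.sym (A.zeroˡ (SA.𝟙 n)))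
      where
      lemma : ∀ m → Prime m → SA.𝟙 (m ℕ.+ n) ≡ 𝟘
      lemma zero q = contradiction q ¬prime[0]
      lemma (suc m) _ = ≡.refl

    eigen-product : ∀ N h → (∀ k → Eigen 𝟘 (h k)) → Eigen 𝟘 (productOf h N)
    eigen-product zero    h e = eigen-𝟙
    eigen-product (suc N) h e n = A.trans (⊠-eigen (e 0) (eigen-product N (h ∘ suc) (e ∘ suc)) n)
      (A.*-congʳ {productOf h (suc N) n} (A.+-identityˡ 𝟘))

    degree-product : ∀ N h → (∀ k n → Degree≤ (n ℕ.+ 0) (h k n)) → ∀ n → Degree≤ (n ℕ.+ 0) (productOf h N n)
    degree-product zero h d zero (suc i) _ = refl
    degree-product zero h d (suc n) i _ = refl
    degree-product (suc N) h d n = Degree≤-⊠ n 0 0 (d 0) (degree-product N (h ∘ suc) (d ∘ suc))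

    leading-product : ∀ N h → (∀ k n → Degree≤ (n ℕ.+ 0) (h k n)) → (∀ k n → h k n (n ℕ.+ 0) ≈ 𝟙 n) →
      ∀ n → productOf h N n (n ℕ.+ 0) ≈ 𝟙 n
    leading-product zero h d e zero = refl
    leading-product zero h d e (suc n) = refl
    leading-product (suc N) h d e n =
      trans (⊠-leading n 0 0 (d 0) (degree-product N (h ∘ suc) (d ∘ suc)))
        (trans (Hℤ.⊠-cong (e 0) (leading-product N (h ∘ suc) (d ∘ suc) (e ∘ suc)) n)
          (Hℤ.⊠-identityʳ 𝟙 𝟙 refl (λ _ → refl) n))

  -- The number of factors is kept apart from the index of the coefficient, because the recursion
  -- lowers the index by p while the product stays the same.
  integralProduct : ℕ → ℕ → Seq
  integralProduct = productOf integralFactor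

  eigen-integralProduct : ∀ N → Eigen (factorialPoly p) (integralProduct (suc N))
  eigen-integralProduct N n = A.trans (⊠-eigen eigen-0 (eigen-product N (integralFactor ∘ suc) eigen-suc) n)
    (A.*-congʳ {integralProduct (suc N) n} (A.+-identityʳ (factorialPoly p)))

  Degree≤-integralProduct : ∀ N n → Degree≤ n (integralProduct N n)
  Degree≤-integralProduct N n = ≡.subst (λ d → Degree≤ d (integralProduct N n)) (ℕₚ.+-identityʳ n)
    (degree-product N integralFactor Degree≤-integralFactor n)

  -- In top degree every factor after the first becomes 1, and the first one becomes exp (-q).
  leading-integralProduct : ∀ N n → integralProduct (suc N) n n ≈ -1ℤ ^ n
  leading-integralProduct N n = trans (reflexive (≡.cong (integralProduct (suc N) n) (≡.sym (ℕₚ.+-identityʳ n))))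
    (trans (⊠-leading n 0 0 (Degree≤-integralFactor 0) (degree-product N (integralFactor ∘ suc) (Degree≤-integralFactor ∘ suc)))
      (trans (Hℤ.⊠-cong leading-integralFactor-0 (leading-product N (integralFactor ∘ suc) (Degree≤-integralFactor ∘ suc) leading-integralFactor-suc) n)
        (Hℤ.⊠-identityʳ (-1ℤ ^_) 𝟙 refl (λ _ → refl) n)))

  private
    Δ-shift : ∀ d f i → Δ d (shift 1 f) i ≈ shift 1 (Δ d f) i
    Δ-shift d f zero = reflexive (≡.cong (λ x → 0ℤ ℤ.- x) (shift-zero d))
      where
      shift-zero : ∀ d → shift d (shift 1 f) 0 ≡ 0ℤ
      shift-zero zero = ≡.refl
      shift-zero (suc d) = ≡.refl
    Δ-shift d f (suc i) = reflexive (≡.cong (λ x → f i ℤ.- x) (shift-suc d i))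
      where
      shift-suc : ∀ d i → shift d (shift 1 f) (suc i) ≡ shift d f i
      shift-suc zero i = ≡.refl
      shift-suc (suc zero) zero = ≡.refl
      shift-suc (suc (suc d)) zero = ≡.refl
      shift-suc (suc d) (suc i) = shift-suc d i

    Δ-shift^ : ∀ d k f i → Δ d (shift k f) i ≈ shift k (Δ d f) i
    Δ-shift^ d zero f i = refl
    Δ-shift^ d (suc k) f i = trans (Δ-cong d (shift-1+ k f) i) (trans (Δ-shift d (shift k f) i)
      (trans (shift-cong 1 (Δ-shift^ d k f) i) (sym (shift-1+ k (Δ d f) i))))
      where
      shift-1+ : ∀ k f i → shift (suc k) f i ≈ shift 1 (shift k f) i
      shift-1+ k f zero = refl
      shift-1+ k f (suc i) = refl

  -- The eigenvalue factorialPoly p is b − b^p = b (1 − b^(p−1)).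
  integralProduct-* : ∀ d → p ≡ suc d → ∀ N k r i →
    integralProduct (suc N) (k ℕ.* p ℕ.+ r) i ≈ shift k (Δ^ d k (integralProduct (suc N) r)) i
  integralProduct-* d p≡1+d N zero r i = refl
  integralProduct-* d p≡1+d N (suc k) r i = begin
    G (p ℕ.+ k ℕ.* p ℕ.+ r) i                        ≡⟨ ≡.cong (λ n → G n i) (ℕₚ.+-assoc p (k ℕ.* p) r) ⟩
    G (p ℕ.+ (k ℕ.* p ℕ.+ r)) i                      ≈⟨ at (eigen-integralProduct N (k ℕ.* p ℕ.+ r)) i ⟩
    (factorialPoly p ⊛ G (k ℕ.* p ℕ.+ r)) i          ≈⟨ factorialPoly-prime-⊛ d p≡1+d (G (k ℕ.* p ℕ.+ r)) i ⟩
    shift 1 (Δ d (G (k ℕ.* p ℕ.+ r))) i              ≈⟨ shift-cong 1 (Δ-cong d (integralProduct-* d p≡1+d N k r)) i ⟩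
    shift 1 (Δ d (shift k (Δ^ d k (G r)))) i         ≈⟨ shift-cong 1 (Δ-shift^ d k (Δ^ d k (G r))) i ⟩
    shift 1 (shift k (Δ^ d (suc k) (G r))) i         ≡⟨ shift-1+ i ⟩
    shift (suc k) (Δ^ d (suc k) (G r)) i             ∎
    where
    open SetoidReasoning setoid
    G = integralProduct (suc N)
    shift-1+ : ∀ i → shift 1 (shift k (Δ^ d (suc k) (G r))) i ≡ shift (suc k) (Δ^ d (suc k) (G r)) i
    shift-1+ zero = ≡.refl
    shift-1+ (suc i) = ≡.refl

-- Finite sums and the counting of residues.

Σ< : ℕ → (ℕ → ℕ) → ℕ
Σ< zero    f = 0
Σ< (suc n) f = f 0 ℕ.+ Σ< n (f ∘ suc)

Σ<-cong : ∀ n {f g} → (∀ i → i ℕ.< n → f i ≡ g i) → Σ< n f ≡ Σ< n g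
Σ<-cong zero    e = ≡.refl
Σ<-cong (suc n) e = ≡.cong₂ ℕ._+_ (e 0 (s≤s z≤n)) (Σ<-cong n λ i i<n → e (suc i) (s≤s i<n))

Σ<-zero : ∀ n {f} → (∀ i → i ℕ.< n → f i ≡ 0) → Σ< n f ≡ 0
Σ<-zero zero    e = ≡.refl
Σ<-zero (suc n) e = ≡.cong₂ ℕ._+_ (e 0 (s≤s z≤n)) (Σ<-zero n λ i i<n → e (suc i) (s≤s i<n))

Σ<-distrib-+ : ∀ n f g → Σ< n (λ i → f i ℕ.+ g i) ≡ Σ< n f ℕ.+ Σ< n g
Σ<-distrib-+ zero    f g = ≡.refl
Σ<-distrib-+ (suc n) f g = ≡.trans (≡.cong (f 0 ℕ.+ g 0 ℕ.+_) (Σ<-distrib-+ n (f ∘ suc) (g ∘ suc)))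
  (interchange (f 0) (g 0) _ _)
  where open CommutativeSemigroupProperties ℕₚ.+-commutativeSemigroup using (interchange)

Σ<-swap : ∀ m n (f : ℕ → ℕ → ℕ) → Σ< m (λ i → Σ< n (f i)) ≡ Σ< n (λ j → Σ< m (λ i → f i j))
Σ<-swap zero    n f = ≡.sym (Σ<-zero n λ _ _ → ≡.refl)
Σ<-swap (suc m) n f = ≡.trans (≡.cong (Σ< n (f 0) ℕ.+_) (Σ<-swap m n (f ∘ suc)))
  (≡.sym (Σ<-distrib-+ n (f 0) (λ j → Σ< m (λ i → f (suc i) j))))

Σ<-+ : ∀ m n f → Σ< (m ℕ.+ n) f ≡ Σ< m f ℕ.+ Σ< n (λ i → f (m ℕ.+ i))
Σ<-+ zero    n f = ≡.refl
Σ<-+ (suc m) n f = ≡.trans (≡.cong (f 0 ℕ.+_) (Σ<-+ m n (f ∘ suc))) (≡.sym (ℕₚ.+-assoc (f 0) _ _))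

Σ<-* : ∀ m n f → Σ< (m ℕ.* n) f ≡ Σ< m (λ i → Σ< n (λ j → f (j ℕ.+ i ℕ.* n)))
Σ<-* zero    n f = ≡.refl
Σ<-* (suc m) n f = ≡.trans (Σ<-+ n (m ℕ.* n) f) (≡.cong₂ ℕ._+_
  (Σ<-cong n λ j _ → ≡.cong f (≡.sym (ℕₚ.+-identityʳ j)))
  (≡.trans (Σ<-* m n (λ i → f (n ℕ.+ i)))
    (Σ<-cong m λ i _ → Σ<-cong n λ j _ → ≡.cong f (exchange j (i ℕ.* n)))))
  where
  exchange : ∀ j k → n ℕ.+ (j ℕ.+ k) ≡ j ℕ.+ (n ℕ.+ k)
  exchange j k = ≡.trans (≡.sym (ℕₚ.+-assoc n j k)) (≡.trans (≡.cong (ℕ._+ k) (ℕₚ.+-comm n j)) (ℕₚ.+-assoc j n k))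

Σ<-unique : ∀ n f k → k ℕ.< n → f k ≡ 1 → (∀ i → i ℕ.< n → ¬ i ≡ k → f i ≡ 0) → Σ< n f ≡ 1
Σ<-unique (suc n) f zero k<n fk others = ≡.cong₂ ℕ._+_ fk (Σ<-zero n λ i i<n → others (suc i) (s≤s i<n) λ ())
Σ<-unique (suc n) f (suc k) (s≤s k<n) fk others = ≡.cong₂ ℕ._+_ (others 0 (s≤s z≤n) λ ())
  (Σ<-unique n (f ∘ suc) k k<n fk λ i i<n i≢k → others (suc i) (s≤s i<n) (i≢k ∘ ℕₚ.suc-injective))

module Counting {p : ℕ} (p-prime : Prime p) where
  open Residues p-prime
  open Sequences (ℤmod p) using (Seq)
  open Polynomials (ℤmod p)
  open Differences (ℤmod p)
  open PowerSeriesPrimeCharacteristic (ℤmod p) p-prime p×≈0 using (Δ^-linear)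

  infix 4 _≈?_
  _≈?_ : ∀ a b → Dec (a ≈ b)
  a ≈? b = map′ (congruent ∘ ℤDiv.∣ᵤ⇒∣) (λ (congruent d) → ℤDiv.∣⇒∣ᵤ d) (p ∣? ℤ.∣ a ℤ.- b ∣)

  indicator : ℤ → ℤ → ℕ
  indicator r a = if does (a ≈? r) then 1 else 0

  indicator-1 : ∀ {r a} → a ≈ r → indicator r a ≡ 1
  indicator-1 {r} {a} e = ≡.cong (if_then 1 else 0) (dec-true (a ≈? r) e)

  indicator-0 : ∀ {r a} → ¬ a ≈ r → indicator r a ≡ 0
  indicator-0 {r} {a} e = ≡.cong (if_then 1 else 0) (dec-false (a ≈? r) e)

  indicator-cong : ∀ r {a b} → a ≈ b → indicator r a ≡ indicator r b
  indicator-cong r {a} {b} a≈b = decide (a ≈? r)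
    where
    decide : Dec (a ≈ r) → indicator r a ≡ indicator r b
    decide (yes a≈r) = ≡.trans (indicator-1 a≈r) (≡.sym (indicator-1 (trans (sym a≈b) a≈r)))
    decide (no  a≉r) = ≡.trans (indicator-0 a≉r) (≡.sym (indicator-0 (λ b≈r → a≉r (trans a≈b b≈r))))

  indicator-zero : ∀ {r a} → ¬ r ≈ 0ℤ → a ≈ 0ℤ → indicator r a ≡ 0
  indicator-zero r≉0 a≈0 = indicator-0 (λ a≈r → r≉0 (trans (sym a≈r) a≈0))

  count : ℤ → ℕ → Seq → ℕ
  count r n f = Σ< n (indicator r ∘ f)

  count-cong : ∀ r n {f g} → (∀ i → f i ≈ g i) → count r n f ≡ count r n g
  count-cong r n e = Σ<-cong n λ i _ → indicator-cong r (e i)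

  -- Only nonzero residues are compared, so the number of counted terms may be enlarged at will
  -- beyond the degree.
  Equidistributed : ℕ → Seq → Set
  Equidistributed n f = ∀ {r s} → ¬ r ≈ 0ℤ → ¬ s ≈ 0ℤ → count r n f ≡ count s n f

  Equidistributed-cong : ∀ n {f g} → (∀ i → f i ≈ g i) → Equidistributed n f → Equidistributed n g
  Equidistributed-cong n e ef {r} {s} r≉0 s≉0 =
    ≡.trans (≡.sym (count-cong r n e)) (≡.trans (ef r≉0 s≉0) (count-cong s n e))

  Equidistributed-columns : ∀ m d f → (∀ c → c ℕ.< d → Equidistributed m (column d c f)) → Equidistributed (m ℕ.* d) f
  Equidistributed-columns m d f e {r} {s} r≉0 s≉0 =
    ≡.trans (by-columns r) (≡.trans (Σ<-cong d λ c c<d → e c c<d r≉0 s≉0) (≡.sym (by-columns s)))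
    where
    by-columns : ∀ r → count r (m ℕ.* d) f ≡ Σ< d (λ c → count r m (column d c f))
    by-columns r = ≡.trans (Σ<-* m d (indicator r ∘ f)) (Σ<-swap m d (λ i c → indicator r (f (c ℕ.+ i ℕ.* d))))

  count-shift : ∀ {r} → ¬ r ≈ 0ℤ → ∀ k n f → count r (k ℕ.+ n) (shift k f) ≡ count r n f
  count-shift {r} r≉0 k n f = ≡.trans (Σ<-+ k n (indicator r ∘ shift k f)) (≡.cong₂ ℕ._+_
    (Σ<-zero k λ i i<k → indicator-zero r≉0 (reflexive (shift-< f i<k)))
    (Σ<-cong n λ i _ → ≡.cong (indicator r) (shift-+ k f i)))

  private
    affine : ℤ → ℤ → ℕ → ℤ
    affine β α l = β ℤ.+ (+ l) ℤ.* α

    difference : ∀ β α l k → affine β α l ℤ.- affine β α k ≡ α ℤ.* ((+ l) ℤ.- (+ k))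
    difference β α l k = lemma β α (+ l) (+ k)
      where
      lemma : ∀ β α l k → (β ℤ.+ l ℤ.* α) ℤ.- (β ℤ.+ k ℤ.* α) ≡ α ℤ.* (l ℤ.- k)
      lemma = ℤSolver.solve-∀

    small-injective : ∀ {i j} → i ℕ.< p → j ℕ.< p → + i ≈ + j → i ≡ j
    small-injective {i} {j} i<p j<p e with ℕₚ.<-cmp i j
    ... | tri≈ _ i≡j _ = i≡j
    ... | tri< i<j _ _ = contradiction (trans (reflexive (≡.sym (≡.trans (ℤₚ.m-n≡m⊖n j i) (ℤₚ.⊖-≥ (ℕₚ.<⇒≤ i<j))))) (a≈b⇒a-b≈0 (sym e)))
            (small≉0 (ℕₚ.m<n⇒0<n∸m i<j) (ℕₚ.≤-<-trans (ℕₚ.m∸n≤m j i) j<p))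
    ... | tri> _ _ j<i = contradiction (trans (reflexive (≡.sym (≡.trans (ℤₚ.m-n≡m⊖n i j) (ℤₚ.⊖-≥ (ℕₚ.<⇒≤ j<i))))) (a≈b⇒a-b≈0 e))
            (small≉0 (ℕₚ.m<n⇒0<n∸m j<i) (ℕₚ.≤-<-trans (ℕₚ.m∸n≤m i j) i<p))

    affine-bijective : ∀ β {α} → ¬ α ≈ 0ℤ → ∀ r → count r p (affine β α) ≡ 1
    affine-bijective β {α} α≉0 r with inverse α≉0
    -- The solution of β + k α ≡ r is the residue of (r - β) α⁻¹; it is unique because α cancels
    -- from the difference of two values.
    ... | α⁻¹ , αα⁻¹≈1 with residue ((r ℤ.- β) ℤ.* α⁻¹)
    ...   | k , k<p , e = Σ<-unique p (indicator r ∘ affine β α) k k<p (indicator-1 hit)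
            λ i i<p i≢k → indicator-0 λ e′ → i≢k (small-injective i<p k<p (a-b≈0⇒a≈b
              (*-cancelˡ-≈0 α≉0 (trans (reflexive (≡.sym (difference β α i k))) (a≈b⇒a-b≈0 {affine β α i} (trans e′ (sym hit)))))))
      where
      open SetoidReasoning setoid
      regroup : ∀ β α r a → β ℤ.+ (r ℤ.- β) ℤ.* a ℤ.* α ≡ β ℤ.+ (r ℤ.- β) ℤ.* (α ℤ.* a)
      regroup = ℤSolver.solve-∀
      simplify : ∀ β r → β ℤ.+ (r ℤ.- β) ℤ.* 1ℤ ≡ r
      simplify = ℤSolver.solve-∀
      hit : affine β α k ≈ r
      hit = begin
        β ℤ.+ (+ k) ℤ.* α                            ≈⟨ +-cong {x = β} refl (*-cong {u = α} (sym e) refl) ⟩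
        β ℤ.+ (r ℤ.- β) ℤ.* α⁻¹ ℤ.* α                ≡⟨ regroup β α r α⁻¹ ⟩
        β ℤ.+ (r ℤ.- β) ℤ.* (α ℤ.* α⁻¹)              ≈⟨ +-cong {x = β} refl (*-cong {x = r ℤ.- β} refl αα⁻¹≈1) ⟩
        β ℤ.+ (r ℤ.- β) ℤ.* 1ℤ                       ≡⟨ simplify β r ⟩
        r                                            ∎

  -- Block i is an arithmetic progression with start x eᵢ and step (x + y) eᵢ. A nonzero step hits
  -- every residue once; a zero step forces the whole block to vanish, by the hypothesis on x and y.
  Equidistributed-linear : ∀ k j → k ℕ.+ 2 ≡ j ℕ.* p → ∀ x y → (x ℤ.+ y ≈ 0ℤ → x ≈ 0ℤ) →
    ∀ m → Equidistributed (m ℕ.* p) (Δ^ 1 k (linear x y))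
  Equidistributed-linear k j k+2≡jp x y s≈0⇒x≈0 m {r} {s} r≉0 s≉0 =
    ≡.trans (Σ<-* m p _) (≡.trans (Σ<-cong m λ i _ → row i) (≡.sym (Σ<-* m p _)))
    where
    open SetoidReasoning setoid
    e : ℕ → ℤ
    e = Δ^ 1 j (λ _ → 1ℤ)
    entry : ∀ i l → l ℕ.< p → Δ^ 1 k (linear x y) (l ℕ.+ i ℕ.* p) ≈ affine (x ℤ.* e i) ((x ℤ.+ y) ℤ.* e i) l
    entry i l l<p = begin
      Δ^ 1 k (linear x y) (l ℕ.+ i ℕ.* p)                   ≈⟨ Δ^-linear k j k+2≡jp x y l l<p i ⟩
      (x ℤ.+ l ×ᵣ (x ℤ.+ y)) ℤ.* e i                        ≡⟨ ≡.cong (λ a → (x ℤ.+ a) ℤ.* e i) (×ᵣ≡* l (x ℤ.+ y)) ⟩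
      (x ℤ.+ (+ l) ℤ.* (x ℤ.+ y)) ℤ.* e i                   ≡⟨ regroup x (x ℤ.+ y) (+ l) (e i) ⟩
      x ℤ.* e i ℤ.+ (+ l) ℤ.* ((x ℤ.+ y) ℤ.* e i)           ∎
      where
      regroup : ∀ x s l e → (x ℤ.+ l ℤ.* s) ℤ.* e ≡ x ℤ.* e ℤ.+ l ℤ.* (s ℤ.* e)
      regroup = ℤSolver.solve-∀
    a*0 : ∀ a {b} → b ≈ 0ℤ → a ℤ.* b ≈ 0ℤ
    a*0 a b≈0 = trans (*-cong {x = a} refl b≈0) (reflexive (ℤₚ.*-zeroʳ a))
    0*a : ∀ a {b} → b ≈ 0ℤ → b ℤ.* a ≈ 0ℤ
    0*a a b≈0 = trans (*-cong {u = a} b≈0 refl) (reflexive (ℤₚ.*-zeroˡ a))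
    count-zero : ∀ {r} → ¬ r ≈ 0ℤ → ∀ {α β} → α ≈ 0ℤ → β ≈ 0ℤ → count r p (affine β α) ≡ 0
    count-zero r≉0 α≈0 β≈0 = Σ<-zero p λ l _ → indicator-zero r≉0 (+-cong β≈0 (a*0 (+ l) α≈0))
    row-affine : ∀ β α → (α ≈ 0ℤ → β ≈ 0ℤ) → count r p (affine β α) ≡ count s p (affine β α)
    row-affine β α h with α ≈? 0ℤ
    ... | yes α≈0 = ≡.trans (count-zero r≉0 α≈0 (h α≈0)) (≡.sym (count-zero s≉0 α≈0 (h α≈0)))
    ... | no α≉0 = ≡.trans (affine-bijective β α≉0 r) (≡.sym (affine-bijective β α≉0 s))
    row : ∀ i → Σ< p (λ l → indicator r (Δ^ 1 k (linear x y) (l ℕ.+ i ℕ.* p)))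
              ≡ Σ< p (λ l → indicator s (Δ^ 1 k (linear x y) (l ℕ.+ i ℕ.* p)))
    row i = ≡.trans (Σ<-cong p λ l l<p → indicator-cong r (entry i l l<p))
      (≡.trans (row-affine (x ℤ.* e i) ((x ℤ.+ y) ℤ.* e i) vanish)
        (≡.sym (Σ<-cong p λ l l<p → indicator-cong s (entry i l l<p))))
      where
      vanish : (x ℤ.+ y) ℤ.* e i ≈ 0ℤ → x ℤ.* e i ≈ 0ℤ
      vanish z with integral-domain (x ℤ.+ y) (e i) z
      ... | inj₁ s≈0 = 0*a (e i) (s≈0⇒x≈0 s≈0)
      ... | inj₂ e≈0 = a*0 x e≈0

  -- When x + y ≈ 0 the series (1 − X)^k (x + y X) is constant along the residue classes, and what
  -- is left is a series of the same shape to which the previous lemma applies.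
  Equidistributed-linear-degenerate : ∀ k k′ j → k ℕ.+ 2 ≡ (k′ ℕ.+ 1) ℕ.* p → k′ ℕ.+ 2 ≡ j ℕ.* p →
    ∀ x y → x ℤ.+ y ≈ 0ℤ → ∀ m → Equidistributed (m ℕ.* p ℕ.* p) (Δ^ 1 k (linear x y))
  Equidistributed-linear-degenerate k k′ j k+2≡ k′+2≡ x y s≈0 m =
    Equidistributed-columns (m ℕ.* p) p (Δ^ 1 k (linear x y)) λ l l<p →
      Equidistributed-cong (m ℕ.* p) (λ i → sym (entry i l l<p))
        (Equidistributed-linear k′ j k′+2≡ x 0ℤ (trans (reflexive (≡.sym (ℤₚ.+-identityʳ x)))) m)
    where
    open SetoidReasoning setoid
    scaled : ∀ i → x ℤ.* linear 1ℤ 0ℤ i ≡ linear x 0ℤ i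
    scaled zero = ℤₚ.*-identityʳ x
    scaled (suc zero) = ℤₚ.*-zeroʳ x
    scaled (suc (suc i)) = ℤₚ.*-zeroʳ x
    entry : ∀ i l → l ℕ.< p → Δ^ 1 k (linear x y) (l ℕ.+ i ℕ.* p) ≈ Δ^ 1 k′ (linear x 0ℤ) i
    entry i l l<p = begin
      Δ^ 1 k (linear x y) (l ℕ.+ i ℕ.* p)
        ≈⟨ Δ^-linear k (k′ ℕ.+ 1) k+2≡ x y l l<p i ⟩
      (x ℤ.+ l ×ᵣ (x ℤ.+ y)) ℤ.* Δ^ 1 (k′ ℕ.+ 1) (λ _ → 1ℤ) i
        ≈⟨ *-cong {u = Δ^ 1 (k′ ℕ.+ 1) (λ _ → 1ℤ) i} (trans (+-cong {x = x} refl (trans (reflexive (×ᵣ≡* l (x ℤ.+ y)))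
             (trans (*-cong {x = + l} refl s≈0) (reflexive (ℤₚ.*-zeroʳ (+ l)))))) (reflexive (ℤₚ.+-identityʳ x))) refl ⟩
      x ℤ.* Δ^ 1 (k′ ℕ.+ 1) (λ _ → 1ℤ) i
        ≡⟨ ≡.cong (λ g → x ℤ.* g i) (fold-+ (λ _ → 1ℤ) (Δ 1) k′) ⟩
      x ℤ.* Δ^ 1 k′ (Δ 1 (λ _ → 1ℤ)) i
        ≈⟨ *-cong {x = x} refl (Δ^-cong 1 k′ Δ-ones i) ⟩
      x ℤ.* Δ^ 1 k′ (linear 1ℤ 0ℤ) i
        ≈⟨ Δ^-scale k′ x (linear 1ℤ 0ℤ) i ⟨
      Δ^ 1 k′ (λ a → x ℤ.* linear 1ℤ 0ℤ a) i
        ≈⟨ Δ^-cong 1 k′ (λ a → reflexive (scaled a)) i ⟩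
      Δ^ 1 k′ (linear x 0ℤ) i ∎

  column-polynomial-0 : ∀ d .{{_ : ℕ.NonZero d}} {g} → Degree≤ d g → ∀ l → column d 0 g l ≈ linear (g 0) (g d) l
  column-polynomial-0 d dg zero = refl
  column-polynomial-0 d {g} dg (suc zero) = reflexive (≡.cong g (ℕₚ.+-identityʳ d))
  column-polynomial-0 d dg (suc (suc l)) = dg (d ℕ.+ (d ℕ.+ l ℕ.* d))
    (ℕₚ.m<m+n d (ℕₚ.<-≤-trans (ℕ.>-nonZero⁻¹ d) (ℕₚ.m≤m+n d (l ℕ.* d))))

  column-polynomial-suc : ∀ {c d g} → suc c ℕ.< d → Degree≤ d g → ∀ l → column d (suc c) g l ≈ linear (g (suc c)) 0ℤ l
  column-polynomial-suc {c} {d} {g} c<d dg zero = reflexive (≡.cong g (ℕₚ.+-identityʳ (suc c)))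
  column-polynomial-suc {c} {d} {g} c<d dg (suc l) = trans (dg (suc c ℕ.+ (d ℕ.+ l ℕ.* d))
    (s≤s (ℕₚ.≤-trans (ℕₚ.m≤m+n d (l ℕ.* d)) (ℕₚ.m≤n+m _ c)))) (reflexive (≡.sym (linear-zero l)))
    where
    linear-zero : ∀ l → linear (g (suc c)) 0ℤ (suc l) ≡ 0ℤ
    linear-zero zero = ≡.refl
    linear-zero (suc l) = ≡.refl

  private
    columns : ∀ d k n {g} → Degree≤ d g →
      (∀ c → Equidistributed n (Δ^ 1 k (linear (g (suc c)) 0ℤ))) →
      Equidistributed n (Δ^ 1 k (linear (g 0) (g d))) →
      Equidistributed (n ℕ.* d) (Δ^ d k g)
    columns d k n {g} dg e+ e0 = Equidistributed-columns n d (Δ^ d k g) λ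
      { zero c<d → Equidistributed-cong n (λ i → sym (trans (column-Δ^ k g c<d i)
          (Δ^-cong 1 k (column-polynomial-0 d {{ℕ.>-nonZero c<d}} dg) i))) e0
      ; (suc c) c<d → Equidistributed-cong n (λ i → sym (trans (column-Δ^ k g c<d i)
          (Δ^-cong 1 k (column-polynomial-suc c<d dg) i))) (e+ c)
      }

    x+0 : ∀ {x} → x ℤ.+ 0ℤ ≈ 0ℤ → x ≈ 0ℤ
    x+0 {x} = trans (reflexive (≡.sym (ℤₚ.+-identityʳ x)))

  Equidistributed-Δ^ : ∀ d k j → k ℕ.+ 2 ≡ j ℕ.* p → ∀ {g} → Degree≤ d g → ¬ g 0 ℤ.+ g d ≈ 0ℤ →
    ∀ m → Equidistributed (m ℕ.* p ℕ.* d) (Δ^ d k g)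
  Equidistributed-Δ^ d k j k+2≡ {g} dg s≉0 m = columns d k (m ℕ.* p) dg
    (λ c → Equidistributed-linear k j k+2≡ (g (suc c)) 0ℤ x+0 m)
    (Equidistributed-linear k j k+2≡ (g 0) (g d) (λ s≈0 → contradiction s≈0 s≉0) m)

  -- Only the class of 0 modulo d degenerates. The other classes have second coefficient 0, so
  -- `Equidistributed-linear` applies to them; the length m p p suits both.
  Equidistributed-Δ^-degenerate : ∀ d k k′ j → k ℕ.+ 2 ≡ (k′ ℕ.+ 1) ℕ.* p → k′ ℕ.+ 2 ≡ j ℕ.* p →
    ∀ {g} → Degree≤ d g → g 0 ℤ.+ g d ≈ 0ℤ → ∀ m → Equidistributed (m ℕ.* p ℕ.* p ℕ.* d) (Δ^ d k g)
  Equidistributed-Δ^-degenerate d k k′ j k+2≡ k′+2≡ {g} dg s≈0 m = columns d k (m ℕ.* p ℕ.* p) dg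
    (λ c → Equidistributed-linear k (k′ ℕ.+ 1) k+2≡ (g (suc c)) 0ℤ x+0 (m ℕ.* p))
    (Equidistributed-linear-degenerate k k′ j k+2≡ k′+2≡ (g 0) (g d) s≈0 m)

-- Partition numbers as constant coefficients.

length-partitionsBounded : ∀ f m k → length (partitionsBounded (suc f) (suc m) (suc k))
  ≡ length (partitionsBounded (suc f) (suc m) k) ℕ.+
    length (concatMap (λ i → map (i ∷_) (partitionsBounded f (suc m ∸ i) i)) (filter (_≤? suc m) [ suc k ]))
length-partitionsBounded f m k = begin
  length (concatMap F (filter (_≤? suc m) (applyUpTo suc (suc k))))
    ≡⟨ ≡.cong (λ xs → length (concatMap F (filter (_≤? suc m) xs))) (applyUpTo-∷ʳ suc k) ⟨
  length (concatMap F (filter (_≤? suc m) (applyUpTo suc k ∷ʳ suc k)))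
    ≡⟨ ≡.cong (length ∘ concatMap F) (filter-++ (_≤? suc m) (applyUpTo suc k) [ suc k ]) ⟩
  length (concatMap F (filter (_≤? suc m) (applyUpTo suc k) ++ filter (_≤? suc m) [ suc k ]))
    ≡⟨ ≡.cong length (concatMap-++ F (filter (_≤? suc m) (applyUpTo suc k)) (filter (_≤? suc m) [ suc k ])) ⟩
  length (concatMap F (filter (_≤? suc m) (applyUpTo suc k)) ++ concatMap F (filter (_≤? suc m) [ suc k ]))
    ≡⟨ length-++ (concatMap F (filter (_≤? suc m) (applyUpTo suc k))) ⟩
  length (concatMap F (filter (_≤? suc m) (applyUpTo suc k))) ℕ.+ length (concatMap F (filter (_≤? suc m) [ suc k ])) ∎
  where
  open ≡.≡-Reasoning
  F : ℕ → List (List ℕ)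
  F i = map (i ∷_) (partitionsBounded f (suc m ∸ i) i)

module PartitionSeries {p : ℕ} (p-prime : Prime p) where
  open Residues p-prime
  open Sequences (ℤmod p)
  open Polynomials (ℤmod p)
  open Differences (ℤmod p)
  open PowerSeriesPrimeCharacteristic (ℤmod p) p-prime p×≈0 using (1-X^; ⊛-Δ)
  open GradedHurwitz (ℤmod p) using (⊠-constant)
  open IntegralFactors p-prime
  private
    module A = CommutativeRing powerSeriesRing
  open Hurwitz (ℤmod p)

  -- Coefficients of 1 / (1 - q^(k+1)), the value of (1 - q^(k+1))^(b-1) at b = 0.
  geometric : ℕ → Seq
  geometric k n with suc k ∣? n
  ... | yes _ = 1ℤ
  ... | no  _ = 0ℤ

  geometric-1 : ∀ k {n} → suc k ∣ n → geometric k n ≡ 1ℤ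
  geometric-1 k {n} d with suc k ∣? n
  ... | yes _ = ≡.refl
  ... | no ¬d = contradiction d ¬d

  geometric-0 : ∀ k {n} → ¬ suc k ∣ n → geometric k n ≡ 0ℤ
  geometric-0 k {n} ¬d with suc k ∣? n
  ... | yes d = contradiction d ¬d
  ... | no _ = ≡.refl

  private
    geometric-+ : ∀ k n → geometric k (suc k ℕ.+ n) ≡ geometric k n
    geometric-+ k n with suc k ∣? n
    ... | yes d = geometric-1 k (∣m∣n⇒∣m+n ∣-refl d)
    ... | no ¬d = geometric-0 k (λ d → ¬d (∣m+n∣m⇒∣n d ∣-refl))

  Δ-geometric : ∀ k i → Δ (suc k) (geometric k) i ≡ 𝟙 i
  Δ-geometric k zero = ≡.cong (ℤ._- 0ℤ) (geometric-1 k (suc k ∣0))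
  Δ-geometric k (suc i) with suc i ℕ.<? suc k
  ... | yes i<k = ≡.cong₂ ℤ._-_ (geometric-0 k (λ d → ℕₚ.<⇒≱ i<k (∣⇒≤ d))) (shift-< {suc k} (geometric k) i<k)
  ... | no i≮k = ≡.subst (λ j → Δ (suc k) (geometric k) j ≡ 0ℤ) (ℕₚ.m+[n∸m]≡n (ℕₚ.≮⇒≥ i≮k)) (begin
        geometric k (suc k ℕ.+ j) ℤ.- shift (suc k) (geometric k) (suc k ℕ.+ j)
          ≡⟨ ≡.cong₂ ℤ._-_ (geometric-+ k j) (shift-+ (suc k) (geometric k) j) ⟩
        geometric k j ℤ.- geometric k j
          ≡⟨ ℤₚ.+-inverseʳ (geometric k j) ⟩
        0ℤ ∎)
    where
    open ≡.≡-Reasoning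
    j = suc i ∸ suc k

  partitionSeries : ℕ → Seq
  partitionSeries N = foldr _⊛_ 𝟙 (applyUpTo geometric N)

  private
    foldr-⊛ : ∀ x (xs : List Seq) → foldr _⊛_ (x ⊛ 𝟙) xs ≋ x ⊛ foldr _⊛_ 𝟙 xs
    foldr-⊛ x [] = A.refl
    foldr-⊛ x (y ∷ ys) = A.trans (A.*-congˡ {y} (foldr-⊛ x ys))
      (A.trans (A.sym (A.*-assoc y x t)) (A.trans (A.*-congʳ {t} (A.*-comm y x)) (A.*-assoc x y t)))
      where t = foldr _⊛_ 𝟙 ys

    partitionSeries-suc-⊛ : ∀ k → partitionSeries (suc k) ≋ geometric k ⊛ partitionSeries k
    partitionSeries-suc-⊛ k = A.trans (A.reflexive (≡.trans
      (≡.cong (foldr _⊛_ 𝟙) (≡.sym (applyUpTo-∷ʳ geometric k)))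
      (foldr-∷ʳ _⊛_ 𝟙 (geometric k) (applyUpTo geometric k))))
      (foldr-⊛ (geometric k) (applyUpTo geometric k))

  -- Multiplication by 1 - X^(k+1) cancels the last geometric factor. The outcome is the recursion
  -- of `length-partitionsBounded`: a partition either has all parts at most k, or starts with k + 1
  -- and continues with parts at most k + 1.
  partitionSeries-suc : ∀ k i → partitionSeries (suc k) i ≈ partitionSeries k i ℤ.+ shift (suc k) (partitionSeries (suc k)) i
  partitionSeries-suc k i = begin
    H i                                           ≡⟨ cancel (H i) (shift (suc k) H i) ⟩
    Δ (suc k) H i ℤ.+ shift (suc k) H i           ≈⟨ +-cong {u = shift (suc k) H i} (at Δ-H i) refl ⟩
    partitionSeries k i ℤ.+ shift (suc k) H i     ∎
    where
    open SetoidReasoning setoid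
    module E = SetoidReasoning A.setoid
    H = partitionSeries (suc k)
    cancel : ∀ x y → x ≡ (x ℤ.- y) ℤ.+ y
    cancel = ℤSolver.solve-∀
    Δ-H : Δ (suc k) H ≋ partitionSeries k
    Δ-H = E.begin
      Δ (suc k) H                                  E.≈⟨ ⊛-Δ (suc k) H ⟨
      1-X^ (suc k) ⊛ H                                        E.≈⟨ A.*-congˡ {1-X^ (suc k)} (partitionSeries-suc-⊛ k) ⟩
      1-X^ (suc k) ⊛ (geometric k ⊛ partitionSeries k)        E.≈⟨ A.*-assoc (1-X^ (suc k)) (geometric k) (partitionSeries k) ⟨
      1-X^ (suc k) ⊛ geometric k ⊛ partitionSeries k          E.≈⟨ A.*-congʳ {partitionSeries k} (⊛-Δ (suc k) (geometric k)) ⟩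
      Δ (suc k) (geometric k) ⊛ partitionSeries k  E.≈⟨ A.*-congʳ {partitionSeries k} (pointwise λ j → reflexive (Δ-geometric k j)) ⟩
      𝟙 ⊛ partitionSeries k                        E.≈⟨ A.*-identityˡ (partitionSeries k) ⟩
      partitionSeries k                            E.∎

  private
    partitionSeries-0 : ∀ k → partitionSeries k 0 ≈ 1ℤ
    partitionSeries-0 zero = refl
    partitionSeries-0 (suc k) = trans (partitionSeries-suc k 0)
      (trans (reflexive (ℤₚ.+-identityʳ (partitionSeries k 0))) (partitionSeries-0 k))

    length-partitionsBounded≈ : ∀ f m k → m ℕ.≤ f → + length (partitionsBounded f m k) ≈ partitionSeries k m
    length-partitionsBounded≈ f zero k _ = sym (partitionSeries-0 k)
    length-partitionsBounded≈ (suc f) (suc m) zero _ = refl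
    length-partitionsBounded≈ (suc f) (suc m) (suc k) (s≤s m≤f) = begin
      + length (partitionsBounded (suc f) (suc m) (suc k))
        ≡⟨ ≡.cong +_ (length-partitionsBounded f m k) ⟩
      + length (partitionsBounded (suc f) (suc m) k) ℤ.+ + length (concatMap F (filter (_≤? suc m) [ suc k ]))
        ≈⟨ +-cong (length-partitionsBounded≈ (suc f) (suc m) k (s≤s m≤f)) last-part ⟩
      partitionSeries k (suc m) ℤ.+ shift (suc k) (partitionSeries (suc k)) (suc m)
        ≈⟨ partitionSeries-suc k (suc m) ⟨
      partitionSeries (suc k) (suc m) ∎
      where
      open SetoidReasoning setoid
      F : ℕ → List (List ℕ)
      F i = map (i ∷_) (partitionsBounded f (suc m ∸ i) i)
      last-part : + length (concatMap F (filter (_≤? suc m) [ suc k ])) ≈ shift (suc k) (partitionSeries (suc k)) (suc m)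
      last-part with suc k ℕ.≤? suc m
      ... | no k≰m = begin
        + length (concatMap F (filter (_≤? suc m) [ suc k ]))     ≡⟨ ≡.cong (λ xs → + length (concatMap F xs)) (filter-reject (_≤? suc m) k≰m) ⟩
        0ℤ                                                        ≡⟨ shift-< (partitionSeries (suc k)) (ℕₚ.≰⇒> k≰m) ⟨
        shift (suc k) (partitionSeries (suc k)) (suc m)           ∎
      ... | yes k≤m = begin
        + length (concatMap F (filter (_≤? suc m) [ suc k ]))     ≡⟨ ≡.cong (λ xs → + length (concatMap F xs)) (filter-accept (_≤? suc m) k≤m) ⟩
        + length (F (suc k) ++ [])                                ≡⟨ ≡.cong (λ xs → + length xs) (++-identityʳ (F (suc k))) ⟩
        + length (F (suc k))                                      ≡⟨ ≡.cong +_ (length-map (suc k ∷_) (partitionsBounded f (m ∸ k) (suc k))) ⟩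
        + length (partitionsBounded f (m ∸ k) (suc k))            ≈⟨ length-partitionsBounded≈ f (m ∸ k) (suc k) (ℕₚ.≤-trans (ℕₚ.m∸n≤m m k) m≤f) ⟩
        partitionSeries (suc k) (m ∸ k)                           ≡⟨ shift-+ (suc k) (partitionSeries (suc k)) (m ∸ k) ⟨
        shift (suc k) (partitionSeries (suc k)) (suc k ℕ.+ (m ∸ k))  ≡⟨ ≡.cong (shift (suc k) (partitionSeries (suc k))) (ℕₚ.m+[n∸m]≡n k≤m) ⟩
        shift (suc k) (partitionSeries (suc k)) (suc m)           ∎

    partitionSeries-stable : ∀ m k → partitionSeries (k ℕ.+ m) m ≈ partitionSeries m m
    partitionSeries-stable m zero = refl
    partitionSeries-stable m (suc k) = begin
      partitionSeries (suc k ℕ.+ m) m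
        ≈⟨ partitionSeries-suc (k ℕ.+ m) m ⟩
      partitionSeries (k ℕ.+ m) m ℤ.+ shift (suc k ℕ.+ m) (partitionSeries (suc k ℕ.+ m)) m
        ≡⟨ ≡.trans (≡.cong (λ y → partitionSeries (k ℕ.+ m) m ℤ.+ y) (shift-< (partitionSeries (suc k ℕ.+ m)) (s≤s (ℕₚ.m≤n+m m k)))) (ℤₚ.+-identityʳ _) ⟩
      partitionSeries (k ℕ.+ m) m
        ≈⟨ partitionSeries-stable m k ⟩
      partitionSeries m m ∎
      where open SetoidReasoning setoid

  partitionSeries≈P : ∀ {N m} → m ℕ.≤ N → partitionSeries N m ≈ + P m
  partitionSeries≈P {N} {m} m≤N = trans (reflexive (≡.cong (λ n → partitionSeries n m) (≡.sym (ℕₚ.m∸n+n≡m m≤N))))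
    (trans (partitionSeries-stable m (N ∸ m)) (sym (length-partitionsBounded≈ m m m ℕₚ.≤-refl)))

  private
    constant-product : ∀ N (h : ℕ → ℕ → Seq) (g : ℕ → Seq) → (∀ k n → h k n 0 ≈ egf (g k) n) →
      ∀ n → productOf h N n 0 ≈ egf (foldr _⊛_ 𝟙 (applyUpTo g N)) n
    constant-product zero h g e zero = refl
    constant-product zero h g e (suc n) = sym (reflexive (≡.trans (×ᵣ≡* (suc n !) 0ℤ) (ℤₚ.*-zeroʳ (+ (suc n !)))))
    constant-product (suc N) h g e n = begin
      productOf h (suc N) n 0
        ≡⟨ ⊠-constant (h 0) (productOf (h ∘ suc) N) n ⟩
      ((λ m → h 0 m 0) ⊠ (λ m → productOf (h ∘ suc) N m 0)) n
        ≈⟨ ⊠-cong (e 0) (constant-product N (h ∘ suc) (g ∘ suc) (e ∘ suc)) n ⟩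
      (egf (g 0) ⊠ egf (foldr _⊛_ 𝟙 (applyUpTo (g ∘ suc) N))) n
        ≈⟨ egf-⊛ (g 0) (foldr _⊛_ 𝟙 (applyUpTo (g ∘ suc) N)) n ⟨
      egf (foldr _⊛_ 𝟙 (applyUpTo g (suc N))) n ∎
      where open SetoidReasoning setoid

    constant≈geometric : ∀ k n → integralFactor k n 0 ≈ egf (geometric k) n
    constant≈geometric k n = trans (by-cases (suc k ∣? n)) (sym (reflexive (×ᵣ≡* (n !) (geometric k n))))
      where
      by-cases : Dec (suc k ∣ n) → integralFactor k n 0 ≈ + (n !) ℤ.* geometric k n
      by-cases (yes d) = reflexive (≡.trans (constant-integralFactor k n d)
        (≡.sym (≡.trans (≡.cong (λ x → + (n !) ℤ.* x) (geometric-1 k d)) (ℤₚ.*-identityʳ (+ (n !))))))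
      by-cases (no ¬d) = reflexive (≡.trans (constant-integralFactor-∤ k n ¬d)
        (≡.sym (≡.trans (≡.cong (λ x → + (n !) ℤ.* x) (geometric-0 k ¬d)) (ℤₚ.*-zeroʳ (+ (n !))))))

  -- At b = 0 the product is that of the series 1 / (1 - q^k), which generates the partition
  -- numbers; factors with k > n do not reach the coefficient of q^n.
  constant-integralProduct : ∀ {N n} → n ℕ.≤ N → integralProduct N n 0 ≈ + (n !) ℤ.* + P n
  constant-integralProduct {N} {n} n≤N = begin
    integralProduct N n 0                ≈⟨ constant-product N integralFactor geometric constant≈geometric n ⟩
    egf (partitionSeries N) n            ≡⟨ ×ᵣ≡* (n !) (partitionSeries N n) ⟩
    + (n !) ℤ.* partitionSeries N n      ≈⟨ *-cong {x = + (n !)} refl (partitionSeries≈P n≤N) ⟩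
    + (n !) ℤ.* + P n                    ∎
    where open SetoidReasoning setoid

-- From rational coefficient lists to integer sequences.

-- The numerator polynomial of binomₚ, written with an arbitrary multiplication _∙_ so that _*ₚ_ can
-- be abstracted in binom-fall.
fallWith : (Poly → Poly → Poly) → Poly → ℕ → Poly
fallWith _∙_ x zero    = constₚ 1ℚ
fallWith _∙_ x (suc i) = fallWith _∙_ x i ∙ (x +ₚ constₚ (ℚ.- ℕ→ℚ i))

private
  -- Remembers that a variable operation is `_*ₚ_`: once `_*ₚ_` has been abstracted, matching on the
  -- constructor restores it.
  data IsMultiplication : (Poly → Poly → Poly) → Set where
    *ₚ-isMultiplication : IsMultiplication _*ₚ_

  1/suc_! : ℕ → ℚ
  1/suc m ! = ((+ 1) ℚ./ (suc m !)) {{suc m !≢0}}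

  fall-unique : ∀ x (F : ℕ → ℕ → Poly) → (∀ w → F w 0 ≡ constₚ 1ℚ) →
    (∀ w n → F w (suc n) ≡ F w n *ₚ (x +ₚ constₚ (ℚ.- ℕ→ℚ n))) →
    ∀ w n → F w n ≡ fallWith _*ₚ_ x n
  fall-unique x F base step w zero    = base w
  fall-unique x F base step w (suc n) =
    ≡.trans (step w n) (≡.cong (_*ₚ (x +ₚ constₚ (ℚ.- ℕ→ℚ n))) (fall-unique x F base step w n))

  ·ₚ-fall-unique : ∀ x (F : ℕ → ℕ → Poly) → (∀ w → F w 0 ≡ constₚ 1ℚ) →
    (∀ w n → F w (suc n) ≡ F w n *ₚ (x +ₚ constₚ (ℚ.- ℕ→ℚ n))) →
    ∀ w n c (_∙_ mul : Poly → Poly → Poly) y → IsMultiplication mul →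
    c ·ₚ (F w n ∙ y) ≡ c ·ₚ (fallWith mul x n ∙ y)
  ·ₚ-fall-unique x F base step w n c _∙_ _ y *ₚ-isMultiplication =
    ≡.cong (λ f → c ·ₚ (f ∙ y)) (fall-unique x F base step w n)

  -- The function fall in the where block of binomₚ cannot be named, and it occurs only in the form
  -- fall x m m. Abstracting suc n in binomₚ x (suc n) separates its two arguments, and abstracting
  -- _*ₚ_ makes the goal rigid enough for unification to find the value of hiddenFall.
  mutual
    hiddenFall : Poly → ℕ → ℕ → Poly
    hiddenFall = _

    binom-fall : ∀ x n mul → IsMultiplication mul → _*ₚ_ ≡ mul →
      binomₚ x (suc n) ≡ 1/suc n ! ·ₚ fallWith mul x (suc n)
    binom-fall x n mul isMul with _*ₚ_ | suc n
    ... | _∙_ | w = λ { ≡.refl → ·ₚ-fall-unique x (hiddenFall x) (λ _ → ≡.refl) (λ _ _ → ≡.refl) w n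
                          (1/suc n !) _∙_ _∙_ (x +ₚ constₚ (ℚ.- ℕ→ℚ n)) isMul }

binomₚ-suc : ∀ x n → binomₚ x (suc n) ≡ ((+ 1) ℚ./ (suc n !)) {{suc n !≢0}} ·ₚ fallWith _*ₚ_ x (suc n)
binomₚ-suc x n = binom-fall x n _*ₚ_ *ₚ-isMultiplication ≡.refl

-- Built with the literal denominator 1, so that the condition on `denominator-1` in `CongQ` and the
-- numerator compute.
ι : ℤ → ℚ
ι z = mkℚ z 0 (Coprimality.sym (Coprimality.1-coprimeTo ℤ.∣ z ∣))

ι-+ : ∀ a b → ι (a ℤ.+ b) ≡ ι a ℚ.+ ι b
ι-+ a b = ℚₚ.toℚᵘ-injective (ℚᵘₚ.≃-trans (*≡* (lemma a b)) (ℚᵘₚ.≃-sym (ℚₚ.toℚᵘ-homo-+ (ι a) (ι b))))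
  where
  lemma : ∀ a b → (a ℤ.+ b) ℤ.* 1ℤ ≡ (a ℤ.* 1ℤ ℤ.+ b ℤ.* 1ℤ) ℤ.* 1ℤ
  lemma = ℤSolver.solve-∀

ι-* : ∀ a b → ι (a ℤ.* b) ≡ ι a ℚ.* ι b
ι-* a b = ℚₚ.toℚᵘ-injective (ℚᵘₚ.≃-trans (*≡* ≡.refl) (ℚᵘₚ.≃-sym (ℚₚ.toℚᵘ-homo-* (ι a) (ι b))))

ι-neg : ∀ a → ι (ℤ.- a) ≡ ℚ.- ι a
ι-neg a = ℚₚ.toℚᵘ-injective (ℚᵘₚ.≃-sym (ℚₚ.toℚᵘ-homo‿- (ι a)))

ι-injective : ∀ {a b} → ι a ≡ ι b → a ≡ b
ι-injective = ≡.cong ℚ.numerator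

ℕ→ℚ≡ι : ∀ n → ℕ→ℚ n ≡ ι (+ n)
ℕ→ℚ≡ι n = ℚₚ.↥p/↧p≡p (ι (+ n))

ι-*-inverse : ∀ d .{{_ : ℕ.NonZero d}} → ι (+ d) ℚ.* ((+ 1) ℚ./ d) ≡ 1ℚ
ι-*-inverse (suc d) = ℚₚ.toℚᵘ-injective (ℚᵘₚ.≃-trans (ℚₚ.toℚᵘ-homo-* (ι (+ suc d)) ((+ 1) ℚ./ suc d))
  (ℚᵘₚ.≃-trans (ℚᵘₚ.*-congˡ {mkℚᵘ (+ suc d) 0} (ℚₚ.toℚᵘ-fromℚᵘ (mkℚᵘ (+ 1) d))) (*≡* (lemma (+ suc d)))))
  where
  lemma : ∀ a → a ℤ.* 1ℤ ℤ.* 1ℤ ≡ 1ℤ ℤ.* (1ℤ ℤ.* a)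
  lemma = ℤSolver.solve-∀

private
  module SQ = Sequences ℚₚ.+-*-commutativeRing
  module QA = CommutativeRing SQ.powerSeriesRing
  module SQA = Sequences SQ.powerSeriesRing
  module HQA = Hurwitz SQ.powerSeriesRing
open SemiringMult QA.semiring using () renaming (_×_ to _×ₐ_)

-- The default 0 past the end identifies lists that differ by trailing zeros.
coeff : Poly → ℕ → ℚ
coeff []      _       = 0ℚ
coeff (a ∷ f) zero    = a
coeff (a ∷ f) (suc i) = coeff f i

coeff-+ₚ : ∀ f g i → coeff (f +ₚ g) i ≡ coeff f i ℚ.+ coeff g i
coeff-+ₚ []      g       i       = ≡.sym (ℚₚ.+-identityˡ (coeff g i))
coeff-+ₚ (a ∷ f) []      i       = ≡.sym (ℚₚ.+-identityʳ (coeff (a ∷ f) i))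
coeff-+ₚ (a ∷ f) (b ∷ g) zero    = ≡.refl
coeff-+ₚ (a ∷ f) (b ∷ g) (suc i) = coeff-+ₚ f g i

coeff-·ₚ : ∀ c f i → coeff (c ·ₚ f) i ≡ c ℚ.* coeff f i
coeff-·ₚ c []      i       = ≡.sym (ℚₚ.*-zeroʳ c)
coeff-·ₚ c (a ∷ f) zero    = ≡.refl
coeff-·ₚ c (a ∷ f) (suc i) = coeff-·ₚ c f i

coeff-*ₚ : ∀ f g i → coeff (f *ₚ g) i ≡ (coeff f SQ.⊛ coeff g) i
coeff-*ₚ [] g i = ≡.sym (SQ.⊛-zeroˡ-at (coeff []) (coeff g) (λ _ → ≡.refl) i)
coeff-*ₚ (a ∷ f) g zero = ≡.trans (coeff-+ₚ (a ·ₚ g) (0ℚ ∷ (f *ₚ g)) 0)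
  (≡.trans (ℚₚ.+-identityʳ (coeff (a ·ₚ g) 0)) (coeff-·ₚ a g 0))
coeff-*ₚ (a ∷ f) g (suc i) = ≡.trans (coeff-+ₚ (a ·ₚ g) (0ℚ ∷ (f *ₚ g)) (suc i))
  (≡.cong₂ ℚ._+_ (coeff-·ₚ a g (suc i)) (coeff-*ₚ f g i))

coeff-sumₚ : ∀ n (F G : Series) i →
  coeff (sumₚ (applyUpTo (λ k → F k *ₚ G (n ∸ k)) (suc n))) i ≡ ((coeff ∘ F) SQA.⊛ (coeff ∘ G)) n i
coeff-sumₚ zero F G i = ≡.trans (coeff-+ₚ (F 0 *ₚ G 0) [] i)
  (≡.trans (ℚₚ.+-identityʳ (coeff (F 0 *ₚ G 0) i)) (coeff-*ₚ (F 0) (G 0) i))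
coeff-sumₚ (suc n) F G i = ≡.trans
  (coeff-+ₚ (F 0 *ₚ G (suc n)) (sumₚ (applyUpTo (λ k → F (suc k) *ₚ G (n ∸ k)) (suc n))) i)
  (≡.cong₂ ℚ._+_ (coeff-*ₚ (F 0) (G (suc n)) i) (coeff-sumₚ n (F ∘ suc) G i))

coeff-⋆ : ∀ (F G : Series) n i → coeff ((F ⋆ G) n) i ≡ ((coeff ∘ F) SQA.⊛ (coeff ∘ G)) n i
coeff-⋆ F G n i = ≡.trans
  (≡.cong (λ xs → coeff (sumₚ xs) i) (map-upTo (λ k → F k *ₚ G (n ∸ k)) (suc n)))
  (coeff-sumₚ n F G i)

×ₐ-at : ∀ n f i → (n ×ₐ f) i ≡ ι (+ n) ℚ.* f i
×ₐ-at zero f i = ≡.sym (ℚₚ.*-zeroˡ (f i))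
×ₐ-at (suc n) f i = begin
  f i ℚ.+ (n ×ₐ f) i                          ≡⟨ ≡.cong (f i ℚ.+_) (×ₐ-at n f i) ⟩
  f i ℚ.+ ι (+ n) ℚ.* f i                     ≡⟨ ≡.cong (ℚ._+ ι (+ n) ℚ.* f i) (ℚₚ.*-identityˡ (f i)) ⟨
  1ℚ ℚ.* f i ℚ.+ ι (+ n) ℚ.* f i              ≡⟨ ℚₚ.*-distribʳ-+ (f i) 1ℚ (ι (+ n)) ⟨
  (1ℚ ℚ.+ ι (+ n)) ℚ.* f i                    ≡⟨ ≡.cong (ℚ._* f i) (ι-+ 1ℤ (+ n)) ⟨
  ι (+ suc n) ℚ.* f i                         ∎
  where open ≡.≡-Reasoning

module Transfer {p : ℕ} (p-prime : Prime p) where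
  open Sequences (ℤmod p) using (Seq; _⊛_)
  open Polynomials (ℤmod p) using (linear)
  open Residues p-prime using (_≈_)
  open PrimeFactorial p-prime using (factorialPoly)
  open IntegralFactors p-prime
  open Counting p-prime
  private
    module S = Sequences (ℤmod p)
  open Hurwitz S.powerSeriesRing using (_⊠_)
  open ≡.≡-Reasoning

  ι-⊛ : ∀ f g n → ι ((f ⊛ g) n) ≡ ((ι ∘ f) SQ.⊛ (ι ∘ g)) n
  ι-⊛ f g zero = ι-* (f 0) (g 0)
  ι-⊛ f g (suc n) = ≡.trans (ι-+ (f 0 ℤ.* g (suc n)) ((f ∘ suc ⊛ g) n))
    (≡.cong₂ ℚ._+_ (ι-* (f 0) (g (suc n))) (ι-⊛ (f ∘ suc) g n))

  ι-⊠ : ∀ (F G : ℕ → Seq) n i → ι ((F ⊠ G) n i) ≡ ((λ m → ι ∘ F m) HQA.⊠ (λ m → ι ∘ G m)) n i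
  ι-⊠ F G zero i = ι-⊛ (F 0) (G 0) i
  ι-⊠ F G (suc n) i = ≡.trans (ι-+ ((F ∘ suc ⊠ G) n i) ((F ⊠ G ∘ suc) n i))
    (≡.cong₂ ℚ._+_ (ι-⊠ (F ∘ suc) G n i) (ι-⊠ F (G ∘ suc) n i))

  private
    ε : ℕ → ℚ
    ε zero    = 1ℚ
    ε (suc m) = (ℚ.- 1ℚ) ℚ.* ε m

    coeff-signₚ : ∀ m f i → coeff (signₚ m f) i ≡ ε m ℚ.* coeff f i
    coeff-signₚ zero    f i = ≡.sym (ℚₚ.*-identityˡ (coeff f i))
    coeff-signₚ (suc m) f i = ≡.trans (coeff-·ₚ (ℚ.- 1ℚ) (signₚ m f) i)
      (≡.trans (≡.cong ((ℚ.- 1ℚ) ℚ.*_) (coeff-signₚ m f i)) (≡.sym (ℚₚ.*-assoc (ℚ.- 1ℚ) (ε m) (coeff f i))))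

    b-1 : Poly
    b-1 = bₚ +ₚ constₚ (ℚ.- 1ℚ)

    b-1-m : ℕ → Poly
    b-1-m m = b-1 +ₚ constₚ (ℚ.- ℕ→ℚ m)

    neg-b-1-m : ∀ m i → (ℚ.- 1ℚ) ℚ.* coeff (b-1-m m) i ≡ ι (linear (+ suc m) -1ℤ i)
    neg-b-1-m m zero = begin
      ι -1ℤ ℚ.* (ι -1ℤ ℚ.+ ℚ.- ℕ→ℚ m)         ≡⟨ ≡.cong (λ x → ι -1ℤ ℚ.* (ι -1ℤ ℚ.+ ℚ.- x)) (ℕ→ℚ≡ι m) ⟩
      ι -1ℤ ℚ.* (ι -1ℤ ℚ.+ ℚ.- ι (+ m))       ≡⟨ ≡.cong (λ x → ι -1ℤ ℚ.* (ι -1ℤ ℚ.+ x)) (ι-neg (+ m)) ⟨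
      ι -1ℤ ℚ.* (ι -1ℤ ℚ.+ ι (ℤ.- + m))       ≡⟨ ≡.cong (ι -1ℤ ℚ.*_) (ι-+ -1ℤ (ℤ.- + m)) ⟨
      ι -1ℤ ℚ.* ι (-1ℤ ℤ.+ ℤ.- + m)           ≡⟨ ι-* -1ℤ (-1ℤ ℤ.+ ℤ.- + m) ⟨
      ι (-1ℤ ℤ.* (-1ℤ ℤ.+ ℤ.- + m))           ≡⟨ ≡.cong ι (lemma (+ m)) ⟩
      ι (+ suc m)                             ∎
      where
      lemma : ∀ a → -1ℤ ℤ.* (-1ℤ ℤ.+ ℤ.- a) ≡ 1ℤ ℤ.+ a
      lemma = ℤSolver.solve-∀
    neg-b-1-m m (suc zero) = ≡.refl
    neg-b-1-m m (suc (suc i)) = ≡.refl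

    -- Each of the m signs is absorbed by one linear factor, turning b - 1 - i into (i + 1) - b.
    coeff-fall : ∀ m i → ε m ℚ.* coeff (fallWith _*ₚ_ b-1 m) i ≡ ι (factorialPoly m i)
    coeff-fall zero zero = ≡.refl
    coeff-fall zero (suc i) = ≡.refl
    coeff-fall (suc m) i = begin
      (ℚ.- 1ℚ) ℚ.* ε m ℚ.* coeff (A *ₚ b-1-m m) i
        ≡⟨ ≡.cong₂ ℚ._*_ (ℚₚ.*-comm (ℚ.- 1ℚ) (ε m)) (coeff-*ₚ A (b-1-m m) i) ⟩
      ε m ℚ.* (ℚ.- 1ℚ) ℚ.* (coeff A SQ.⊛ coeff (b-1-m m)) i
        ≡⟨ ℚₚ.*-assoc (ε m) (ℚ.- 1ℚ) _ ⟩
      ε m ℚ.* ((ℚ.- 1ℚ) ℚ.* (coeff A SQ.⊛ coeff (b-1-m m)) i)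
        ≡⟨ ≡.cong (ε m ℚ.*_) scale ⟩
      ε m ℚ.* (coeff A SQ.⊛ (λ j → (ℚ.- 1ℚ) ℚ.* coeff (b-1-m m) j)) i
        ≡⟨ SQ.⊛-scaleˡ (ε m) (coeff A) (λ j → (ℚ.- 1ℚ) ℚ.* coeff (b-1-m m) j) i ⟨
      ((λ j → ε m ℚ.* coeff A j) SQ.⊛ (λ j → (ℚ.- 1ℚ) ℚ.* coeff (b-1-m m) j)) i
        ≡⟨ SQ.⊛-cong-at (coeff-fall m) (neg-b-1-m m) i ⟩
      ((ι ∘ factorialPoly m) SQ.⊛ (ι ∘ linear (+ suc m) -1ℤ)) i
        ≡⟨ ι-⊛ (factorialPoly m) (linear (+ suc m) -1ℤ) i ⟨
      ι (factorialPoly (suc m) i) ∎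
      where
      A = fallWith _*ₚ_ b-1 m
      scale : (ℚ.- 1ℚ) ℚ.* (coeff A SQ.⊛ coeff (b-1-m m)) i ≡ (coeff A SQ.⊛ (λ j → (ℚ.- 1ℚ) ℚ.* coeff (b-1-m m) j)) i
      scale = ≡.trans (≡.cong ((ℚ.- 1ℚ) ℚ.*_) (SQ.⊛-comm-at (coeff A) (coeff (b-1-m m)) i))
        (≡.trans (≡.sym (SQ.⊛-scaleˡ (ℚ.- 1ℚ) (coeff (b-1-m m)) (coeff A) i))
          (SQ.⊛-comm-at (λ j → (ℚ.- 1ℚ) ℚ.* coeff (b-1-m m) j) (coeff A) i))

    1/_! : ℕ → ℚ
    1/ m ! = ((+ 1) ℚ./ (m !)) {{m !≢0}}

    coeff-binomₚ : ∀ m i → coeff (binomₚ b-1 m) i ≡ 1/ m ! ℚ.* coeff (fallWith _*ₚ_ b-1 m) i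
    coeff-binomₚ zero i = coeff-·ₚ (1/ 0 !) (fallWith _*ₚ_ b-1 0) i
    coeff-binomₚ (suc m) i = ≡.trans (≡.cong (λ f → coeff f i) (binomₚ-suc b-1 m))
      (coeff-·ₚ (1/ suc m !) (fallWith _*ₚ_ b-1 (suc m)) i)

    ι-ratio : ∀ {m n} → m ℕ.≤ n → ι (+ (n !)) ℚ.* 1/ m ! ≡ ι (+ factorialRatio n m)
    ι-ratio {m} {n} m≤n = begin
      ι (+ (n !)) ℚ.* 1/ m !                                    ≡⟨ ≡.cong (λ x → ι (+ x) ℚ.* 1/ m !) (factorialRatio-* m≤n) ⟨
      ι (+ (factorialRatio n m ℕ.* m !)) ℚ.* 1/ m !             ≡⟨ ≡.cong (λ x → ι x ℚ.* 1/ m !) (ℤₚ.pos-* (factorialRatio n m) (m !)) ⟩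
      ι (+ factorialRatio n m ℤ.* + (m !)) ℚ.* 1/ m !           ≡⟨ ≡.cong (ℚ._* 1/ m !) (ι-* (+ factorialRatio n m) (+ (m !))) ⟩
      ι (+ factorialRatio n m) ℚ.* ι (+ (m !)) ℚ.* 1/ m !       ≡⟨ ℚₚ.*-assoc (ι (+ factorialRatio n m)) (ι (+ (m !))) (1/ m !) ⟩
      ι (+ factorialRatio n m) ℚ.* (ι (+ (m !)) ℚ.* 1/ m !)     ≡⟨ ≡.cong (ι (+ factorialRatio n m) ℚ.*_) (ι-*-inverse (m !) {{m !≢0}}) ⟩
      ι (+ factorialRatio n m) ℚ.* 1ℚ                           ≡⟨ ℚₚ.*-identityʳ (ι (+ factorialRatio n m)) ⟩
      ι (+ factorialRatio n m)                                  ∎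

    coeff-factor : ∀ k n i → ι (+ (n !)) ℚ.* coeff (factor k n) i ≡ ι (integralFactor k n i)
    coeff-factor k n i with suc k ∣? n
    ... | no _ = ℚₚ.*-zeroʳ (ι (+ (n !)))
    ... | yes _ = begin
      ι (+ (n !)) ℚ.* coeff (signₚ m (binomₚ b-1 m)) i
        ≡⟨ ≡.cong (ι (+ (n !)) ℚ.*_) (≡.trans (coeff-signₚ m (binomₚ b-1 m) i) (≡.cong (ε m ℚ.*_) (coeff-binomₚ m i))) ⟩
      ι (+ (n !)) ℚ.* (ε m ℚ.* (1/ m ! ℚ.* coeff A i))
        ≡⟨ ≡.cong (ι (+ (n !)) ℚ.*_) (swap (ε m) (1/ m !) (coeff A i)) ⟩
      ι (+ (n !)) ℚ.* (1/ m ! ℚ.* (ε m ℚ.* coeff A i))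
        ≡⟨ ℚₚ.*-assoc (ι (+ (n !))) (1/ m !) (ε m ℚ.* coeff A i) ⟨
      ι (+ (n !)) ℚ.* 1/ m ! ℚ.* (ε m ℚ.* coeff A i)
        ≡⟨ ≡.cong₂ ℚ._*_ (ι-ratio {m} {n} (m/n≤m n (suc k))) (coeff-fall m i) ⟩
      ι (+ factorialRatio n m) ℚ.* ι (factorialPoly m i)
        ≡⟨ ι-* (+ factorialRatio n m) (factorialPoly m i) ⟨
      ι (+ factorialRatio n m ℤ.* factorialPoly m i) ∎
      where
      m = n ℕ./ suc k
      A = fallWith _*ₚ_ b-1 m
      swap : ∀ x y z → x ℚ.* (y ℚ.* z) ≡ y ℚ.* (x ℚ.* z)
      swap x y z = ≡.trans (≡.sym (ℚₚ.*-assoc x y z)) (≡.trans (≡.cong (ℚ._* z) (ℚₚ.*-comm x y)) (ℚₚ.*-assoc y x z))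

    coeff-oneₛ : ∀ n i → ι (+ (n !)) ℚ.* coeff (oneₛ n) i ≡ ι (productOf integralFactor 0 n i)
    coeff-oneₛ zero zero = ≡.refl
    coeff-oneₛ zero (suc i) = ≡.refl
    coeff-oneₛ (suc n) i = ℚₚ.*-zeroʳ (ι (+ (suc n !)))

    -- By `egf-⊛` the factor n! distributes over the product when `⋆` is traded for `⊠`, so
    -- denominators are cleared one factor at a time.
    coeff-product : ∀ N (F : ℕ → Series) (h : ℕ → ℕ → Seq) →
      (∀ k n i → ι (+ (n !)) ℚ.* coeff (F k n) i ≡ ι (h k n i)) →
      ∀ n i → ι (+ (n !)) ℚ.* coeff (foldr _⋆_ oneₛ (applyUpTo F N) n) i ≡ ι (productOf h N n i)
    coeff-product zero F h e n i = coeff-oneₛ n i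
    coeff-product (suc N) F h e n i = begin
      ι (+ (n !)) ℚ.* coeff ((F 0 ⋆ G) n) i
        ≡⟨ ≡.cong (ι (+ (n !)) ℚ.*_) (coeff-⋆ (F 0) G n i) ⟩
      ι (+ (n !)) ℚ.* ((coeff ∘ F 0) SQA.⊛ (coeff ∘ G)) n i
        ≡⟨ ×ₐ-at (n !) (((coeff ∘ F 0) SQA.⊛ (coeff ∘ G)) n) i ⟨
      HQA.egf ((coeff ∘ F 0) SQA.⊛ (coeff ∘ G)) n i
        ≡⟨ SQ.at (HQA.egf-⊛ (coeff ∘ F 0) (coeff ∘ G) n) i ⟩
      (HQA.egf (coeff ∘ F 0) HQA.⊠ HQA.egf (coeff ∘ G)) n i
        ≡⟨ SQ.at (HQA.⊠-cong
             (λ m → SQ.pointwise λ j → ≡.trans (×ₐ-at (m !) (coeff (F 0 m)) j) (e 0 m j))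
             (λ m → SQ.pointwise λ j → ≡.trans (×ₐ-at (m !) (coeff (G m)) j) (coeff-product N (F ∘ suc) (h ∘ suc) (e ∘ suc) m j))
             n) i ⟩
      ((λ m → ι ∘ h 0 m) HQA.⊠ (λ m → ι ∘ productOf (h ∘ suc) N m)) n i
        ≡⟨ ι-⊠ (h 0) (productOf (h ∘ suc) N) n i ⟨
      ι (productOf h (suc N) n i) ∎
      where G = foldr _⋆_ oneₛ (applyUpTo (F ∘ suc) N)

  coeff-pPoly : ∀ n i → coeff (pPoly n) i ≡ ι (integralProduct n n i)
  coeff-pPoly n i = begin
    coeff (ℕ→ℚ (n !) ·ₚ prodCoeff n) i
      ≡⟨ coeff-·ₚ (ℕ→ℚ (n !)) (prodCoeff n) i ⟩
    ℕ→ℚ (n !) ℚ.* coeff (prodCoeff n) i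
      ≡⟨ ≡.cong₂ (λ x Fs → x ℚ.* coeff (foldr _⋆_ oneₛ Fs n) i) (ℕ→ℚ≡ι (n !)) (map-upTo factor n) ⟩
    ι (+ (n !)) ℚ.* coeff (foldr _⋆_ oneₛ (applyUpTo factor n) n) i
      ≡⟨ coeff-product n factor integralFactor coeff-factor n i ⟩
    ι (integralProduct n n i) ∎

  -- Any bound past the length of the list gives the same count, as the extra terms are 0 and r is
  -- not.
  countCong≡count : ∀ {r} → ¬ r ≈ 0ℤ → ∀ f z → (∀ i → coeff f i ≡ ι (z i)) → ∀ {n} → length f ℕ.≤ n →
    countCong p r f ≡ count r n z
  countCong≡count r≉0 [] z e {n} _ = ≡.sym (Σ<-zero n λ i _ → indicator-zero r≉0 (congruent-0 i))
    where
    congruent-0 : ∀ i → z i ≈ 0ℤ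
    congruent-0 i = CommutativeRing.reflexive (ℤmod p) (ι-injective (≡.sym (e i)))
  -- Replacing `a` by `ι (z 0)` lets the test of the denominator in `congQ?` compute, and only the
  -- divisibility test remains.
  countCong≡count {r} r≉0 (a ∷ f) z e {suc n} (s≤s f≤n) with a | e 0
  ... | _ | ≡.refl with does (p ∣? ℤ.∣ z 0 ℤ.- r ∣)
  ...   | true  = ≡.cong suc (countCong≡count r≉0 f (z ∘ suc) (e ∘ suc) f≤n)
  ...   | false = countCong≡count r≉0 f (z ∘ suc) (e ∘ suc) f≤n

-- The two families of indices.

open import Data.Nat using (_*_; _^_; _≤_; _<_)

module _ {d : ℕ} (p-prime : Prime (2 ℕ.+ d)) where
  private
    p : ℕ
    p = 2 ℕ.+ d
  open Residues p-prime hiding (_^_)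
  open Polynomials (ℤmod p)
  open Differences (ℤmod p)
  open PrimeFactorial p-prime
  open IntegralFactors p-prime
  open PartitionSeries p-prime
  open Counting p-prime
  open Transfer p-prime

  -- This is the quantity x + y that separates the two cases: it vanishes modulo p exactly when P(p
  -- - 1) ≡ 1.
  extreme-coefficients : ∀ {N} → suc d ≤ suc N →
    integralProduct (suc N) (suc d) 0 ℤ.+ integralProduct (suc N) (suc d) (suc d) ≈ 1ℤ ℤ.- + P (suc d)
  extreme-coefficients {N} d≤N = begin
    integralProduct (suc N) (suc d) 0 ℤ.+ integralProduct (suc N) (suc d) (suc d)
      ≈⟨ +-cong (constant-integralProduct d≤N) (trans (leading-integralProduct N (suc d)) (even-power (suc d) ≡.refl)) ⟩
    + (suc d !) ℤ.* + P (suc d) ℤ.+ 1ℤ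
      ≈⟨ +-cong {u = 1ℤ} (*-cong {u = + P (suc d)} (wilson (suc d) ≡.refl) refl) refl ⟩
    -1ℤ ℤ.* + P (suc d) ℤ.+ 1ℤ
      ≡⟨ lemma (+ P (suc d)) ⟩
    1ℤ ℤ.- + P (suc d) ∎
    where
    open SetoidReasoning setoid
    lemma : ∀ x → -1ℤ ℤ.* x ℤ.+ 1ℤ ≡ 1ℤ ℤ.- x
    lemma = ℤSolver.solve-∀

  countCong-pPoly : ∀ k t {r} → ¬ r ≈ 0ℤ → let n = k * p ℕ.+ suc d in length (pPoly n) ≤ t →
    countCong p r (pPoly n) ≡ count r t (Δ^ (suc d) k (integralProduct n (suc d)))
  countCong-pPoly k t {r} r≉0 len≤t = begin
    countCong p r (pPoly n)
      ≡⟨ countCong≡count r≉0 (pPoly n) (integralProduct n n) (coeff-pPoly n) (ℕₚ.≤-trans len≤t (ℕₚ.m≤n+m t k)) ⟩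
    count r (k ℕ.+ t) (integralProduct n n)
      ≡⟨ count-cong r (k ℕ.+ t) factored ⟩
    count r (k ℕ.+ t) (shift k (Δ^ (suc d) k (integralProduct n (suc d))))
      ≡⟨ count-shift r≉0 k t (Δ^ (suc d) k (integralProduct n (suc d))) ⟩
    count r t (Δ^ (suc d) k (integralProduct n (suc d))) ∎
    where
    open ≡.≡-Reasoning
    n = k * p ℕ.+ suc d
    factored : ∀ i → integralProduct n n i ≈ shift k (Δ^ (suc d) k (integralProduct n (suc d))) i
    -- The number of factors has to be exhibited as a successor, so that the factor k = 1, which
    -- carries the eigenvalue, is present.
    factored i = ≡.subst (λ N → integralProduct N n i ≈ shift k (Δ^ (suc d) k (integralProduct N (suc d))) i)
      (≡.sym (ℕₚ.+-suc (k * p) d)) (integralProduct-* (suc d) ≡.refl (k * p ℕ.+ d) k (suc d) i)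

  EqualCounts : ℕ → Set
  EqualCounts n = ∀ {r s} → ¬ r ≈ 0ℤ → ¬ s ≈ 0ℤ → countCong p r (pPoly n) ≡ countCong p s (pPoly n)

  private
    extremes : ∀ k → integralProduct (k * p ℕ.+ suc d) (suc d) 0 ℤ.+ integralProduct (k * p ℕ.+ suc d) (suc d) (suc d)
             ≈ 1ℤ ℤ.- + P (suc d)
    extremes k = ≡.subst (λ N → integralProduct N (suc d) 0 ℤ.+ integralProduct N (suc d) (suc d) ≈ 1ℤ ℤ.- + P (suc d))
      (≡.sym (ℕₚ.+-suc (k * p) d)) (extreme-coefficients (s≤s (ℕₚ.m≤n+m d (k * p))))

  equalCounts : ¬ + P (suc d) ≈ 1ℤ → ∀ k j → k ℕ.+ 2 ≡ j * p → EqualCounts (k * p ℕ.+ suc d)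
  equalCounts P≉1 k j k+2≡ r≉0 s≉0 = ≡.trans (countCong-pPoly k t r≉0 len≤t)
    (≡.trans (Equidistributed-Δ^ (suc d) k j k+2≡ (Degree≤-integralProduct n (suc d)) s≉0′ m r≉0 s≉0)
      (≡.sym (countCong-pPoly k t s≉0 len≤t)))
    where
    n = k * p ℕ.+ suc d
    m = length (pPoly n)
    -- A multiple of p (p - 1) that is at least the length of the list: the p - 1 classes then have
    -- whole blocks of p terms, and the surplus terms are zeros.
    t = m * p * suc d
    len≤t : m ≤ t
    len≤t = ℕₚ.≤-trans (ℕₚ.m≤m*n m p) (ℕₚ.m≤m*n (m * p) (suc d))
    s≉0′ : ¬ integralProduct n (suc d) 0 ℤ.+ integralProduct n (suc d) (suc d) ≈ 0ℤ
    s≉0′ e = P≉1 (sym (a-b≈0⇒a≈b (trans (sym (extremes k)) e)))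

  equalCounts-degenerate : + P (suc d) ≈ 1ℤ → ∀ k k′ j → k ℕ.+ 2 ≡ (k′ ℕ.+ 1) * p → k′ ℕ.+ 2 ≡ j * p →
    EqualCounts (k * p ℕ.+ suc d)
  equalCounts-degenerate P≈1 k k′ j k+2≡ k′+2≡ r≉0 s≉0 = ≡.trans (countCong-pPoly k t r≉0 len≤t)
    (≡.trans (Equidistributed-Δ^-degenerate (suc d) k k′ j k+2≡ k′+2≡ (Degree≤-integralProduct n (suc d))
        (trans (extremes k) (a≈b⇒a-b≈0 (sym P≈1))) m r≉0 s≉0)
      (≡.sym (countCong-pPoly k t s≉0 len≤t)))
    where
    n = k * p ℕ.+ suc d
    m = length (pPoly n)
    t = m * p * p * suc d
    len≤t : m ≤ t
    len≤t = ℕₚ.≤-trans (ℕₚ.m≤m*n m p) (ℕₚ.≤-trans (ℕₚ.m≤m*n (m * p) p) (ℕₚ.m≤m*n (m * p * p) (suc d)))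

  private
    2≤jp : ∀ {j} → 1 ≤ j → 2 ≤ j * p
    2≤jp {suc j} _ = s≤s (s≤s z≤n)

    1≤k+1 : ∀ k → 1 ≤ k ℕ.+ 1
    1≤k+1 k = ℕₚ.m≤n+m 1 k

  -- The family comes from the condition k + 2 = p j, under which (1 - X)^(k + 2) is a power of 1 -
  -- X^p.
  index₁ : ∀ k j → k ℕ.+ 2 ≡ j * p → p ^ 2 * j ∸ p ∸ 1 ≡ k * p ℕ.+ suc d
  index₁ k j e = begin
    p ^ 2 * j ∸ p ∸ 1                                   ≡⟨ ≡.cong (λ x → x ∸ p ∸ 1) (begin
        p ^ 2 * j                                           ≡⟨ square p j ⟩
        j * p * p                                           ≡⟨ ≡.cong (_* p) e ⟨
        (k ℕ.+ 2) * p                                       ≡⟨ expand k d ⟩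
        k * p ℕ.+ suc d ℕ.+ 1 ℕ.+ p                         ∎) ⟩
    k * p ℕ.+ suc d ℕ.+ 1 ℕ.+ p ∸ p ∸ 1                 ≡⟨ ≡.cong (_∸ 1) (ℕₚ.m+n∸n≡m (k * p ℕ.+ suc d ℕ.+ 1) p) ⟩
    k * p ℕ.+ suc d ℕ.+ 1 ∸ 1                           ≡⟨ ℕₚ.m+n∸n≡m (k * p ℕ.+ suc d) 1 ⟩
    k * p ℕ.+ suc d                                     ∎
    where
    open ≡.≡-Reasoning
    square : ∀ p j → p * (p * 1) * j ≡ j * p * p
    square = ℕSolver.solve-∀
    expand : ∀ k d → (k ℕ.+ 2) * (2 ℕ.+ d) ≡ k * (2 ℕ.+ d) ℕ.+ (1 ℕ.+ d) ℕ.+ 1 ℕ.+ (2 ℕ.+ d)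
    expand = ℕSolver.solve-∀

  -- The second family is the first one with k′ + 1 = p j - 1 in place of j.
  index₂ : ∀ k k′ j → k ℕ.+ 2 ≡ (k′ ℕ.+ 1) * p → k′ ℕ.+ 2 ≡ j * p →
    p ^ 3 * j ∸ p ^ 2 ∸ p ∸ 1 ≡ k * p ℕ.+ suc d
  index₂ k k′ j e e′ = begin
    p ^ 3 * j ∸ p ^ 2 ∸ p ∸ 1                           ≡⟨ ≡.cong (λ x → x ∸ p ∸ 1) (begin
        p ^ 3 * j ∸ p ^ 2                                   ≡⟨ ≡.cong (_∸ p ^ 2) (begin
          p ^ 3 * j                                             ≡⟨ cube p j ⟩
          j * p * p * p                                         ≡⟨ ≡.cong (λ x → x * p * p) e′ ⟨
          (k′ ℕ.+ 2) * p * p                                    ≡⟨ split k′ p ⟩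
          (k′ ℕ.+ 1) * p * p ℕ.+ p ^ 2                          ∎) ⟩
        (k′ ℕ.+ 1) * p * p ℕ.+ p ^ 2 ∸ p ^ 2                ≡⟨ ℕₚ.m+n∸n≡m ((k′ ℕ.+ 1) * p * p) (p ^ 2) ⟩
        (k′ ℕ.+ 1) * p * p                                  ≡⟨ square p (k′ ℕ.+ 1) ⟨
        p ^ 2 * (k′ ℕ.+ 1)                                  ∎) ⟩
    p ^ 2 * (k′ ℕ.+ 1) ∸ p ∸ 1                          ≡⟨ index₁ k (k′ ℕ.+ 1) e ⟩
    k * p ℕ.+ suc d                                     ∎
    where
    open ≡.≡-Reasoning
    square : ∀ p j → p * (p * 1) * j ≡ j * p * p
    square = ℕSolver.solve-∀
    cube : ∀ p j → p * (p * (p * 1)) * j ≡ j * p * p * p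
    cube = ℕSolver.solve-∀
    split : ∀ k p → (k ℕ.+ 2) * p * p ≡ (k ℕ.+ 1) * p * p ℕ.+ p * (p * 1)
    split = ℕSolver.solve-∀

  equalCounts₁ : ¬ + P (suc d) ≈ 1ℤ → ∀ j → 1 ≤ j → EqualCounts (p ^ 2 * j ∸ p ∸ 1)
  equalCounts₁ P≉1 j 1≤j = ≡.subst EqualCounts (≡.sym (index₁ k j e)) (equalCounts P≉1 k j e)
    where
    k = j * p ∸ 2
    e = ℕₚ.m∸n+n≡m (2≤jp 1≤j)

  equalCounts₂ : + P (suc d) ≈ 1ℤ → ∀ j → 1 ≤ j → EqualCounts (p ^ 3 * j ∸ p ^ 2 ∸ p ∸ 1)
  equalCounts₂ P≈1 j 1≤j =
    ≡.subst EqualCounts (≡.sym (index₂ k k′ j e e′)) (equalCounts-degenerate P≈1 k k′ j e e′)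
    where
    k′ = j * p ∸ 2
    k = (k′ ℕ.+ 1) * p ∸ 2
    e′ = ℕₚ.m∸n+n≡m (2≤jp 1≤j)
    e = ℕₚ.m∸n+n≡m (2≤jp (1≤k+1 k′))

theorem3p3 : (p : ℕ) → Prime p →
    ((¬ (IntCong (+ P (p ∸ 1)) (+ 1) p) →
    (j : ℕ) → 1 ≤ j →
    (r s : ℕ) → 1 ≤ r → r < p → 1 ≤ s → s < p →
    countCong p (+ r) (pPoly (p ^ 2 * j ∸ p ∸ 1))
    ≡ countCong p (+ s) (pPoly (p ^ 2 * j ∸ p ∸ 1)))
    ×
    ((IntCong (+ P (p ∸ 1)) (+ 1) p) →
    (j : ℕ) → 1 ≤ j →
    (r s : ℕ) → 1 ≤ r → r < p → 1 ≤ s → s < p →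
    countCong p (+ r) (pPoly (p ^ 3 * j ∸ p ^ 2 ∸ p ∸ 1))
    ≡ countCong p (+ s) (pPoly (p ^ 3 * j ∸ p ^ 2 ∸ p ∸ 1))))
theorem3p3 zero p-prime = contradiction p-prime ¬prime[0]
theorem3p3 (suc zero) p-prime = contradiction p-prime ¬prime[1]
theorem3p3 (suc (suc d)) p-prime =
    (λ P≢1 j 1≤j r s 1≤r r<p 1≤s s<p → equalCounts₁ p-prime
      (λ (congruent P≡1) → P≢1 (ℤDiv.∣⇒∣ᵤ P≡1)) j 1≤j (small≉0 1≤r r<p) (small≉0 1≤s s<p))
  , (λ P≡1 j 1≤j r s 1≤r r<p 1≤s s<p → equalCounts₂ p-prime
      (congruent (ℤDiv.∣ᵤ⇒∣ P≡1)) j 1≤j (small≉0 1≤r r<p) (small≉0 1≤s s<p))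
  where open Residues p-prime using (small≉0)
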